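{- Let $\alpha$ be a weak composition and $\varphi$ a flag. If $\varphi$ is strictly increasing, then $\kappa_{(\alpha,\varphi)}=\kappa_\beta$, where $\beta_j=\alpha_i$ if $\varphi(i)=j$ for some $i$, and $\beta_j=0$ otherwise. If $\varphi$ is not strictly increasing and $i$ is the smallest index with $\varphi(i)=\varphi(i+1)$, then $$\kappa_{(\alpha,\varphi)}=\begin{cases}\kappa_{(\alpha,\varphi-\mathbf e_i)}&\text{if }\alpha_i\le\alpha_{i+1},\\ \kappa_{(\alpha\cdot s_i,\varphi-\mathbf e_i)}&\text{if }\alpha_i>\alpha_{i+1}.\end{cases}$$
   Context: Tableaux: fillings by positive integers of finite sets of boxes (row $r$, column $c\in\mathbb{Z}_{>0}$), rows left-justified, rows indexed upward; $T_{rc}$ is an entry; shape = weak composition of row lengths. $\mathsf{wt}(T)=(\beta_1,\beta_2,\dots)$ with $\beta_i$ the number of entries equal to $i$. A flag is a weakly increasing $\varphi:\mathbb{Z}_{>0}\to\mathbb{Z}_{>0}$ with $\varphi(m)\ge m$; $(\varphi-\mathbf e_i)(l)=\varphi(l)-\delta_{il}$. A key tableau: (a) rows weakly decreasing left to right; (b) columns with distinct entries; (c) if boxes $(i,j),(k,j)$ with $i<k$ have $T_{ij}>T_{kj}$ then $(i,j+1)$ is a box with $T_{i,j+1}>T_{kj}$. $\varphi$-flagged: $T_{ij}\le\varphi(i)$ for all boxes. $\mathrm{SSKT}(\alpha,\varphi)$: $\varphi$-flagged key tableaux of shape $\alpha$; $\kappa_{(\alpha,\varphi)}=\sum_{T\in\mathrm{SSKT}(\alpha,\varphi)}x^{\mathsf{wt}(T)}$.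 Key polynomials: $\pi_if=\partial_i(x_if)$, $\partial_if=(f-s_if)/(x_i-x_{i+1})$; $\pi_w=\pi_{i_1}\cdots\pi_{i_m}$ for a reduced word of $w$; $\alpha\cdot s_i$ swaps $\alpha_i$ and $\alpha_{i+1}$; $\kappa_\alpha=\pi_wx^\lambda$ with $w$ of minimal length such that $\alpha\cdot w=\lambda$ is a partition. -}

module Defs where

open import Data.Bool using (Bool; true; false; if_then_else_; _∧_; _∨_; not)
open import Data.Nat using (ℕ; zero; suc; _+_; _*_; _∸_; _⊔_; _⊓_; _≤ᵇ_; _<ᵇ_; _≡ᵇ_; _≤_; _<_)
open import Data.Integer as ℤ using (ℤ; +_; -_)
open import Data.List using (List; []; _∷_; map; concatMap; upTo; length; filter; foldr)
open import Data.Maybe using (Maybe; just; nothing)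
open import Data.Product using (_×_; _,_)
open import Relation.Binary.PropositionalEquality using (_≡_)
open import Relation.Nullary.Decidable using (Dec)
import Data.Bool.Properties as BP

-- Weak compositions / exponent vectors as finite lists.
-- Position 1 of the paper is the head of the list; entries beyond the
-- end of the list are 0.  Indices are 1-based; index 0 is junk (never used).

idx0 : List ℕ → ℕ → ℕ
idx0 []       _       = 0
idx0 (x ∷ xs) zero    = x
idx0 (x ∷ xs) (suc k) = idx0 xs k

at : List ℕ → ℕ → ℕ
at l zero    = 0
at l (suc k) = idx0 l k

upd0 : List ℕ → ℕ → ℕ → List ℕ
upd0 []       zero    v = v ∷ []
upd0 []       (suc k) v = 0 ∷ upd0 [] k v
upd0 (x ∷ xs) zero    v = v ∷ xs
upd0 (x ∷ xs) (suc k) v = x ∷ upd0 xs k v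

upd : List ℕ → ℕ → ℕ → List ℕ
upd l zero    v = l
upd l (suc k) v = upd0 l k v

_·s_ : List ℕ → ℕ → List ℕ
α ·s i = upd (upd α i (at α (suc i))) (suc i) (at α i)

all : {A : Set} → (A → Bool) → List A → Bool
all p []       = true
all p (x ∷ xs) = p x ∧ all p xs

range1 : ℕ → List ℕ
range1 n = map suc (upTo n)

-- Polynomials in x_1, x_2, ... with integer coefficients, as formal sums
-- of terms (coefficient , exponent vector).  Two polynomials are equal
-- when all their coefficients agree.

Mon : Set
Mon = List ℕ

Poly : Set
Poly = List (ℤ × Mon)

monEq : Mon → Mon → Bool
monEq []       []       = true
monEq []       (y ∷ ys) = (y ≡ᵇ 0) ∧ monEq [] ys
monEq (x ∷ xs) []       = (x ≡ᵇ 0) ∧ monEq xs []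
monEq (x ∷ xs) (y ∷ ys) = (x ≡ᵇ y) ∧ monEq xs ys

coeff : Poly → Mon → ℤ
coeff []             γ = + 0
coeff ((c , m) ∷ ps) γ = (if monEq m γ then c else + 0) ℤ.+ coeff ps γ

_≈ₚ_ : Poly → Poly → Set
p ≈ₚ q = ∀ (γ : Mon) → coeff p γ ≡ coeff q γ

infix 4 _≈ₚ_

monomial : Mon → Poly
monomial α = (+ 1 , α) ∷ []

mulX : ℕ → Poly → Poly
mulX i = map (λ { (c , m) → (c , upd m i (suc (at m i))) })

-- divided difference ∂_i on a monomial x^m, written out explicitly:
-- with p = m_i, q = m_{i+1},  (x_i^p x_{i+1}^q - x_i^q x_{i+1}^p)/(x_i - x_{i+1}) =
--   p > q :   Σ_{k=0}^{p-q-1}  x_i^{p-1-k} x_{i+1}^{q+k}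
--   p = q :   0
--   p < q : - Σ_{k=0}^{q-p-1}  x_i^{p+k} x_{i+1}^{q-1-k}
∂mon : ℕ → Mon → Poly
∂mon i m =
  if q <ᵇ p then map (λ k → (+ 1 , setPair (p ∸ 1 ∸ k) (q + k))) (upTo (p ∸ q))
  else (if p <ᵇ q then map (λ k → (- (+ 1) , setPair (p + k) (q ∸ 1 ∸ k))) (upTo (q ∸ p))
  else [])
  where
    p = at m i
    q = at m (suc i)
    setPair : ℕ → ℕ → Mon
    setPair a b = upd (upd m i a) (suc i) b

∂ : ℕ → Poly → Poly
∂ i = concatMap (λ { (c , m) → map (λ { (d , m') → (c ℤ.* d , m') }) (∂mon i m) })

π : ℕ → Poly → Poly
π i f = ∂ i (mulX i f)

-- Key polynomials κ_α = π_w x^λ, w minimal with α·w = λ a partition.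
-- A reduced word for this (unique) minimal w is obtained by repeatedly
-- swapping the first ascent: if i is the first index with α_i < α_{i+1}
-- then w = s_i w' with w' minimal for α·s_i, so κ_α = π_i κ_{α·s_i};
-- if α has no ascent, α = λ and κ_α = x^λ.  Each step removes exactly one
-- inversion, so (length α)^2 steps of fuel always suffice.

firstAscent : List ℕ → Maybe ℕ
firstAscent (a ∷ b ∷ rest) =
  if a <ᵇ b then just 1 else Data.Maybe.map suc (firstAscent (b ∷ rest))
firstAscent _ = nothing

keyAux : ℕ → List ℕ → Poly
keyAux zero    α = monomial α
keyAux (suc f) α with firstAscent α
... | nothing = monomial α
... | just i  = π i (keyAux f (α ·s i))

κ : List ℕ → Poly
κ α = keyAux (length α * length α) α

-- Flags (1-based): φ : ℕ → ℕ, only values at m ≥ 1 matter.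

IsFlag : (ℕ → ℕ) → Set
IsFlag φ = (∀ m → 1 ≤ m → φ m ≤ φ (suc m)) × (∀ m → 1 ≤ m → m ≤ φ m)

_-e_ : (ℕ → ℕ) → ℕ → (ℕ → ℕ)
(φ -e i) l = if l ≡ᵇ i then φ l ∸ 1 else φ l

-- Tableaux of shape α: list of rows (row r is the r-th element, r ≥ 1),
-- row r a list of α_r entries, T_rc = entry c of row r (1-based).

Tableau : Set
Tableau = List (List ℕ)

rowOf : Tableau → ℕ → List ℕ
rowOf []       _       = []
rowOf (x ∷ xs) zero    = x
rowOf (x ∷ xs) (suc k) = rowOf xs k

ent : Tableau → ℕ → ℕ → ℕ
ent T r c = at (rowOf T (r ∸ 1)) c

box : List ℕ → ℕ → ℕ → Bool
box α r c = (1 ≤ᵇ r) ∧ (1 ≤ᵇ c) ∧ (c ≤ᵇ at α r)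

condA : List ℕ → Tableau → Bool
condA α T = all (λ r → all (λ c → ent T r (suc c) ≤ᵇ ent T r c)
                           (range1 (at α r ∸ 1)))
                (range1 (length α))

pairCond : List ℕ → Tableau → ℕ → ℕ → ℕ → Bool
pairCond α T i k c =
  not (ent T i c ≡ᵇ ent T k c)
  ∧ (if ent T k c <ᵇ ent T i c
     then box α i (suc c) ∧ (ent T k c <ᵇ ent T i (suc c))
     else true)

condBC : List ℕ → Tableau → Bool
condBC α T =
  all (λ i → all (λ k → if i <ᵇ k
                        then all (λ c → pairCond α T i k c) (range1 (at α i ⊓ at α k))
                        else true)
                 (range1 (length α)))
      (range1 (length α))

flagged : List ℕ → (ℕ → ℕ) → Tableau → Bool
flagged α φ T = all (λ r → all (λ c → (1 ≤ᵇ ent T r c) ∧ (ent T r c ≤ᵇ φ r))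
                               (range1 (at α r)))
                    (range1 (length α))

isSSKT : List ℕ → (ℕ → ℕ) → Tableau → Bool
isSSKT α φ T = condA α T ∧ condBC α T ∧ flagged α φ T

rowsOf : ℕ → ℕ → List (List ℕ)
rowsOf zero    b = [] ∷ []
rowsOf (suc l) b = concatMap (λ x → map (x ∷_) (rowsOf l b)) (range1 b)

fillingsFrom : (ℕ → ℕ) → ℕ → List ℕ → List Tableau
fillingsFrom φ r []       = [] ∷ []
fillingsFrom φ r (a ∷ as) =
  concatMap (λ row → map (row ∷_) (fillingsFrom φ (suc r) as)) (rowsOf a (φ r))

-- SSKT(α, φ), as a list without repetitions
SSKT : List ℕ → (ℕ → ℕ) → List Tableau
SSKT α φ = filter (λ T → BP.T? (isSSKT α φ T)) (fillingsFrom φ 1 α)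

count : ℕ → Tableau → ℕ
count i = foldr (λ row n → foldr (λ x m → (if x ≡ᵇ i then 1 else 0) + m) n row) 0

maxEnt : Tableau → ℕ
maxEnt = foldr (λ row n → foldr _⊔_ n row) 0

wt : Tableau → Mon
wt T = map (λ i → count i T) (range1 (maxEnt T))

κφ : List ℕ → (ℕ → ℕ) → Poly
κφ α φ = map (λ T → (+ 1 , wt T)) (SSKT α φ)

{-# OPTIONS --safe #-}
-- Read a key tableau column by column, from right to left, an absent box being an
-- entry 0.  Conditions (a)-(c) become a relation Adj between consecutive columns,
-- and only the first column sees the flag, since rows decrease.  So κ_(α,φ) is the
-- sum, over the first columns T ≤ φ, of the generating function G(T) of the
-- tableaux starting with T, and G is computed by a recursion over columns.
--
-- If φ(i) = φ(i+1) and α_i ≤ α_{i+1}, then row i lies strictly below row i+1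
-- entrywise, which allows φ to be lowered.  If α_i > α_{i+1}, then exchanging rows i
-- and i+1 of the shape preserves the sum of G over T and its row exchange.
--
-- For κ_β, the value exchange s of i and i+1 satisfies: G(T) + G(sT) is symmetric in
-- x_i, x_{i+1}, and x_i G(T) is symmetric when i+1 occurs in T below every i.  Hence
-- raising the bound of row i from i to i+1 applies the Demazure operator π_i, and the
-- row exchange then gives the recursion that defines κ_β.
module Submission where

open import Defs
open import Data.Bool using (Bool; true; false; if_then_else_; _∧_; not) renaming (T to True)
import Data.Bool.Properties as BP
open import Data.Empty using (⊥; ⊥-elim)
open import Data.Integer as ℤ using (ℤ; -_) renaming (+_ to infix 8 ⁺_)
import Data.Integer.Properties as ℤP
import Data.Integer.Tactic.RingSolver as ℤ-Solver
open import Data.List as List using (List; []; _∷_; concatMap; upTo; length; filter; _++_)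
open import Data.List.Membership.Propositional using (_∈_)
open import Data.List.Properties using (map-upTo)
open import Data.List.Relation.Unary.All as AllL using ([]; _∷_)
import Data.List.Relation.Unary.All.Properties as AllLP
open import Data.List.Relation.Unary.AllPairs using (AllPairs; []; _∷_)
open import Data.List.Relation.Unary.Any using (here; there)
open import Data.Maybe using (just; nothing)
open import Data.Maybe.Properties using (just-injective)
open import Data.Nat
open import Data.Nat.Induction using (<-rec)
open import Data.Nat.ListAction using (sum)
open import Data.Nat.Properties
import Data.Nat.Tactic.RingSolver as ℕ-Solver
open import Data.Product using (_×_; _,_; proj₁; proj₂; ∃)
open import Data.Sum as Sum using (_⊎_; inj₁; inj₂)
open import Data.Unit using (⊤; tt)
open import Data.Vec as Vec using (Vec; []; _∷_; toList)
open import Data.Vec.Properties using (≡-dec)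
open import Data.Vec.Relation.Unary.All as AllV using (All; []; _∷_)
open import Function using (_∘_; id; Equivalence)
open import Relation.Binary.Definitions using (tri<; tri≈; tri>)
open import Relation.Binary.PropositionalEquality
open import Relation.Nullary using (Dec; yes; no; does; ¬_; ¬?; _×-dec_; _⊎-dec_)
open import Relation.Unary using (Decidable)
open import Algebra.Properties.AbelianGroup ℤP.+-0-abelianGroup using () renaming (∙-cancelʳ to ℤ-cancelʳ)
open import Algebra.Properties.CommutativeSemigroup +-commutativeSemigroup using (interchange; xy∙z≈xz∙y; x∙yz≈y∙xz)

-- Why `π_i` appears: let F be the generating function for the identity flag, H the one with the
-- bound of row i raised to i+1, and R = H - F. No bound of the raised flag equals i, so the value
-- exchange preserves it on first columns, and pairing T with sT makes H symmetric. The columns that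
-- contribute to R have i+1 in row i and no i below, so x_i R is symmetric. Hence π_i R = ∂_i(x_i R)
-- = 0 and π_i F = π_i H = H.
--
-- The obstacle is that one G(T) need not be symmetric, and no bijection of tableaux is constructed.
-- Both symmetry statements are therefore proved by one simultaneous induction on the number of
-- columns, and a sum is shown symmetric by adding its image under an exchange and halving. All
-- these series have natural coefficients, so differences are replaced by cancellation, and integers
-- enter only with the divided differences.
--
-- At an ascent of β the bound is raised, the rows are exchanged and the bound is lowered again,
-- which leads back to the identity flag. A strictly increasing flag is the identity flag once empty
-- rows are inserted.

private variable
  n   : ℕ
  A C : Set
  P Q : Set

-- Finite sums

∑ : List A → (A → ℕ) → ℕ
∑ []       f = 0
∑ (x ∷ xs) f = f x + ∑ xs f

∑-cong : (xs : List A) {f g : A → ℕ} → (∀ x → f x ≡ g x) → ∑ xs f ≡ ∑ xs g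
∑-cong []       e = refl
∑-cong (x ∷ xs) e = cong₂ _+_ (e x) (∑-cong xs e)

∑-cong-All : {P : A → Set} {xs : List A} {f g : A → ℕ} → AllL.All P xs →
             (∀ x → P x → f x ≡ g x) → ∑ xs f ≡ ∑ xs g
∑-cong-All []       e = refl
∑-cong-All (p ∷ ps) e = cong₂ _+_ (e _ p) (∑-cong-All ps e)

∑-++ : (xs ys : List A) (f : A → ℕ) → ∑ (xs ++ ys) f ≡ ∑ xs f + ∑ ys f
∑-++ []       ys f = refl
∑-++ (x ∷ xs) ys f = trans (cong (f x +_) (∑-++ xs ys f)) (sym (+-assoc (f x) _ _))

∑-map : (h : A → C) (xs : List A) (f : C → ℕ) → ∑ (List.map h xs) f ≡ ∑ xs (f ∘ h)
∑-map h []       f = refl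
∑-map h (x ∷ xs) f = cong (f (h x) +_) (∑-map h xs f)

∑-concatMap : (h : A → List C) (xs : List A) (f : C → ℕ) →
              ∑ (concatMap h xs) f ≡ ∑ xs (λ x → ∑ (h x) f)
∑-concatMap h []       f = refl
∑-concatMap h (x ∷ xs) f = trans (∑-++ (h x) _ f) (cong (∑ (h x) f +_) (∑-concatMap h xs f))

∑-zero : (xs : List A) {f : A → ℕ} → (∀ x → f x ≡ 0) → ∑ xs f ≡ 0
∑-zero []       e = refl
∑-zero (x ∷ xs) e = cong₂ _+_ (e x) (∑-zero xs e)

∑-+ : (xs : List A) (f g : A → ℕ) → ∑ xs (λ x → f x + g x) ≡ ∑ xs f + ∑ xs g
∑-+ []       f g = refl
∑-+ (x ∷ xs) f g = trans (cong (f x + g x +_) (∑-+ xs f g)) (interchange (f x) (g x) _ _)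

∑-* : (c : ℕ) (xs : List A) (f : A → ℕ) → ∑ xs (λ x → c * f x) ≡ c * ∑ xs f
∑-* c []       f = sym (*-zeroʳ c)
∑-* c (x ∷ xs) f = trans (cong (c * f x +_) (∑-* c xs f)) (sym (*-distribˡ-+ c (f x) _))

∑-comm : (xs : List A) (ys : List C) (f : A → C → ℕ) →
         ∑ xs (λ x → ∑ ys (f x)) ≡ ∑ ys (λ y → ∑ xs (λ x → f x y))
∑-comm []       ys f = sym (∑-zero ys λ _ → refl)
∑-comm (x ∷ xs) ys f = trans (cong (∑ ys (f x) +_) (∑-comm xs ys f)) (sym (∑-+ ys (f x) _))

∑-upTo-suc : (n : ℕ) (f : ℕ → ℕ) → ∑ (upTo (suc n)) f ≡ f 0 + ∑ (upTo n) (f ∘ suc)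
∑-upTo-suc n f =
  cong (f 0 +_) (trans (cong (λ xs → ∑ xs f) (sym (map-upTo suc n))) (∑-map suc (upTo n) f))

∑-upTo-single : (n v : ℕ) (f : ℕ → ℕ) → v < n → (∀ k → k ≢ v → f k ≡ 0) → ∑ (upTo n) f ≡ f v
∑-upTo-single (suc n) zero f v<n e =
  trans (∑-upTo-suc n f)
        (trans (cong (f 0 +_) (∑-zero (upTo n) λ k → e (suc k) λ ())) (+-identityʳ (f 0)))
∑-upTo-single (suc n) (suc v) f v<n e =
  trans (∑-upTo-suc n f)
        (cong₂ _+_ (e 0 λ ())
                   (∑-upTo-single n v (f ∘ suc) (s<s⁻¹ v<n) λ k k≢v → e (suc k) (k≢v ∘ suc-injective)))

-- Indicators

ind : Dec P → ℕ
ind d = if does d then 1 else 0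

ind-yes : (d : Dec P) → P → ind d ≡ 1
ind-yes (yes _) p = refl
ind-yes (no ¬p) p = ⊥-elim (¬p p)

ind-no : (d : Dec P) → ¬ P → ind d ≡ 0
ind-no (yes p) ¬p = ⊥-elim (¬p p)
ind-no (no _)  ¬p = refl

ind-⇔ : (d : Dec P) (e : Dec Q) → (P → Q) → (Q → P) → ind d ≡ ind e
ind-⇔ (yes p) e f g = sym (ind-yes e (f p))
ind-⇔ (no ¬p) e f g = sym (ind-no e (¬p ∘ g))

ind-× : (d : Dec P) (e : Dec Q) → ind (d ×-dec e) ≡ ind d * ind e
ind-× (yes _) e = sym (+-identityʳ (ind e))
ind-× (no _)  e = refl

ind-⊎ : (d : Dec P) (e : Dec Q) → ¬ (P × Q) → ind (d ⊎-dec e) ≡ ind d + ind e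
ind-⊎ (yes p) e ¬pq = cong suc (sym (ind-no e (λ q → ¬pq (p , q))))
ind-⊎ (no _)  e ¬pq = refl

ind*-zero : (d : Dec P) {x : ℕ} → (P → x ≡ 0) → ind d * x ≡ 0
ind*-zero (yes p) e = trans (+-identityʳ _) (e p)
ind*-zero (no _)  e = refl

ind*-cong : (d : Dec P) {x y : ℕ} → (P → x ≡ y) → ind d * x ≡ ind d * y
ind*-cong (yes p) e = cong (1 *_) (e p)
ind*-cong (no _)  e = refl

∑-filter : {P : A → Set} (P? : Decidable P) (xs : List A) (f : A → ℕ) →
           ∑ (filter P? xs) f ≡ ∑ xs (λ x → ind (P? x) * f x)
∑-filter P? []       f = refl
∑-filter P? (x ∷ xs) f with P? x
... | yes _ = cong₂ _+_ (sym (+-identityʳ (f x))) (∑-filter P? xs f)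
... | no _  = ∑-filter P? xs f

-- Adjacent transpositions

τ : ℕ → ℕ → ℕ
τ zero    0             = 1
τ zero    1             = 0
τ zero    (suc (suc k)) = suc (suc k)
τ (suc i) 0             = 0
τ (suc i) (suc k)       = suc (τ i k)

τ-invol : ∀ i k → τ i (τ i k) ≡ k
τ-invol zero    0             = refl
τ-invol zero    1             = refl
τ-invol zero    (suc (suc k)) = refl
τ-invol (suc i) 0             = refl
τ-invol (suc i) (suc k)       = cong suc (τ-invol i k)

τ-fst : ∀ i → τ i i ≡ suc i
τ-fst zero    = refl
τ-fst (suc i) = cong suc (τ-fst i)

τ-snd : ∀ i → τ i (suc i) ≡ i
τ-snd zero    = refl
τ-snd (suc i) = cong suc (τ-snd i)

τ-other : ∀ i k → k ≢ i → k ≢ suc i → τ i k ≡ k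
τ-other zero    0             p q = ⊥-elim (p refl)
τ-other zero    1             p q = ⊥-elim (q refl)
τ-other zero    (suc (suc k)) p q = refl
τ-other (suc i) 0             p q = refl
τ-other (suc i) (suc k)       p q = cong suc (τ-other i k (p ∘ cong suc) (q ∘ cong suc))

-- Indexed by the argument and by the value, so that matching on `τ i k` together with its view
-- replaces both in the goal.
data τ-View (i : ℕ) : ℕ → ℕ → Set where
  fst-view   : τ-View i i (suc i)
  snd-view   : τ-View i (suc i) i
  other-view : ∀ {k} → k ≢ i → k ≢ suc i → τ-View i k k

τ-view : ∀ i k → τ-View i k (τ i k)
τ-view i k with k ≟ i | k ≟ suc i
... | yes refl | _        = subst (τ-View i i) (sym (τ-fst i)) fst-view
... | no _     | yes refl = subst (τ-View i (suc i)) (sym (τ-snd i)) snd-view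
... | no p     | no q     = subst (τ-View i k) (sym (τ-other i k p q)) (other-view p q)

≤∧≢⇒suc≤ : ∀ {x y} → x ≤ y → y ≢ x → suc x ≤ y
≤∧≢⇒suc≤ x≤y y≢x = ≤∧≢⇒< x≤y (y≢x ∘ sym)

-- `τ i` moves a number by at most one and raises only `i`, so just one pair of values can spoil the
-- inequality. This lemma and the next five isolate that pair; the adjacency arguments below then
-- only have to exclude it or repair it.
τ-monoˡ-≤ : ∀ i {x y} → x ≤ y → (x ≡ i × y ≡ i) ⊎ τ i x ≤ y
τ-monoˡ-≤ i {x} {y} x≤y with τ i x | τ-view i x
... | _ | other-view _ _ = inj₂ x≤y
... | _ | snd-view       = inj₂ (≤-trans (n≤1+n i) x≤y)
... | _ | fst-view with y ≟ i
...   | yes refl = inj₁ (refl , refl)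
...   | no y≢i   = inj₂ (≤∧≢⇒suc≤ x≤y y≢i)

τ-monoʳ-≤ : ∀ i {x y} → x ≤ y → (x ≡ suc i × y ≡ suc i) ⊎ x ≤ τ i y
τ-monoʳ-≤ i {x} {y} x≤y with τ i y | τ-view i y
... | _ | other-view _ _ = inj₂ x≤y
... | _ | fst-view       = inj₂ (≤-trans x≤y (n≤1+n i))
... | _ | snd-view with x ≟ suc i
...   | yes refl = inj₁ (refl , refl)
...   | no x≢    = inj₂ (≤-pred (≤∧≢⇒< x≤y x≢))

τ-monoʳ-< : ∀ i {x y} → x < y → (x ≡ i × y ≡ suc i) ⊎ x < τ i y
τ-monoʳ-< i x<y with τ-monoʳ-≤ i x<y
... | inj₁ (refl , q) = inj₁ (refl , q)
... | inj₂ q          = inj₂ q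

τ-monoˡ-< : ∀ i {x y} → x < y → (x ≡ i × y ≡ suc i) ⊎ τ i x < y
τ-monoˡ-< i {x} {y} x<y with τ i x | τ-view i x
... | _ | other-view _ _ = inj₂ x<y
... | _ | snd-view       = inj₂ (≤-trans (n≤1+n (suc i)) x<y)
... | _ | fst-view with y ≟ suc i
...   | yes refl = inj₁ (refl , refl)
...   | no y≢    = inj₂ (≤∧≢⇒suc≤ x<y y≢)

τ-mono-< : ∀ i {x y} → x < y → (x ≡ i × y ≡ suc i) ⊎ τ i x < τ i y
τ-mono-< i {x} {y} x<y with τ i x | τ-view i x
... | _ | other-view x≢i _ with τ-monoʳ-< i x<y
...   | inj₁ (p , _) = ⊥-elim (x≢i p)
...   | inj₂ q       = inj₂ q
τ-mono-< i {x} {y} x<y | _ | snd-view with τ i y | τ-view i y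
...   | _ | fst-view       = ⊥-elim (<-asym x<y (n<1+n i))
...   | _ | snd-view       = ⊥-elim (<-irrefl refl x<y)
...   | _ | other-view _ _ = inj₂ (<-trans (n<1+n i) x<y)
τ-mono-< i {x} {y} x<y | _ | fst-view with τ i y | τ-view i y
...   | _ | fst-view       = ⊥-elim (<-irrefl refl x<y)
...   | _ | snd-view       = inj₁ (refl , refl)
...   | _ | other-view _ q = inj₂ (≤∧≢⇒suc≤ x<y q)

τ-mono-≤ : ∀ i {x y} → x ≤ y → (x ≡ i × y ≡ suc i) ⊎ τ i x ≤ τ i y
τ-mono-≤ i {x} {y} x≤y with x ≟ y
... | yes refl = inj₂ ≤-refl
... | no x≢y with τ-mono-< i (≤∧≢⇒< x≤y x≢y)
...   | inj₁ p = inj₁ p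
...   | inj₂ q = inj₂ (<⇒≤ q)

∑-upTo-τ : ∀ i n (f : ℕ → ℕ) → suc i < n → ∑ (upTo n) (f ∘ τ i) ≡ ∑ (upTo n) f
∑-upTo-τ zero (suc (suc n)) f i<n =
  trans (split (f ∘ τ 0)) (trans (x∙yz≈y∙xz (f 1) (f 0) _) (sym (split f)))
  where
  split : ∀ g → ∑ (upTo (suc (suc n))) g ≡ g 0 + (g 1 + ∑ (upTo n) (g ∘ suc ∘ suc))
  split g = trans (∑-upTo-suc (suc n) g) (cong (g 0 +_) (∑-upTo-suc n (g ∘ suc)))
∑-upTo-τ zero (suc zero) f (s≤s ())
∑-upTo-τ (suc i) (suc n) f i<n =
  trans (∑-upTo-suc n (f ∘ τ (suc i)))
        (trans (cong (f 0 +_) (∑-upTo-τ i n (f ∘ suc) (s<s⁻¹ i<n))) (sym (∑-upTo-suc n f)))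

-- Columns

ix : Vec ℕ n → ℕ → ℕ
ix []      _       = 0
ix (x ∷ v) zero    = x
ix (x ∷ v) (suc k) = ix v k

ix-≥ : (T : Vec ℕ n) → ∀ {r} → n ≤ r → ix T r ≡ 0
ix-≥ []      _       = refl
ix-≥ (x ∷ T) (s≤s p) = ix-≥ T p

ix≢0⇒< : (T : Vec ℕ n) → ∀ {r} → ix T r ≢ 0 → r < n
ix≢0⇒< {n} T {r} p with r <? n
... | yes r<n = r<n
... | no r≮n  = ⊥-elim (p (ix-≥ T (≮⇒≥ r≮n)))

ix-ext : (S T : Vec ℕ n) → (∀ r → r < n → ix S r ≡ ix T r) → S ≡ T
ix-ext []      []      e = refl
ix-ext (x ∷ S) (y ∷ T) e = cong₂ _∷_ (e 0 z<s) (ix-ext S T (λ r r<n → e (suc r) (s<s r<n)))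

All⇒ix : ∀ {P : ℕ → Set} {v : Vec ℕ n} → All P v → P 0 → ∀ k → P (ix v k)
All⇒ix []       p0 k       = p0
All⇒ix (p ∷ ps) p0 zero    = p
All⇒ix (p ∷ ps) p0 (suc k) = All⇒ix ps p0 k

ix⇒All : ∀ {P : ℕ → Set} (v : Vec ℕ n) → (∀ k → P (ix v k)) → All P v
ix⇒All []      f = []
ix⇒All (x ∷ v) f = f 0 ∷ ix⇒All v (f ∘ suc)

val-swap : ℕ → Vec ℕ n → Vec ℕ n
val-swap i = Vec.map (τ (suc i))

ix-val-swap : ∀ i (T : Vec ℕ n) r → ix (val-swap i T) r ≡ τ (suc i) (ix T r)
ix-val-swap i []      r       = refl
ix-val-swap i (x ∷ T) zero    = refl
ix-val-swap i (x ∷ T) (suc r) = ix-val-swap i T r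

val-swap-invol : ∀ i (T : Vec ℕ n) → val-swap i (val-swap i T) ≡ T
val-swap-invol i []      = refl
val-swap-invol i (x ∷ T) = cong₂ _∷_ (τ-invol (suc i) x) (val-swap-invol i T)

-- An entry 0 stands for a missing box.  With x the entry of a row, p its right
-- neighbour and z an entry above x, Cmp is the conjunction of (b) and (c).
Cmp : ℕ → ℕ → ℕ → Set
Cmp x p z = z ≡ 0 ⊎ (x < z ⊎ z < p)

Cmp? : ∀ x p z → Dec (Cmp x p z)
Cmp? x p z = z ≟ 0 ⊎-dec (x <? z ⊎-dec z <? p)

-- N can be the column immediately to the right of T in a key tableau.
Adj : Vec ℕ n → Vec ℕ n → Set
Adj []      []      = ⊤
Adj (p ∷ N) (x ∷ T) = p ≤ x × (All (Cmp x p) T × Adj N T)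

Adj? : (N T : Vec ℕ n) → Dec (Adj N T)
Adj? []      []      = yes tt
Adj? (p ∷ N) (x ∷ T) = p ≤? x ×-dec (AllV.all? (Cmp? x p) T ×-dec Adj? N T)

adj-≤ : (N T : Vec ℕ n) → Adj N T → ∀ r → ix N r ≤ ix T r
adj-≤ []      []      _           r       = z≤n
adj-≤ (p ∷ N) (x ∷ T) (p≤x , _)   zero    = p≤x
adj-≤ (p ∷ N) (x ∷ T) (_ , _ , h) (suc r) = adj-≤ N T h r

adj-cmp : (N T : Vec ℕ n) → Adj N T → ∀ {i k} → i < k → Cmp (ix T i) (ix N i) (ix T k)
adj-cmp []      []      _           _                     = inj₁ refl
adj-cmp (p ∷ N) (x ∷ T) (_ , a , _) {zero}  {suc k} _     = All⇒ix a (inj₁ refl) k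
adj-cmp (p ∷ N) (x ∷ T) (_ , _ , h) {suc i} {suc k} (s<s i<k) = adj-cmp N T h i<k

adj-intro : (N T : Vec ℕ n) → (∀ r → ix N r ≤ ix T r) →
            (∀ {i k} → i < k → Cmp (ix T i) (ix N i) (ix T k)) → Adj N T
adj-intro []      []      f g = tt
adj-intro (p ∷ N) (x ∷ T) f g =
  f 0 , ix⇒All T (λ k → g {0} {suc k} z<s) , adj-intro N T (f ∘ suc) (λ i<k → g (s<s i<k))

Distinct : Vec ℕ n → Set
Distinct []      = ⊤
Distinct (x ∷ T) = All (λ z → z ≡ 0 ⊎ x ≢ z) T × Distinct T

Distinct? : (T : Vec ℕ n) → Dec (Distinct T)
Distinct? []      = yes tt
Distinct? (x ∷ T) = AllV.all? (λ z → z ≟ 0 ⊎-dec ¬? (x ≟ z)) T ×-dec Distinct? T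

distinct-ix : (T : Vec ℕ n) → Distinct T → ∀ {i k} → ix T i ≡ ix T k → ix T i ≢ 0 → i ≡ k
distinct-ix []      _       e e≢0 = ⊥-elim (e≢0 refl)
distinct-ix (x ∷ T) (a , d) {zero}  {zero}  e e≢0 = refl
distinct-ix (x ∷ T) (a , d) {zero}  {suc k} e e≢0 with All⇒ix a (inj₁ refl) k
... | inj₁ z≡0 = ⊥-elim (e≢0 (trans e z≡0))
... | inj₂ x≢z = ⊥-elim (x≢z e)
distinct-ix (x ∷ T) (a , d) {suc i} {zero}  e e≢0 with All⇒ix a (inj₁ refl) i
... | inj₁ z≡0 = ⊥-elim (e≢0 z≡0)
... | inj₂ x≢z = ⊥-elim (x≢z (sym e))
distinct-ix (x ∷ T) (a , d) {suc i} {suc k} e e≢0 = cong suc (distinct-ix T d e e≢0)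

distinct-intro : (T : Vec ℕ n) → (∀ {i k} → ix T i ≡ ix T k → ix T i ≢ 0 → i ≡ k) → Distinct T
distinct-intro []      f = tt
distinct-intro (x ∷ T) f = ix⇒All T head , distinct-intro T (λ e e≢0 → suc-injective (f e e≢0))
  where
  head : ∀ k → ix T k ≡ 0 ⊎ x ≢ ix T k
  head k with ix T k ≟ 0
  ... | yes p = inj₁ p
  ... | no p  = inj₂ λ e → 0≢1+n (f {0} {suc k} e (p ∘ trans (sym e)))

-- As `p ≤ x`, both alternatives of `Cmp` for a nonzero `z` separate it strictly from `x`. The last
-- column of a tableau is covered by the empty column to its right.
adj-distinct : (N T : Vec ℕ n) → Adj N T → Distinct T
adj-distinct []      []      _ = tt
adj-distinct (p ∷ N) (x ∷ T) (p≤x , a , h) = AllV.map f a , adj-distinct N T h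
  where
  f : ∀ {z} → Cmp x p z → z ≡ 0 ⊎ x ≢ z
  f (inj₁ z≡0)        = inj₁ z≡0
  f (inj₂ (inj₁ x<z)) = inj₂ (<⇒≢ x<z)
  f (inj₂ (inj₂ z<p)) = inj₂ (≢-sym (<⇒≢ (<-≤-trans z<p p≤x)))

Has : ℕ → Vec ℕ n → Set
Has v T = ∃ λ r → ix T r ≡ v

Has? : ∀ v (T : Vec ℕ n) → Dec (Has (suc v) T)
Has? {n} v T with anyUpTo? (λ r → ix T r ≟ suc v) n
... | yes (r , _ , e) = yes (r , e)
... | no ¬h           = no λ (r , e) → ¬h (r , ix≢0⇒< T (λ e₀ → 0≢1+n (trans (sym e₀) e)) , e)

-- Exponent vectors are indexed from 0: cnt T k counts the entries suc k.
cnt : Vec ℕ n → ℕ → ℕ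
cnt []      k = 0
cnt (x ∷ T) k = ind (x ≟ suc k) + cnt T k

cnt-¬Has : ∀ k (T : Vec ℕ n) → ¬ Has (suc k) T → cnt T k ≡ 0
cnt-¬Has k []      h = refl
cnt-¬Has k (x ∷ T) h =
  cong₂ _+_ (ind-no (x ≟ suc k) (λ e → h (0 , e))) (cnt-¬Has k T (λ (r , e) → h (suc r , e)))

cnt-Has : ∀ k (T : Vec ℕ n) → Distinct T → Has (suc k) T → cnt T k ≡ 1
cnt-Has k []      d (r , ())
cnt-Has k (x ∷ T) d (zero , e) =
  cong₂ _+_ (ind-yes (x ≟ suc k) e)
            (cnt-¬Has k T (λ (r , e′) →
              0≢1+n (distinct-ix (x ∷ T) d {0} {suc r} (trans e (sym e′)) (λ x≡0 → 0≢1+n (trans (sym x≡0) e)))))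
cnt-Has k (x ∷ T) d (suc r , e) =
  cong₂ _+_ (ind-no (x ≟ suc k) (λ e′ →
              0≢1+n (distinct-ix (x ∷ T) d {0} {suc r} (trans e′ (sym e)) (λ x≡0 → 0≢1+n (trans (sym x≡0) e′)))))
            (cnt-Has k T (proj₂ d) (r , e))

cnt-val-swap : ∀ i (T : Vec ℕ n) k → cnt (val-swap i T) k ≡ cnt T (τ i k)
cnt-val-swap i []      k = refl
cnt-val-swap i (x ∷ T) k =
  cong₂ _+_ (ind-⇔ (τ (suc i) x ≟ suc k) (x ≟ suc (τ i k))
              (λ e → trans (sym (τ-invol (suc i) x)) (cong (τ (suc i)) e))
              (λ e → trans (cong (τ (suc i)) e) (τ-invol (suc i) (suc k))))
            (cnt-val-swap i T k)

-- The columns T for which x_a G(T) turns out to be symmetric in x_a, x_{a+1}.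
Upper : ℕ → Vec ℕ n → Set
Upper a T = ∃ λ r → ix T r ≡ suc a × (∀ {k} → k < r → ix T k ≢ a)

Upper? : ∀ a (T : Vec ℕ n) → Dec (Upper a T)
Upper? {n} a T
  with anyUpTo? (λ r → ix T r ≟ suc a ×-dec allUpTo? (λ k → ¬? (ix T k ≟ a)) r) n
... | yes (r , _ , u) = yes (r , u)
... | no ¬u           = no λ (r , e , f) → ¬u (r , ix≢0⇒< T (λ e₀ → 0≢1+n (trans (sym e₀) e)) , e , f)

¬Upper⇒below : ∀ a (T : Vec ℕ n) → ¬ Upper a T → ∀ {r} → ix T r ≡ suc a →
               ∃ λ k → k < r × ix T k ≡ a
¬Upper⇒below a T ¬u {r} e with anyUpTo? (λ k → ix T k ≟ a) r
... | yes h = h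
... | no ¬h = ⊥-elim (¬u (r , e , λ k<r e′ → ¬h (_ , k<r , e′)))

-- Exchanging the values a and a+1 in adjacent columns

module _ (i : ℕ) where

  private
    a = suc i

    a≢0 : ∀ {x} → x ≡ a → x ≢ 0
    a≢0 refl ()

    sa≢0 : ∀ {x} → x ≡ suc a → x ≢ 0
    sa≢0 refl ()

    a≢sa : ∀ {x} → x ≡ a → x ≢ suc a
    a≢sa refl e = 1+n≢n (sym e)

    τ0 : ∀ {x} → x ≡ 0 → τ a x ≡ 0
    τ0 refl = refl

    τa : ∀ {x} → x ≡ a → τ a x ≡ suc a
    τa refl = τ-fst a

    τsa : ∀ {x} → x ≡ suc a → τ a x ≡ a
    τsa refl = τ-snd a

    τ⁻a : ∀ {x} → τ a x ≡ a → x ≡ suc a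
    τ⁻a {x} e = trans (sym (τ-invol a x)) (τa e)

    τ⁻sa : ∀ {x} → τ a x ≡ suc a → x ≡ a
    τ⁻sa {x} e = trans (sym (τ-invol a x)) (τsa e)

    τ⁻0 : ∀ {x} → τ a x ≡ 0 → x ≡ 0
    τ⁻0 {x} e = trans (sym (τ-invol a x)) (τ0 e)

    σ : ∀ {n} → Vec ℕ n → Vec ℕ n
    σ = val-swap i

    ≤-σˡ : ∀ (N : Vec ℕ n) {r x} → τ a (ix N r) ≤ x → ix (σ N) r ≤ x
    ≤-σˡ N {r} = subst (_≤ _) (sym (ix-val-swap i N r))

  distinct-val-swap : (T : Vec ℕ n) → Distinct T → Distinct (σ T)
  distinct-val-swap T d = distinct-intro (σ T) λ {r} {k} e e≢0 →
    distinct-ix T d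
      (trans (sym (τ-invol a _)) (trans (cong (τ a) (trans (sym (ix-val-swap i T r)) (trans e (ix-val-swap i T k)))) (τ-invol a _)))
      (λ e₀ → e≢0 (trans (ix-val-swap i T r) (τ0 e₀)))

  Has-val-swap : (T : Vec ℕ n) → ∀ {v} → Has v T → Has (τ a v) (σ T)
  Has-val-swap T (r , refl) = r , ix-val-swap i T r

  -- The exchange in `N` can only do harm where an entry `a` of `T` meets an `a` in the same row of
  -- `N`, or an `a + 1` of `N` in a lower row.
  adj-val-swapˡ : (N T : Vec ℕ n) → ¬ Has a T → Adj N T → Adj (σ N) T
  adj-val-swapˡ N T ¬h adj = adj-intro (σ N) T le cm
    where
    le : ∀ r → ix (σ N) r ≤ ix T r
    le r with τ-monoˡ-≤ a (adj-≤ N T adj r)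
    ... | inj₁ (_ , e) = ⊥-elim (¬h (r , e))
    ... | inj₂ q       = ≤-σˡ N q
    cm : ∀ {j k} → j < k → Cmp (ix T j) (ix (σ N) j) (ix T k)
    cm {j} {k} j<k rewrite ix-val-swap i N j with adj-cmp N T adj j<k
    ... | inj₁ e        = inj₁ e
    ... | inj₂ (inj₁ l) = inj₂ (inj₁ l)
    ... | inj₂ (inj₂ l) with τ-monoʳ-< a l
    ...   | inj₁ (e , _) = ⊥-elim (¬h (k , e))
    ...   | inj₂ q       = inj₂ (inj₂ q)

  -- The `a` of `T` lies above its `a + 1`, so `Cmp` forces the row of `a + 1` to continue with a
  -- value above `a`, that is with `a + 1` again. An `a` of `N` below that row would force an `a`
  -- into `T` in its own row.
  adj-Upper : (N T : Vec ℕ n) → Upper a T → Has a T → Adj N T → Upper a N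
  adj-Upper N T (r , e , low) (r′ , e′) adj = r , Nr , low′
    where
    r<r′ : r < r′
    r<r′ with <-cmp r r′
    ... | tri< l _ _    = l
    ... | tri≈ _ refl _ = ⊥-elim (a≢sa e′ e)
    ... | tri> _ _ l    = ⊥-elim (low l e′)
    Nr : ix N r ≡ suc a
    Nr with adj-cmp N T adj r<r′
    ... | inj₁ q        = ⊥-elim (a≢0 e′ q)
    ... | inj₂ (inj₁ l) = ⊥-elim (<-asym (subst₂ _<_ e e′ l) (n<1+n a))
    ... | inj₂ (inj₂ l) = ≤-antisym (subst (ix N r ≤_) e (adj-≤ N T adj r)) (subst (_< ix N r) e′ l)
    low′ : ∀ {k} → k < r → ix N k ≢ a
    low′ {k} k<r Nk with adj-cmp N T adj k<r
    ... | inj₁ q        = sa≢0 e q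
    ... | inj₂ (inj₁ l) = low k<r (≤-antisym (≤-pred (subst (ix T k <_) e l)) (subst (_≤ ix T k) Nk (adj-≤ N T adj k)))
    ... | inj₂ (inj₂ l) = <-asym (subst₂ _<_ e Nk l) (n<1+n a)

  module _ (N T : Vec ℕ n) (¬h : ¬ Has (suc a) T) (¬u : ¬ Upper a N) where

    -- The only danger is an `a` of `T` above a row in which `N` has `a + 1`. As `N` is not upper,
    -- it has an `a` in a still lower row, and there the `a` of `T` already violates `Cmp`.
    adj-val-swapʳ : Adj N T → Adj N (σ T)
    adj-val-swapʳ adj = adj-intro N (σ T) le cm
      where
      le : ∀ r → ix N r ≤ ix (σ T) r
      le r rewrite ix-val-swap i T r with τ-monoʳ-≤ a (adj-≤ N T adj r)
      ... | inj₁ (_ , e) = ⊥-elim (¬h (r , e))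
      ... | inj₂ q       = q
      cm : ∀ {j k} → j < k → Cmp (ix (σ T) j) (ix N j) (ix (σ T) k)
      cm {j} {k} j<k rewrite ix-val-swap i T j | ix-val-swap i T k with adj-cmp N T adj j<k
      ... | inj₁ e        = inj₁ (τ0 e)
      ... | inj₂ (inj₁ l) with τ-mono-< a l
      ...   | inj₁ (_ , e) = ⊥-elim (¬h (k , e))
      ...   | inj₂ q       = inj₂ (inj₁ q)
      cm {j} {k} j<k | inj₂ (inj₂ l) with τ-monoˡ-< a l
      ...   | inj₂ q         = inj₂ (inj₂ q)
      ...   | inj₁ (Tk , Nj) with ¬Upper⇒below a N ¬u Nj
      ...     | j′ , j′<j , Nj′ with adj-cmp N T adj (<-trans j′<j j<k)
      ...       | inj₁ e         = ⊥-elim (a≢0 Tk e)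
      ...       | inj₂ (inj₁ l′) = ⊥-elim (<⇒≱ (subst (ix T j′ <_) Tk l′) (subst (_≤ ix T j′) Nj′ (adj-≤ N T adj j′)))
      ...       | inj₂ (inj₂ l′) = ⊥-elim (<-irrefl refl (subst₂ _<_ Tk Nj′ l′))

    -- The critical case is a row with `a + 1` in both `N` and `σ T`. Again `N` has an `a` in a
    -- lower row; `Cmp` then puts an `a` into that row of `σ T`, hence an `a + 1` into `T`, which
    -- `¬h` excludes.
    adj-val-swapʳ⁻ : Adj N (σ T) → Adj N T
    adj-val-swapʳ⁻ adj = adj-intro N T le cm
      where
      le : ∀ r → ix N r ≤ ix T r
      le r with τ-monoʳ-≤ a (subst (ix N r ≤_) (ix-val-swap i T r) (adj-≤ N (σ T) adj r))
      ... | inj₂ q       = subst (ix N r ≤_) (τ-invol a _) q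
      ... | inj₁ (Nr , Tr) with ¬Upper⇒below a N ¬u Nr
      ...   | j , j<r , Nj
            with adj-≤ N (σ T) adj j | adj-cmp N (σ T) adj j<r
      ...     | le′ | c rewrite ix-val-swap i T j | ix-val-swap i T r with c
      ...       | inj₁ e        = ⊥-elim (sa≢0 Tr e)
      ...       | inj₂ (inj₁ l) =
                    ⊥-elim (¬h (j , τ⁻a (≤-antisym (≤-pred (subst (_ <_) Tr l)) (subst (_≤ _) Nj le′))))
      ...       | inj₂ (inj₂ l) = ⊥-elim (<-asym (subst₂ _<_ Tr Nj l) (n<1+n a))
      cm : ∀ {j k} → j < k → Cmp (ix T j) (ix N j) (ix T k)
      cm {j} {k} j<k with adj-cmp N (σ T) adj j<k
      ... | c rewrite ix-val-swap i T j | ix-val-swap i T k with c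
      ...   | inj₁ e        = inj₁ (τ⁻0 e)
      ...   | inj₂ (inj₁ l) with τ-mono-< a l
      ...     | inj₁ (e , _) = ⊥-elim (¬h (j , τ⁻a e))
      ...     | inj₂ q       = inj₂ (inj₁ (subst₂ _<_ (τ-invol a _) (τ-invol a _) q))
      cm {j} {k} j<k | c | inj₂ (inj₂ l) with τ-monoˡ-< a l
      ...     | inj₁ (e , _) = ⊥-elim (¬h (k , τ⁻a e))
      ...     | inj₂ q       = inj₂ (inj₂ (subst (_< _) (τ-invol a _) q))

  module _ (T : Vec ℕ n) {r r′ : ℕ} (r<r′ : r < r′) (Tr : ix T r ≡ a) (Tr′ : ix T r′ ≡ suc a) where

    private
      -- In `σ T` the larger value lies below the smaller one, so condition (c) forces the lower row
      -- to continue with `a + 1`.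
      adj-σT⇒ : (N : Vec ℕ n) → Adj N (σ T) → ix N r ≡ suc a
      adj-σT⇒ N adj with adj-≤ N (σ T) adj r | adj-cmp N (σ T) adj r<r′
      ... | l | c rewrite ix-val-swap i T r | ix-val-swap i T r′ | τa Tr | τsa Tr′ with c
      ...   | inj₂ (inj₁ l′) = ⊥-elim (<-asym l′ (n<1+n a))
      ...   | inj₂ (inj₂ l′) = ≤-antisym l l′

    adj-excl : (N : Vec ℕ n) → ¬ (Adj N T × Adj N (σ T))
    adj-excl N (h , h′) =
      <-irrefl refl (subst₂ _≤_ (adj-σT⇒ N h′) Tr (adj-≤ N T h r))

    -- The columns adjacent to `T` or to `σ T` form a set closed under the exchange, and row `r`
    -- decides which of the two columns the image fits: if `N` is adjacent to `T` with `a` in row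
    -- `r`, the image fits `σ T`; in all other cases it fits `T`.
    adj-both : (N : Vec ℕ n) → Distinct N →
               Adj N T ⊎ Adj N (σ T) → Adj (σ N) T ⊎ Adj (σ N) (σ T)
    adj-both N dN (inj₁ adj) with ix N r ≟ a
    ... | yes Nr = inj₂ (adj-intro (σ N) (σ T) le cm)
      where
      dT = adj-distinct N T adj
      le : ∀ k → ix (σ N) k ≤ ix (σ T) k
      le k rewrite ix-val-swap i N k | ix-val-swap i T k with τ-mono-≤ a (adj-≤ N T adj k)
      ... | inj₂ q         = q
      ... | inj₁ (Nk , Tk) with distinct-ix N dN {r} {k} (trans Nr (sym Nk)) (a≢0 Nr)
      ...   | refl = ⊥-elim (a≢sa Tr Tk)
      cm : ∀ {j k} → j < k → Cmp (ix (σ T) j) (ix (σ N) j) (ix (σ T) k)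
      cm {j} {k} j<k rewrite ix-val-swap i T j | ix-val-swap i T k | ix-val-swap i N j
        with adj-cmp N T adj j<k
      ... | inj₁ e        = inj₁ (τ0 e)
      ... | inj₂ (inj₁ l) with τ-mono-< a l
      ...   | inj₂ q         = inj₂ (inj₁ q)
      ...   | inj₁ (Tj , Tk) with distinct-ix T dT {j} {r} (trans Tj (sym Tr)) (a≢0 Tj)
      ...     | refl = inj₂ (inj₂ (subst₂ _<_ (sym (τsa Tk)) (sym (τa Nr)) (n<1+n a)))
      cm {j} {k} j<k | inj₂ (inj₂ l) with τ-mono-< a l
      ...   | inj₂ q         = inj₂ (inj₂ q)
      ...   | inj₁ (Tk , Nj) with distinct-ix T dT {k} {r} (trans Tk (sym Tr)) (a≢0 Tk)
      ...     | refl with adj-cmp N T adj (<-trans j<k r<r′)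
      ...       | inj₁ e         = ⊥-elim (sa≢0 Tr′ e)
      ...       | inj₂ (inj₁ l′) = ⊥-elim (<⇒≱ (subst (_ <_) Tr′ l′) (subst (_≤ _) Nj (adj-≤ N T adj j)))
      ...       | inj₂ (inj₂ l′) = ⊥-elim (<-irrefl refl (subst₂ _<_ Tr′ Nj l′))
    ... | no Nr≢ = inj₁ (adj-intro (σ N) T le cm)
      where
      dT = adj-distinct N T adj
      le : ∀ k → ix (σ N) k ≤ ix T k
      le k rewrite ix-val-swap i N k with τ-monoˡ-≤ a (adj-≤ N T adj k)
      ... | inj₂ q         = q
      ... | inj₁ (Nk , Tk) with distinct-ix T dT {k} {r} (trans Tk (sym Tr)) (a≢0 Tk)
      ...   | refl = ⊥-elim (Nr≢ Nk)
      cm : ∀ {j k} → j < k → Cmp (ix T j) (ix (σ N) j) (ix T k)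
      cm {j} {k} j<k rewrite ix-val-swap i N j with adj-cmp N T adj j<k
      ... | inj₁ e        = inj₁ e
      ... | inj₂ (inj₁ l) = inj₂ (inj₁ l)
      ... | inj₂ (inj₂ l) with τ-monoʳ-< a l
      ...   | inj₂ q         = inj₂ (inj₂ q)
      ...   | inj₁ (Tk , Nj) with distinct-ix T dT {k} {r} (trans Tk (sym Tr)) (a≢0 Tk)
      ...     | refl with adj-cmp N T adj (<-trans j<k r<r′)
      ...       | inj₁ e         = ⊥-elim (sa≢0 Tr′ e)
      ...       | inj₂ (inj₁ l′) = ⊥-elim (<⇒≱ (subst (_ <_) Tr′ l′) (subst (_≤ _) Nj (adj-≤ N T adj j)))
      ...       | inj₂ (inj₂ l′) = ⊥-elim (<-irrefl refl (subst₂ _<_ Tr′ Nj l′))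
    adj-both N dN (inj₂ adj) = inj₁ (adj-intro (σ N) T le cm)
      where
      Nr = adj-σT⇒ N adj
      ττ : ∀ {x} → τ a (τ a x) ≡ x
      ττ = τ-invol a _
      dT : ∀ {j k} → ix T j ≡ ix T k → ix T j ≢ 0 → j ≡ k
      dT {j} {k} e ne = distinct-ix (σ T) (adj-distinct N (σ T) adj)
        (trans (ix-val-swap i T j) (trans (cong (τ a) e) (sym (ix-val-swap i T k))))
        (λ e₀ → ne (τ⁻0 (trans (sym (ix-val-swap i T j)) e₀)))
      le : ∀ k → ix (σ N) k ≤ ix T k
      le k rewrite ix-val-swap i N k
        with τ-mono-≤ a (subst (ix N k ≤_) (ix-val-swap i T k) (adj-≤ N (σ T) adj k))
      ... | inj₂ q         = subst (_ ≤_) ττ q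
      ... | inj₁ (Nk , Tk) with dT {k} {r} (trans (τ⁻sa Tk) (sym Tr)) (a≢0 (τ⁻sa Tk))
      ...   | refl = ⊥-elim (a≢sa Nk Nr)
      cm : ∀ {j k} → j < k → Cmp (ix T j) (ix (σ N) j) (ix T k)
      cm {j} {k} j<k with adj-cmp N (σ T) adj j<k
      ... | c rewrite ix-val-swap i T j | ix-val-swap i T k | ix-val-swap i N j with c
      ...   | inj₁ e        = inj₁ (τ⁻0 e)
      ...   | inj₂ (inj₁ l) with τ-mono-< a l
      ...     | inj₂ q         = inj₂ (inj₁ (subst₂ _<_ ττ ττ q))
      ...     | inj₁ (Tj , Tk) with dT {j} {r′} (trans (τ⁻a Tj) (sym Tr′)) (sa≢0 (τ⁻a Tj))
                                  | dT {k} {r} (trans (τ⁻sa Tk) (sym Tr)) (a≢0 (τ⁻sa Tk))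
      ...       | refl | refl = ⊥-elim (<-asym r<r′ j<k)
      cm {j} {k} j<k | c | inj₂ (inj₂ l) with τ-mono-< a l
      ...     | inj₂ q         = inj₂ (inj₂ (subst (_< _) ττ q))
      ...     | inj₁ (Tk , Nj) with distinct-ix N dN {j} {r} (trans Nj (sym Nr)) (sa≢0 Nj)
      ...       | refl = inj₂ (inj₁ (subst₂ _<_ (sym Tr) (sym (τ⁻a Tk)) (n<1+n a)))

-- Columns of a given shape and their enumeration

Same : ℕ → ℕ → Set
Same zero    zero    = ⊤
Same (suc _) (suc _) = ⊤
Same _       _       = ⊥

Same? : ∀ x y → Dec (Same x y)
Same? zero    zero    = yes tt
Same? zero    (suc _) = no λ ()
Same? (suc _) zero    = no λ ()
Same? (suc _) (suc _) = yes tt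

same-0ʳ : ∀ {x y} → Same x y → y ≡ 0 → x ≡ 0
same-0ʳ {zero} s e = refl
same-0ʳ {suc x} {suc y} s ()

same-0ˡ : ∀ {x y} → Same x y → x ≡ 0 → y ≡ 0
same-0ˡ {zero} {zero} s e = refl

same-suc : ∀ {x x′ y} → Same (suc x) y → Same (suc x′) y
same-suc {y = suc y} s = tt

-- The boxes of the column T are those of the first column of the shape g.
Supp : (ℕ → ℕ) → Vec ℕ n → Set
Supp g []      = ⊤
Supp g (x ∷ T) = Same x (g 0) × Supp (g ∘ suc) T

Supp? : (g : ℕ → ℕ) (T : Vec ℕ n) → Dec (Supp g T)
Supp? g []      = yes tt
Supp? g (x ∷ T) = Same? x (g 0) ×-dec Supp? (g ∘ suc) T

supp-empty : ∀ g (T : Vec ℕ n) → Supp g T → ∀ r → g r ≡ 0 → ix T r ≡ 0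
supp-empty g []      s       r       e = refl
supp-empty g (x ∷ T) (s , _) zero    e = same-0ʳ s e
supp-empty g (x ∷ T) (_ , s) (suc r) e = supp-empty (g ∘ suc) T s r e

supp-nonempty : ∀ g (T : Vec ℕ n) → Supp g T → ∀ r → r < n → g r ≢ 0 → ix T r ≢ 0
supp-nonempty g (x ∷ T) (s , _) zero    _   ne = ne ∘ same-0ˡ s
supp-nonempty g (x ∷ T) (_ , s) (suc r) r<n ne = supp-nonempty (g ∘ suc) T s r (s<s⁻¹ r<n) ne

supp-val-swap : ∀ i g (T : Vec ℕ n) → Supp g T → Supp g (val-swap i T)
supp-val-swap i g []          s       = tt
supp-val-swap i g (zero ∷ T)  (s , t) = s , supp-val-swap i (g ∘ suc) T t
supp-val-swap i g (suc x ∷ T) (s , t) = same-suc s , supp-val-swap i (g ∘ suc) T t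

ind-supp-val-swap : ∀ i g (T : Vec ℕ n) → ind (Supp? g (val-swap i T)) ≡ ind (Supp? g T)
ind-supp-val-swap i g T = ind-⇔ (Supp? g (val-swap i T)) (Supp? g T)
  (λ s → subst (Supp g) (val-swap-invol i T) (supp-val-swap i g (val-swap i T) s))
  (supp-val-swap i g T)

cols : (n B : ℕ) → List (Vec ℕ n)
cols zero    B = [] ∷ []
cols (suc n) B = concatMap (λ x → List.map (x ∷_) (cols n B)) (upTo (suc B))

∑-cols-suc : ∀ n B (F : Vec ℕ (suc n) → ℕ) →
             ∑ (cols (suc n) B) F ≡ ∑ (upTo (suc B)) (λ x → ∑ (cols n B) (λ T → F (x ∷ T)))
∑-cols-suc n B F =
  trans (∑-concatMap (λ x → List.map (x ∷_) (cols n B)) (upTo (suc B)) F) (∑-cong (upTo (suc B)) (λ x → ∑-map (x ∷_) (cols n B) F))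

∑-cols-val-swap : ∀ i n B → suc i < B → (F : Vec ℕ n → ℕ) →
                  ∑ (cols n B) (F ∘ val-swap i) ≡ ∑ (cols n B) F
∑-cols-val-swap i zero    B i<B F = refl
∑-cols-val-swap i (suc n) B i<B F =
  trans (∑-cols-suc n B _)
    (trans (∑-cong (upTo (suc B)) (λ x → ∑-cols-val-swap i n B i<B (λ T → F (τ (suc i) x ∷ T))))
      (trans (∑-upTo-τ (suc i) (suc B) (λ x → ∑ (cols n B) (λ T → F (x ∷ T))) (s<s i<B))
        (sym (∑-cols-suc n B F))))

∑-cols-single : ∀ {n} B (F : Vec ℕ n → ℕ) (S : Vec ℕ n) → All (_≤ B) S →
                (∀ T → T ≢ S → F T ≡ 0) → ∑ (cols n B) F ≡ F S
∑-cols-single B F []      [] e = +-identityʳ (F [])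
∑-cols-single {suc n} B F (x ∷ S) (x≤B ∷ S≤B) e =
  trans (∑-cols-suc n B F)
    (trans (∑-upTo-single (suc B) x _ (s≤s x≤B)
             (λ k k≢x → ∑-zero (cols n B) (λ T → e (k ∷ T) (k≢x ∘ cong (λ { (y ∷ _) → y })))))
      (∑-cols-single B (λ T → F (x ∷ T)) S S≤B (λ T T≢S → e (x ∷ T) (T≢S ∘ cong (λ { (_ ∷ U) → U })))))

-- Polynomials are represented by their values on test functions of the
-- exponent vector: F stands for the functional sending L to the sum of L over
-- the monomials of F.  Then L ⊕ f multiplies
-- by x^f and swapᵂ i applies s_i.
Test : Set
Test = (ℕ → ℕ) → ℕ

Ext : Test → Set
Ext L = ∀ {v w} → (∀ k → v k ≡ w k) → L v ≡ L w

infixl 6 _⊕_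
_⊕_ : Test → (ℕ → ℕ) → Test
(L ⊕ f) w = L (λ k → f k + w k)

swapᵂ : ℕ → Test → Test
swapᵂ i L w = L (w ∘ τ i)

⊕-ext : ∀ {L} → Ext L → ∀ f → Ext (L ⊕ f)
⊕-ext el f e = el (λ k → cong (f k +_) (e k))

swap-ext : ∀ i {L} → Ext L → Ext (swapᵂ i L)
swap-ext i el e = el (λ k → e (τ i k))

x+x-injective : ∀ {x y} → x + x ≡ y + y → x ≡ y
x+x-injective {x} {y} e with <-cmp x y
... | tri< l _ _ = ⊥-elim (<⇒≢ (+-mono-< l l) e)
... | tri≈ _ p _ = p
... | tri> _ _ l = ⊥-elim (<⇒≢ (+-mono-< l l) (sym e))

-- Averaging over `ρ`: together with `x+x-injective`, an identity for `G x + G (ρ x)` passes to the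
-- weighted sum of `G`, without division and without choosing orbit representatives. Invariance of
-- `c` is asked for only where `G (ρ x)` is nonzero, because in `∑-G-sym` it is known for columns
-- with distinct entries.
∑-double : {A : Set} (xs : List A) (ρ : A → A) → (∀ F → ∑ xs (F ∘ ρ) ≡ ∑ xs F) →
           (c G : A → ℕ) → (∀ x → c (ρ x) * G (ρ x) ≡ c x * G (ρ x)) →
           ∑ xs (λ x → c x * (G x + G (ρ x))) ≡ ∑ xs (λ x → c x * G x) + ∑ xs (λ x → c x * G x)
∑-double xs ρ re c G inv =
  trans (∑-cong xs (λ x → *-distribˡ-+ (c x) (G x) (G (ρ x))))
    (trans (∑-+ xs _ _)
      (cong (∑ xs (λ x → c x * G x) +_)
        (trans (∑-cong xs (λ x → sym (inv x))) (re (λ x → c x * G x)))))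

-- Generating functions of key tableaux with a given first column

module _ (B : ℕ) where

  -- G m g T L sums L over the weights of the key tableaux of shape g with at
  -- most m columns and first column T (entries at most B from the second
  -- column on).
  mutual
    G : ∀ {n} → ℕ → (ℕ → ℕ) → Vec ℕ n → Test → ℕ
    G zero    g T L = ind (Supp? (λ _ → 0) T) * L (λ _ → 0)
    G (suc m) g T L = ind (Supp? g T) * S m (pred ∘ g) T (L ⊕ cnt T)

    S : ∀ {n} → ℕ → (ℕ → ℕ) → Vec ℕ n → Test → ℕ
    S {n} m g T L = ∑ (cols n B) (λ N → ind (Adj? N T) * G m g N L)

  mutual
    G-cong : ∀ m g (T : Vec ℕ n) {L L′} → (∀ w → L w ≡ L′ w) → G m g T L ≡ G m g T L′
    G-cong zero    g T e = cong (ind (Supp? (λ _ → 0) T) *_) (e _)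
    G-cong (suc m) g T e = cong (ind (Supp? g T) *_) (S-cong m (pred ∘ g) T (λ w → e _))

    S-cong : ∀ m g (T : Vec ℕ n) {L L′} → (∀ w → L w ≡ L′ w) → S m g T L ≡ S m g T L′
    S-cong {n} m g T e = ∑-cong (cols n B) (λ N → cong (ind (Adj? N T) *_) (G-cong m g N e))

  S-zero : ∀ m g (T : Vec ℕ n) L → (∀ N → Adj N T → G m g N L ≡ 0) → S m g T L ≡ 0
  S-zero {n} m g T L e = ∑-zero (cols n B) (λ N → ind*-zero (Adj? N T) (e N))

  G-distinct : ∀ m g (T : Vec ℕ n) L → ¬ Distinct T → G m g T L ≡ 0
  G-distinct zero    g T L ¬d = ind*-zero (Supp? (λ _ → 0) T) (λ s →
    ⊥-elim (¬d (distinct-intro T (λ {i} _ ne → ⊥-elim (ne (supp-empty _ T s i refl))))))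
  G-distinct (suc m) g T L ¬d = ind*-zero (Supp? g T) (λ _ →
    S-zero m (pred ∘ g) T _ (λ N adj → ⊥-elim (¬d (adj-distinct N T adj))))

  module _ (i : ℕ) (i<B : suc i < B) where

    private
      a = suc i
      σ : ∀ {n} → Vec ℕ n → Vec ℕ n
      σ = val-swap i
      _ˢ : Test → Test
      _ˢ = swapᵂ i
      δ : ℕ → ℕ
      δ k = ind (k ≟ i)

      Balanced : (ℕ → ℕ) → Set
      Balanced f = ∀ k → f (τ i k) ≡ f k

      balanced : (f : ℕ → ℕ) → f i ≡ f (suc i) → Balanced f
      balanced f e k with τ i k | τ-view i k
      ... | _ | fst-view       = sym e
      ... | _ | snd-view       = e
      ... | _ | other-view _ _ = refl

      ⊕-swap : ∀ {L} → Ext L → ∀ {f} → Balanced f → ∀ w → ((L ⊕ f) ˢ) w ≡ ((L ˢ) ⊕ f) w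
      ⊕-swap el st w = el (λ k → cong (_+ w (τ i k)) (sym (st k)))

      ¬Has-σ : (T : Vec ℕ n) → ¬ Has (suc a) T → ¬ Has a (σ T)
      ¬Has-σ T ¬h h = ¬h (subst₂ Has (τ-fst a) (val-swap-invol i T) (Has-val-swap i (σ T) h))

      ¬Has-σ′ : (T : Vec ℕ n) → ¬ Has a T → ¬ Has (suc a) (σ T)
      ¬Has-σ′ T ¬h h = ¬h (subst₂ Has (τ-snd a) (val-swap-invol i T) (Has-val-swap i (σ T) h))

      δi : δ i ≡ 1
      δi = ind-yes (i ≟ i) refl

      δsi : δ (suc i) ≡ 0
      δsi = ind-no (suc i ≟ i) 1+n≢n

    PairSym : ℕ → ℕ → Set
    PairSym n m = ∀ g (T : Vec ℕ n) {L} → Ext L →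
      G m g T L + G m g (σ T) L ≡ G m g T (L ˢ) + G m g (σ T) (L ˢ)

    UpperSym : ℕ → ℕ → Set
    UpperSym n m = ∀ g (T : Vec ℕ n) → Upper a T → ∀ {L} → Ext L →
      G m g T (L ⊕ δ) ≡ G m g T ((L ˢ) ⊕ δ)

    -- Twice the sum is the sum of `c N * (G N + G (σ N))`, to which `PairSym` applies termwise.
    -- Columns with a repeated entry drop out by `G-distinct`.
    ∑-G-sym : ∀ n m → PairSym n m → ∀ g (c : Vec ℕ n → ℕ) →
              (∀ N → Distinct N → c (σ N) ≡ c N) → ∀ {L} → Ext L →
              ∑ (cols n B) (λ N → c N * G m g N L) ≡ ∑ (cols n B) (λ N → c N * G m g N (L ˢ))
    ∑-G-sym n m ps g c inv {L} el =
      x+x-injective (trans (sym (dbl L)) (trans (∑-cong (cols n B) (λ N → cong (c N *_) (ps g N el))) (dbl (L ˢ))))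
      where
      inv′ : ∀ L N → c (σ N) * G m g (σ N) L ≡ c N * G m g (σ N) L
      inv′ L N with Distinct? N
      ... | yes d = cong (_* G m g (σ N) L) (inv N d)
      ... | no ¬d rewrite G-distinct m g (σ N) L
                    (λ d → ¬d (subst Distinct (val-swap-invol i N) (distinct-val-swap i (σ N) d))) =
        trans (*-zeroʳ (c (σ N))) (sym (*-zeroʳ (c N)))
      dbl : ∀ L → _
      dbl L = ∑-double (cols n B) σ (∑-cols-val-swap i n B i<B) c (λ N → G m g N L) (inv′ L)

    module _ (n m : ℕ) (ps : PairSym n m) (us : UpperSym n m) where

      -- Without `a` in `T`, the columns that fit to its right are closed under the exchange.
      S-sym : ∀ g (T : Vec ℕ n) → ¬ Has a T → ∀ {L} → Ext L → S m g T L ≡ S m g T (L ˢ)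
      S-sym g T ¬h el = ∑-G-sym n m ps g (λ N → ind (Adj? N T)) (λ N _ →
        ind-⇔ (Adj? (σ N) T) (Adj? N T)
          (λ h → subst (λ M → Adj M T) (val-swap-invol i N) (adj-val-swapˡ i (σ N) T ¬h h))
          (adj-val-swapˡ i N T ¬h)) el

      -- By `adj-excl` the two adjacency indicators add up to the indicator of a union, and
      -- `adj-both` makes this union invariant.
      S-both : ∀ g (T : Vec ℕ n) → ∀ {r r′} → r < r′ → ix T r ≡ a → ix T r′ ≡ suc a → ∀ {L} → Ext L →
               S m g T L + S m g (σ T) L ≡ S m g T (L ˢ) + S m g (σ T) (L ˢ)
      S-both g T r<r′ Tr Tr′ {L} el = trans (merge L) (trans (∑-G-sym n m ps g c inv el) (sym (merge (L ˢ))))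
        where
        c : Vec ℕ n → ℕ
        c N = ind (Adj? N T) + ind (Adj? N (σ T))
        c≡ : ∀ N → ind (Adj? N T ⊎-dec Adj? N (σ T)) ≡ c N
        c≡ N = ind-⊎ (Adj? N T) (Adj? N (σ T)) (adj-excl i T r<r′ Tr Tr′ N)
        inv : ∀ N → Distinct N → c (σ N) ≡ c N
        inv N d = trans (sym (c≡ (σ N))) (trans (ind-⇔ (Adj? (σ N) T ⊎-dec Adj? (σ N) (σ T)) (Adj? N T ⊎-dec Adj? N (σ T))
          (λ h → subst (λ M → Adj M T ⊎ Adj M (σ T)) (val-swap-invol i N)
                   (adj-both i T r<r′ Tr Tr′ (σ N) (distinct-val-swap i N d) h))
          (adj-both i T r<r′ Tr Tr′ N d)) (c≡ N))
        merge : ∀ L → S m g T L + S m g (σ T) L ≡ ∑ (cols n B) (λ N → c N * G m g N L)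
        merge L = trans (sym (∑-+ (cols n B) _ _))
          (∑-cong (cols n B) (λ N → sym (*-distribʳ-+ (G m g N L) (ind (Adj? N T)) (ind (Adj? N (σ T))))))

      -- With A = S T, B = S (σ T) and X₁, X₂ the parts of B and A over upper
      -- columns, A + X₁ = B + X₂ where B and x_i X₁, x_i X₂ are symmetric;
      -- so x_i A + x_{i+1} B is symmetric.
      S-one : ∀ g (T : Vec ℕ n) → Distinct T → Has a T → ¬ Has (suc a) T → ∀ {L} → Ext L →
              S m g T (L ⊕ cnt T) + S m g (σ T) (L ⊕ cnt (σ T)) ≡
              S m g T ((L ˢ) ⊕ cnt T) + S m g (σ T) ((L ˢ) ⊕ cnt (σ T))
      S-one g T d h ¬h {L} el =
        -- Adding `X (σ T)` on both sides stands in for a subtraction; by `X-sym` this summand is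
        -- the same for `L` and `L ˢ`.
        +-cancelʳ-≡ (X (σ T) (L ⊕ cnt T)) _ _ (trans (side el) (trans middle (sym (trans (cong (rhs +_) (X-sym (σ T))) (side (swap-ext i el))))))
        where
        rhs = S m g T ((L ˢ) ⊕ cnt T) + S m g (σ T) ((L ˢ) ⊕ cnt (σ T))
        X : Vec ℕ n → Test → ℕ
        X U L = ∑ (cols n B) (λ N → ind (Upper? a N) * (ind (Adj? N U) * G m g N L))

        -- If `N` is not upper, adjacency to `T` and to `σ T` agree; if it is upper, both sides
        -- carry the same two summands.
        exchange : ∀ L → S m g T L + X (σ T) L ≡ S m g (σ T) L + X T L
        exchange L = trans (sym (∑-+ (cols n B) _ _)) (trans (∑-cong (cols n B) term) (∑-+ (cols n B) _ _))
          where
          term : ∀ N → ind (Adj? N T) * G m g N L + ind (Upper? a N) * (ind (Adj? N (σ T)) * G m g N L)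
                     ≡ ind (Adj? N (σ T)) * G m g N L + ind (Upper? a N) * (ind (Adj? N T) * G m g N L)
          term N with Upper? a N
          ... | yes _ = trans (cong (ind (Adj? N T) * G m g N L +_) (+-identityʳ _))
                          (trans (+-comm (ind (Adj? N T) * G m g N L) _)
                            (cong (ind (Adj? N (σ T)) * G m g N L +_) (sym (+-identityʳ _))))
          ... | no ¬u = cong (λ z → z * G m g N L + 0)
                          (ind-⇔ (Adj? N T) (Adj? N (σ T)) (adj-val-swapʳ i N T ¬h ¬u) (adj-val-swapʳ⁻ i N T ¬h ¬u))

        -- `T` has one `a` and no `a + 1`, so its monomial is x_a times a monomial symmetric in x_a
        -- and x_{a+1}. The spare x_a is the factor that `UpperSym` needs.
        f : ℕ → ℕ
        f k = cnt T k ∸ δ k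

        cT-i = cnt-Has i T d h
        cT-si = cnt-¬Has (suc i) T ¬h

        cnt≡ : ∀ k → cnt T k ≡ f k + δ k
        cnt≡ k with k ≟ i
        ... | yes refl = trans cT-i (sym (cong₂ _+_ (cong₂ _∸_ cT-i δi) δi))
        ... | no k≢i   = trans (sym (+-identityʳ (cnt T k)))
                           (sym (cong₂ _+_ (cong (cnt T k ∸_) (ind-no (k ≟ i) k≢i)) (ind-no (k ≟ i) k≢i)))

        f-balanced : Balanced f
        f-balanced = balanced f (trans (cong₂ _∸_ cT-i δi) (sym (cong₂ _∸_ cT-si δsi)))

        split : ∀ {L} → Ext L → ∀ w → (L ⊕ cnt T) w ≡ (L ⊕ f ⊕ δ) w
        split el w = el (λ k → trans (cong (_+ w k) (cnt≡ k)) (+-assoc (f k) (δ k) (w k)))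

        X-sym : ∀ U → X U (L ⊕ cnt T) ≡ X U ((L ˢ) ⊕ cnt T)
        X-sym U = ∑-cong (cols n B) (λ N → ind*-cong (Upper? a N) (λ u → cong (ind (Adj? N U) *_)
          (trans (G-cong m g N (split el))
            (trans (us g N u (⊕-ext el f))
              (trans (G-cong m g N (λ w → ⊕-swap el f-balanced (λ k → δ k + w k)))
                (sym (G-cong m g N (split (swap-ext i el)))))))))

        flip : ∀ {L} → Ext L → S m g (σ T) (L ⊕ cnt (σ T)) ≡ S m g (σ T) ((L ˢ) ⊕ cnt T)
        flip el = trans (S-sym g (σ T) (¬Has-σ T ¬h) (⊕-ext el (cnt (σ T))))
          (S-cong m g (σ T) (λ w → el (λ k → cong (_+ w (τ i k)) (cnt-val-swap i T k))))

        side : ∀ {L} → Ext L →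
               S m g T (L ⊕ cnt T) + S m g (σ T) (L ⊕ cnt (σ T)) + X (σ T) (L ⊕ cnt T) ≡
               S m g (σ T) (L ⊕ cnt T) + S m g (σ T) ((L ˢ) ⊕ cnt T) + X T (L ⊕ cnt T)
        side {L} el = trans (xy∙z≈xz∙y (S m g T (L ⊕ cnt T)) _ (X (σ T) (L ⊕ cnt T)))
          (trans (cong₂ _+_ (exchange (L ⊕ cnt T)) (flip el)) (xy∙z≈xz∙y (S m g (σ T) (L ⊕ cnt T)) (X T (L ⊕ cnt T)) _))

        middle : S m g (σ T) (L ⊕ cnt T) + S m g (σ T) ((L ˢ) ⊕ cnt T) + X T (L ⊕ cnt T) ≡
                 S m g (σ T) ((L ˢ) ⊕ cnt T) + S m g (σ T) (((L ˢ) ˢ) ⊕ cnt T) + X T ((L ˢ) ⊕ cnt T)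
        middle = cong₂ _+_
          (trans (+-comm (S m g (σ T) (L ⊕ cnt T)) _)
            (cong (S m g (σ T) ((L ˢ) ⊕ cnt T) +_)
              (S-cong m g (σ T) (λ w → el (λ k → sym (cong (λ j → cnt T j + w j) (τ-invol i k)))))))
          (X-sym T)

      G-sym : ∀ g (T : Vec ℕ n) → Distinct T → ¬ Has a T → ¬ Has (suc a) T → ∀ {L} → Ext L →
              G (suc m) g T L ≡ G (suc m) g T (L ˢ)
      G-sym g T d ¬h ¬h′ el = cong (ind (Supp? g T) *_)
        (trans (S-sym (pred ∘ g) T ¬h (⊕-ext el (cnt T)))
          (S-cong m (pred ∘ g) T (⊕-swap el (balanced (cnt T) (trans (cnt-¬Has i T ¬h) (sym (cnt-¬Has (suc i) T ¬h′)))))))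

      private
        factor : ∀ g (T : Vec ℕ n) L →
                 G (suc m) g T L + G (suc m) g (σ T) L ≡
                 ind (Supp? g T) * (S m (pred ∘ g) T (L ⊕ cnt T) + S m (pred ∘ g) (σ T) (L ⊕ cnt (σ T)))
        factor g T L rewrite ind-supp-val-swap i g T = sym (*-distribˡ-+ (ind (Supp? g T)) _ _)

        pair-one : ∀ g (T : Vec ℕ n) → Distinct T → Has a T → ¬ Has (suc a) T → ∀ {L} → Ext L →
          G (suc m) g T L + G (suc m) g (σ T) L ≡ G (suc m) g T (L ˢ) + G (suc m) g (σ T) (L ˢ)
        pair-one g T d h ¬h {L} el =
          trans (factor g T L) (trans (cong (ind (Supp? g T) *_) (S-one (pred ∘ g) T d h ¬h el)) (sym (factor g T (L ˢ))))

        pair-both : ∀ g (T : Vec ℕ n) → Distinct T → ∀ {r r′} → r < r′ → ix T r ≡ a → ix T r′ ≡ suc a → ∀ {L} → Ext L →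
          G (suc m) g T L + G (suc m) g (σ T) L ≡ G (suc m) g T (L ˢ) + G (suc m) g (σ T) (L ˢ)
        pair-both g T d r<r′ Tr Tr′ {L} el =
          trans (factor g T L) (trans (cong (ind (Supp? g T) *_) core) (sym (factor g T (L ˢ))))
          where
          bal : Balanced (cnt T)
          bal = balanced (cnt T) (trans (cnt-Has i T d (_ , Tr)) (sym (cnt-Has (suc i) T d (_ , Tr′))))
          same : ∀ {L} → Ext L → ∀ w → (L ⊕ cnt (σ T)) w ≡ (L ⊕ cnt T) w
          same el w = el (λ k → cong (_+ w k) (trans (cnt-val-swap i T k) (bal k)))
          core : S m (pred ∘ g) T (L ⊕ cnt T) + S m (pred ∘ g) (σ T) (L ⊕ cnt (σ T)) ≡
                 S m (pred ∘ g) T ((L ˢ) ⊕ cnt T) + S m (pred ∘ g) (σ T) ((L ˢ) ⊕ cnt (σ T))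
          core = trans (cong (S m (pred ∘ g) T (L ⊕ cnt T) +_) (S-cong m (pred ∘ g) (σ T) (same el)))
            (trans (S-both (pred ∘ g) T r<r′ Tr Tr′ (⊕-ext el (cnt T)))
              (cong₂ _+_ (S-cong m (pred ∘ g) T (⊕-swap el bal))
                (S-cong m (pred ∘ g) (σ T) (λ w → trans (⊕-swap el bal w) (sym (same (swap-ext i el) w))))))

        -- The claim is invariant under exchanging `T` and `σ T`, so it suffices to treat columns
        -- with `a` but not `a + 1`, or with `a` below `a + 1`.
        flipped : ∀ g (T : Vec ℕ n) L →
          (G (suc m) g (σ T) L + G (suc m) g (σ (σ T)) L ≡ G (suc m) g (σ T) (L ˢ) + G (suc m) g (σ (σ T)) (L ˢ)) →
          G (suc m) g T L + G (suc m) g (σ T) L ≡ G (suc m) g T (L ˢ) + G (suc m) g (σ T) (L ˢ)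
        flipped g T L e rewrite val-swap-invol i T = trans (+-comm (G (suc m) g T L) _) (trans e (+-comm (G (suc m) g (σ T) (L ˢ)) _))

      pairSym-suc : PairSym n (suc m)
      pairSym-suc g T {L} el with Distinct? T
      ... | no ¬d = trans (cong₂ _+_ (vanish L) (vanish′ L)) (sym (cong₂ _+_ (vanish (L ˢ)) (vanish′ (L ˢ))))
        where
        vanish : ∀ L → G (suc m) g T L ≡ 0
        vanish L = G-distinct (suc m) g T L ¬d
        vanish′ : ∀ L → G (suc m) g (σ T) L ≡ 0
        vanish′ L = G-distinct (suc m) g (σ T) L (¬d ∘ subst Distinct (val-swap-invol i T) ∘ distinct-val-swap i (σ T))
      ... | yes d with Has? i T | Has? (suc i) T
      ...   | no ¬h | no ¬h′ = cong₂ _+_ (G-sym g T d ¬h ¬h′ el)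
                                 (G-sym g (σ T) (distinct-val-swap i T d) (¬Has-σ T ¬h′) (¬Has-σ′ T ¬h) el)
      ...   | yes h | no ¬h′ = pair-one g T d h ¬h′ el
      ...   | no ¬h | yes h′ = flipped g T L (pair-one g (σ T) (distinct-val-swap i T d)
                                 (subst (λ v → Has v (σ T)) (τ-snd a) (Has-val-swap i T h′)) (¬Has-σ′ T ¬h) el)
      ...   | yes (r , e) | yes (r′ , e′) with <-cmp r r′
      ...     | tri< l _ _    = pair-both g T d l e e′ el
      ...     | tri≈ _ refl _ = ⊥-elim (1+n≢n (trans (sym e′) e))
      ...     | tri> _ _ l    = flipped g T L (pair-both g (σ T) (distinct-val-swap i T d) l
                                  (trans (ix-val-swap i T r′) (trans (cong (τ a) e′) (τ-snd a)))
                                  (trans (ix-val-swap i T r) (trans (cong (τ a) e) (τ-fst a))) el)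

      -- If `a` is absent, the factor x_a completes the lone `a + 1` of `T` to a symmetric monomial
      -- and `S-sym` applies. If `a` is present, the monomial of `T` is already symmetric and every
      -- column that can follow is again upper, so the factor x_a is handed on to the induction
      -- hypothesis.
      upperSym-suc : UpperSym n (suc m)
      upperSym-suc g T u@(r , e , _) {L} el with Distinct? T
      ... | no ¬d = trans (G-distinct (suc m) g T (L ⊕ δ) ¬d) (sym (G-distinct (suc m) g T ((L ˢ) ⊕ δ) ¬d))
      ... | yes d = cong (ind (Supp? g T) *_) core
        where
        c = cnt T
        c-si : c (suc i) ≡ 1
        c-si = cnt-Has (suc i) T d (r , e)
        core : S m (pred ∘ g) T (L ⊕ δ ⊕ c) ≡ S m (pred ∘ g) T ((L ˢ) ⊕ δ ⊕ c)
        core with Has? i T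
        ... | no ¬h = trans (S-cong m (pred ∘ g) T (assoc el))
                        (trans (S-sym (pred ∘ g) T ¬h (⊕-ext el f))
                          (S-cong m (pred ∘ g) T (λ w → trans (⊕-swap el bal w) (sym (assoc (swap-ext i el) w)))))
          where
          f : ℕ → ℕ
          f k = δ k + c k
          bal : Balanced f
          bal = balanced f (trans (cong₂ _+_ δi (cnt-¬Has i T ¬h)) (sym (cong₂ _+_ δsi c-si)))
          assoc : ∀ {L} → Ext L → ∀ w → (L ⊕ δ ⊕ c) w ≡ (L ⊕ f) w
          assoc el w = el (λ k → sym (+-assoc (δ k) (c k) (w k)))
        ... | yes h = ∑-cong (cols n B) (λ N → ind*-cong (Adj? N T) (λ adj →
                        trans (G-cong m (pred ∘ g) N (comm el))
                          (trans (us (pred ∘ g) N (adj-Upper i N T u h adj) (⊕-ext el c))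
                            (G-cong m (pred ∘ g) N (λ w → trans (⊕-swap el bal (λ k → δ k + w k)) (sym (comm (swap-ext i el) w)))))))
          where
          bal : Balanced c
          bal = balanced c (trans (cnt-Has i T d h) (sym c-si))
          comm : ∀ {L} → Ext L → ∀ w → (L ⊕ δ ⊕ c) w ≡ (L ⊕ c ⊕ δ) w
          comm el w = el (λ k → x∙yz≈y∙xz (δ k) (c k) (w k))

    mutual
      pairSym : ∀ n m → PairSym n m
      pairSym n zero    = λ g T el → refl
      pairSym n (suc m) = pairSym-suc n m (pairSym n m) (upperSym n m)

      upperSym : ∀ n m → UpperSym n m
      upperSym n zero g T (r , e , _) {L} el = trans (none (L ⊕ δ)) (sym (none ((L ˢ) ⊕ δ)))
        where
        none : ∀ L → G 0 g T L ≡ 0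
        none L = ind*-zero (Supp? (λ _ → 0) T) (λ s → ⊥-elim (0≢1+n (trans (sym (supp-empty _ T s r refl)) e)))
      upperSym n (suc m) = upperSym-suc n m (pairSym n m) (upperSym n m)

-- Exchanging two adjacent rows

row-swap : ℕ → Vec ℕ n → Vec ℕ n
row-swap _       []          = []
row-swap zero    (x ∷ [])    = x ∷ []
row-swap zero    (x ∷ y ∷ T) = y ∷ x ∷ T
row-swap (suc i) (x ∷ T)     = x ∷ row-swap i T

row-swap-invol : ∀ i (T : Vec ℕ n) → row-swap i (row-swap i T) ≡ T
row-swap-invol zero    []          = refl
row-swap-invol (suc i) []          = refl
row-swap-invol zero    (x ∷ [])    = refl
row-swap-invol zero    (x ∷ y ∷ T) = refl
row-swap-invol (suc i) (x ∷ T)     = cong (x ∷_) (row-swap-invol i T)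

ix-row-swap : ∀ i (T : Vec ℕ n) → suc i < n → ∀ r → ix (row-swap i T) r ≡ ix T (τ i r)
ix-row-swap zero    (x ∷ y ∷ T) _   0             = refl
ix-row-swap zero    (x ∷ y ∷ T) _   1             = refl
ix-row-swap zero    (x ∷ y ∷ T) _   (suc (suc r)) = refl
ix-row-swap zero    (x ∷ [])    (s≤s ())
ix-row-swap (suc i) (x ∷ T)     _   0             = refl
ix-row-swap (suc i) (x ∷ T)     i<n (suc r)       = ix-row-swap i T (s<s⁻¹ i<n) r

∑-cols-row-swap : ∀ i n B (F : Vec ℕ n → ℕ) → ∑ (cols n B) (F ∘ row-swap i) ≡ ∑ (cols n B) F
∑-cols-row-swap zero    zero    B F = refl
∑-cols-row-swap (suc i) zero    B F = refl
∑-cols-row-swap zero (suc zero) B F =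
  trans (∑-cols-suc 0 B _) (sym (∑-cols-suc 0 B F))
∑-cols-row-swap zero (suc (suc n)) B F =
  trans (split (F ∘ row-swap 0)) (trans (∑-comm (upTo (suc B)) (upTo (suc B)) _) (sym (split F)))
  where
  split : ∀ F → ∑ (cols (suc (suc n)) B) F ≡
                ∑ (upTo (suc B)) (λ x → ∑ (upTo (suc B)) (λ y → ∑ (cols n B) (λ T → F (x ∷ y ∷ T))))
  split F = trans (∑-cols-suc (suc n) B F)
    (∑-cong (upTo (suc B)) (λ x → ∑-cols-suc n B (λ T → F (x ∷ T))))
∑-cols-row-swap (suc i) (suc n) B F =
  trans (∑-cols-suc n B _)
    (trans (∑-cong (upTo (suc B)) (λ x → ∑-cols-row-swap i n B (λ T → F (x ∷ T)))) (sym (∑-cols-suc n B F)))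

cnt-row-swap : ∀ i (T : Vec ℕ n) k → cnt (row-swap i T) k ≡ cnt T k
cnt-row-swap zero    []          k = refl
cnt-row-swap (suc i) []          k = refl
cnt-row-swap zero    (x ∷ [])    k = refl
cnt-row-swap zero    (x ∷ y ∷ T) k =
  x∙yz≈y∙xz (ind (y ≟ suc k)) (ind (x ≟ suc k)) (cnt T k)
cnt-row-swap (suc i) (x ∷ T)     k = cong (ind (x ≟ suc k) +_) (cnt-row-swap i T k)

All-row-swap : ∀ {P : ℕ → Set} i {T : Vec ℕ n} → All P T → All P (row-swap i T)
All-row-swap zero    []           = []
All-row-swap (suc i) []           = []
All-row-swap zero    (p ∷ [])     = p ∷ []
All-row-swap zero    (p ∷ q ∷ ps) = q ∷ p ∷ ps
All-row-swap (suc i) (p ∷ ps)     = p ∷ All-row-swap i ps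

supp-row-swap : ∀ i g (T : Vec ℕ n) → suc i < n → Supp g T → Supp (g ∘ τ i) (row-swap i T)
supp-row-swap zero    g (x ∷ [])    (s≤s ())
supp-row-swap zero    g (x ∷ y ∷ T) _   (s , t , u) = t , s , u
supp-row-swap (suc i) g (x ∷ T)     i<n (s , t)     = s , supp-row-swap i (g ∘ suc) T (s<s⁻¹ i<n) t

same-trans : ∀ {x y z} → Same x y → Same y z → Same x z
same-trans {zero}  {zero}  {zero}  _ _ = tt
same-trans {suc _} {suc _} {suc _} _ _ = tt

same-≢0 : ∀ {x y} → x ≢ 0 → y ≢ 0 → Same x y
same-≢0 {zero}  {_}     p _ = ⊥-elim (p refl)
same-≢0 {suc _} {zero}  _ q = ⊥-elim (q refl)
same-≢0 {suc _} {suc _} _ _ = tt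

same-refl : ∀ x → Same x x
same-refl zero    = tt
same-refl (suc x) = tt

supp-cong : ∀ {g h : ℕ → ℕ} (T : Vec ℕ n) → (∀ r → Same (g r) (h r)) → Supp g T → Supp h T
supp-cong         []      e s       = tt
supp-cong {g = g} (x ∷ T) e (s , t) = same-trans {x} {g 0} s (e 0) , supp-cong T (e ∘ suc) t

supp-row-swap⁻ : ∀ i g (T : Vec ℕ n) → suc i < n → Supp (g ∘ τ i) (row-swap i T) → Supp g T
supp-row-swap⁻ i g T i<n s =
  subst (Supp g) (row-swap-invol i T)
    (supp-cong (row-swap i (row-swap i T)) (λ r → subst (Same _) (cong g (τ-invol i r)) (same-refl _))
      (supp-row-swap i (g ∘ τ i) (row-swap i T) i<n s))

-- An empty row has no right neighbour, and `Cmp` always holds from it upwards and against it from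
-- below, so it can pass its neighbour. This version and the next, with the empty row above and
-- below, invert each other.
adj-row-swap-emptyʳ : ∀ i (N T : Vec ℕ n) → ix T (suc i) ≡ 0 → Adj N T → Adj (row-swap i N) (row-swap i T)
adj-row-swap-emptyʳ zero    []          []              e h = tt
adj-row-swap-emptyʳ (suc i) []          []              e h = tt
adj-row-swap-emptyʳ zero    (p ∷ [])    (x ∷ [])        e h = h
adj-row-swap-emptyʳ zero    (p ∷ q ∷ N) (x ∷ .zero ∷ T) refl (p≤x , _ ∷ c , q≤0 , d , h) =
  q≤0 , above x ∷ d , p≤x , c , h
  where
  above : ∀ x → Cmp 0 q x
  above zero    = inj₁ refl
  above (suc x) = inj₂ (inj₁ z<s)
adj-row-swap-emptyʳ (suc i) (p ∷ N)     (x ∷ T)         e (p≤x , c , h) =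
  p≤x , All-row-swap i c , adj-row-swap-emptyʳ i N T e h

adj-row-swap-emptyˡ : ∀ i (N T : Vec ℕ n) → ix T i ≡ 0 → Adj N T → Adj (row-swap i N) (row-swap i T)
adj-row-swap-emptyˡ zero    []          []              e h = tt
adj-row-swap-emptyˡ (suc i) []          []              e h = tt
adj-row-swap-emptyˡ zero    (p ∷ [])    (x ∷ [])        e h = h
adj-row-swap-emptyˡ zero    (p ∷ q ∷ N) (.zero ∷ y ∷ T) refl (p≤0 , _ ∷ c , q≤y , d , h) =
  q≤y , inj₁ refl ∷ d , p≤0 , c , h
adj-row-swap-emptyˡ (suc i) (p ∷ N)     (x ∷ T)         e (p≤x , c , h) =
  p≤x , All-row-swap i c , adj-row-swap-emptyˡ i N T e h

private
  -- Because `q ≤ x`, the mixed case `x < z < q` cannot occur. So a present `z` either exceeds both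
  -- `x` and `y` or lies below both `p` and `q`, which does not depend on the pairing.
  cmp-exchange : ∀ {x y p q z} → x < y → q ≤ x → Cmp x p z × Cmp y q z → Cmp x q z × Cmp y p z
  cmp-exchange x<y q≤x (inj₁ e , _) = inj₁ e , inj₁ e
  cmp-exchange x<y q≤x (_ , inj₁ e) = inj₁ e , inj₁ e
  cmp-exchange x<y q≤x (_ , inj₂ (inj₁ y<z)) = inj₂ (inj₁ (<-trans x<y y<z)) , inj₂ (inj₁ y<z)
  cmp-exchange x<y q≤x (inj₂ (inj₁ x<z) , inj₂ (inj₂ z<q)) = ⊥-elim (<-asym x<z (<-≤-trans z<q q≤x))
  cmp-exchange x<y q≤x (inj₂ (inj₂ z<p) , inj₂ (inj₂ z<q)) = inj₂ (inj₂ z<q) , inj₂ (inj₂ z<p)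

  adj-irrefl : ∀ {x p q} {N T : Vec ℕ n} → x ≢ 0 → ¬ Adj (p ∷ q ∷ N) (x ∷ x ∷ T)
  adj-irrefl x≢0 (p≤x , inj₁ x≡0 ∷ _ , _)        = x≢0 x≡0
  adj-irrefl x≢0 (p≤x , inj₂ (inj₁ x<x) ∷ _ , _) = <-irrefl refl x<x
  adj-irrefl x≢0 (p≤x , inj₂ (inj₂ x<p) ∷ _ , _) = <⇒≱ x<p p≤x

  adj-above : ∀ {x y p q} {N T : Vec ℕ n} → x ≢ 0 → x < y → Adj (p ∷ q ∷ N) (y ∷ x ∷ T) → x < p
  adj-above x≢0 x<y (_ , inj₁ x≡0 ∷ _ , _)        = ⊥-elim (x≢0 x≡0)
  adj-above x≢0 x<y (_ , inj₂ (inj₁ y<x) ∷ _ , _) = ⊥-elim (<-asym x<y y<x)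
  adj-above x≢0 x<y (_ , inj₂ (inj₂ x<p) ∷ _ , _) = x<p

  -- Exchanging the right neighbours may force `x` and `y` to change places too. With `x` in the
  -- lower row this is avoided when `q ≤ x`; when `x < q`, the neighbour `q` fits only beside `y`,
  -- and `x < q` is then just what (c) demands.
  adj-exchange : ∀ {x y p q} {N T : Vec ℕ n} → x ≢ 0 → x < y →
    Adj (p ∷ q ∷ N) (x ∷ y ∷ T) ⊎ Adj (p ∷ q ∷ N) (y ∷ x ∷ T) →
    Adj (q ∷ p ∷ N) (x ∷ y ∷ T) ⊎ Adj (q ∷ p ∷ N) (y ∷ x ∷ T)
  adj-exchange {x = x} {q = q} x≢0 x<y (inj₁ (p≤x , _ ∷ c , q≤y , d , h)) with q ≤? x
  ... | yes q≤x = inj₁ (q≤x , inj₂ (inj₁ x<y) ∷ AllV.map proj₁ both , ≤-trans p≤x (<⇒≤ x<y) , AllV.map proj₂ both , h)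
    where both = AllV.map (cmp-exchange x<y q≤x) (AllV.zip (c , d))
  ... | no q≰x = inj₂ (q≤y , inj₂ (inj₂ (≰⇒> q≰x)) ∷ d , p≤x , c , h)
  adj-exchange x≢0 x<y (inj₂ (p≤y , _ ∷ c , q≤x , d , h)) =
    inj₁ (q≤x , inj₂ (inj₁ x<y) ∷ d , p≤y , c , h)

-- With the larger entry in the lower row, (c) makes its right neighbour exceed the smaller entry;
-- with the smaller entry there, that same neighbour is bounded by it.
adj-row-swap-excl : ∀ i (N T : Vec ℕ n) → suc i < n → ix T i ≢ 0 → ix T (suc i) ≢ 0 →
                    ¬ (Adj N T × Adj N (row-swap i T))
adj-row-swap-excl zero (p ∷ []) (x ∷ []) (s≤s ())
adj-row-swap-excl zero (p ∷ q ∷ N) (x ∷ y ∷ T) _ x≢0 y≢0 (h , h′) with <-cmp x y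
... | tri< x<y _ _  = <⇒≱ (adj-above {q = q} {N} {T} x≢0 x<y h′) (proj₁ h)
... | tri≈ _ refl _ = adj-irrefl {q = q} {N} {T} x≢0 h
... | tri> _ _ y<x  = <⇒≱ (adj-above {q = q} {N} {T} y≢0 y<x h) (proj₁ h′)
adj-row-swap-excl (suc i) (p ∷ N) (x ∷ T) i<n x≢0 y≢0 ((_ , _ , h) , (_ , _ , h′)) =
  adj-row-swap-excl i N T (s<s⁻¹ i<n) x≢0 y≢0 (h , h′)

adj-row-swap-both : ∀ i (N T : Vec ℕ n) → suc i < n → ix T i ≢ 0 → ix T (suc i) ≢ 0 →
                    Adj N T ⊎ Adj N (row-swap i T) →
                    Adj (row-swap i N) T ⊎ Adj (row-swap i N) (row-swap i T)
adj-row-swap-both zero (p ∷ []) (x ∷ []) (s≤s ())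
adj-row-swap-both zero (p ∷ q ∷ N) (x ∷ y ∷ T) _ x≢0 y≢0 h with <-cmp x y
... | tri< x<y _ _  = adj-exchange x≢0 x<y h
... | tri≈ _ refl _ = ⊥-elim (adj-irrefl {q = q} {N} {T} x≢0 (Sum.[ id , id ]′ h))
... | tri> _ _ y<x  = Sum.swap (adj-exchange y≢0 y<x (Sum.swap h))
adj-row-swap-both (suc i) (p ∷ N) (x ∷ T) i<n x≢0 y≢0 (inj₁ (l , c , h)) =
  Sum.map (λ h → l , c , h) (λ h → l , All-row-swap i c , h)
    (adj-row-swap-both i N T (s<s⁻¹ i<n) x≢0 y≢0 (inj₁ h))
adj-row-swap-both (suc i) (p ∷ N) (x ∷ T) i<n x≢0 y≢0 (inj₂ (l , c , h)) =
  Sum.map (λ h → l , subst (All _) (row-swap-invol i T) (All-row-swap i c) , h) (λ h → l , c , h)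
    (adj-row-swap-both i N T (s<s⁻¹ i<n) x≢0 y≢0 (inj₂ h))

-- Flags, exchanging rows with equal bounds, and lowering a bound

LE : (ℕ → ℕ) → Vec ℕ n → Set
LE b []      = ⊤
LE b (x ∷ T) = x ≤ b 0 × LE (b ∘ suc) T

LE? : (b : ℕ → ℕ) (T : Vec ℕ n) → Dec (LE b T)
LE? b []      = yes tt
LE? b (x ∷ T) = x ≤? b 0 ×-dec LE? (b ∘ suc) T

le-ix : ∀ b (T : Vec ℕ n) → LE b T → ∀ r → ix T r ≤ b r
le-ix b []      l       r       = z≤n
le-ix b (x ∷ T) (l , _) zero    = l
le-ix b (x ∷ T) (_ , l) (suc r) = le-ix (b ∘ suc) T l r

le-intro : ∀ b (T : Vec ℕ n) → (∀ r → ix T r ≤ b r) → LE b T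
le-intro b []      f = tt
le-intro b (x ∷ T) f = f 0 , le-intro (b ∘ suc) T (f ∘ suc)

module _ (B : ℕ) where

  private
    G′ : ℕ → (ℕ → ℕ) → Vec ℕ n → Test → ℕ
    G′ = G B
    S′ : ℕ → (ℕ → ℕ) → Vec ℕ n → Test → ℕ
    S′ = S B

  -- The generating function of the key tableaux of shape g flagged by b.
  Φ : ∀ n → ℕ → (ℕ → ℕ) → (ℕ → ℕ) → Test → ℕ
  Φ n m g b L = ∑ (cols n B) (λ T → ind (LE? b T) * G′ m g T L)

  G-empty : ∀ m g (T : Vec ℕ n) L r → g r ≡ 0 → ix T r ≢ 0 → G′ m g T L ≡ 0
  G-empty zero    g T L r e ne = ind*-zero (Supp? (λ _ → 0) T) (λ s → ⊥-elim (ne (supp-empty _ T s r refl)))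
  G-empty (suc m) g T L r e ne = ind*-zero (Supp? g T) (λ s → ⊥-elim (ne (supp-empty g T s r e)))

  module _ (i : ℕ) where

    private
      ρ : Vec ℕ n → Vec ℕ n
      ρ = row-swap i

    -- Moving a row past an empty one is a mere relabelling, hence an equality for each column
    -- instead of only for the sum over `T` and `ρ T`.
    G-row-swap-empty : suc i < n → ∀ m g (T : Vec ℕ n) {L} → Ext L → g (suc i) ≡ 0 →
                       G′ m g T L ≡ G′ m (g ∘ τ i) (ρ T) L
    G-row-swap-empty i<n zero g T {L} el e = cong (_* L (λ _ → 0))
      (ind-⇔ (Supp? (λ _ → 0) T) (Supp? (λ _ → 0) (ρ T)) (supp-row-swap i (λ _ → 0) T i<n) (supp-row-swap⁻ i (λ _ → 0) T i<n))
    G-row-swap-empty {n} i<n (suc m) g T {L} el e =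
      trans (ind*-cong (Supp? g T) (λ s → core (supp-empty g T s (suc i) e)))
        (cong (_* S′ m (pred ∘ g ∘ τ i) (ρ T) (L ⊕ cnt (ρ T)))
          (ind-⇔ (Supp? g T) (Supp? (g ∘ τ i) (ρ T)) (supp-row-swap i g T i<n) (supp-row-swap⁻ i g T i<n)))
      where
      pg = pred ∘ g
      core : ix T (suc i) ≡ 0 → S′ m pg T (L ⊕ cnt T) ≡ S′ m (pg ∘ τ i) (ρ T) (L ⊕ cnt (ρ T))
      core e₀ =
        trans (∑-cong (cols n B) (λ N → cong₂ _*_
                (ind-⇔ (Adj? N T) (Adj? (ρ N) (ρ T)) (adj-row-swap-emptyʳ i N T e₀)
                  (λ h → subst₂ Adj (row-swap-invol i N) (row-swap-invol i T)
                    (adj-row-swap-emptyˡ i (ρ N) (ρ T) (trans (ix-row-swap i T i<n i) (trans (cong (ix T) (τ-fst i)) e₀)) h)))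
                (G-row-swap-empty i<n m pg N (⊕-ext el (cnt T)) (cong pred e))))
          (trans (∑-cols-row-swap i n B (λ N → ind (Adj? N (ρ T)) * G′ m (pg ∘ τ i) N (L ⊕ cnt T)))
            (S-cong B m (pg ∘ τ i) (ρ T) (λ w → el (λ k → cong (_+ w k) (sym (cnt-row-swap i T k))))))

    ∑-G-row-swap : ∀ m g h (c : Vec ℕ n → ℕ) → (∀ N → c (ρ N) ≡ c N) → ∀ L →
                   (∀ N → G′ m g N L + G′ m g (ρ N) L ≡ G′ m h N L + G′ m h (ρ N) L) →
                   ∑ (cols n B) (λ N → c N * G′ m g N L) ≡ ∑ (cols n B) (λ N → c N * G′ m h N L)
    ∑-G-row-swap {n} m g h c inv L e =
      x+x-injective (trans (sym (dbl g)) (trans (∑-cong (cols n B) (λ N → cong (c N *_) (e N))) (dbl h)))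
      where
      dbl : ∀ g → _
      dbl g = ∑-double (cols n B) ρ (∑-cols-row-swap i n B) c (λ N → G′ m g N L)
                (λ N → cong (_* G′ m g (ρ N) L) (inv N))

    -- If row `i + 1` is nonempty, both shapes have the same boxes in the first column. The columns
    -- adjacent to `T` or to `ρ T` form a disjoint union closed under `ρ`, so averaging over `ρ`
    -- reduces the claim to the shapes with their first column removed.
    G-row-swap : suc i < n → ∀ m g (T : Vec ℕ n) {L} → Ext L → g (suc i) ≤ g i →
                 G′ m g T L + G′ m g (ρ T) L ≡ G′ m (g ∘ τ i) T L + G′ m (g ∘ τ i) (ρ T) L
    G-row-swap i<n zero    g T el le = refl
    G-row-swap {n} i<n (suc m) g T {L} el le with g (suc i) ≟ 0
    ... | yes e = trans (cong₂ _+_ (G-row-swap-empty i<n (suc m) g T el e) (G-row-swap-empty i<n (suc m) g (ρ T) el e))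
                    (trans (cong (λ U → G′ (suc m) (g ∘ τ i) (ρ T) L + G′ (suc m) (g ∘ τ i) U L) (row-swap-invol i T))
                      (+-comm (G′ (suc m) (g ∘ τ i) (ρ T) L) _))
    ... | no ne = trans (factor g s≡) (trans (ind*-cong (Supp? g T) core) (sym (factor (g ∘ τ i) s≡′)))
      where
      pg = pred ∘ g
      ne′ : g i ≢ 0
      ne′ e = ne (n≤0⇒n≡0 (subst (g (suc i) ≤_) e le))
      same : ∀ r → Same (g r) (g (τ i r))
      same r with τ i r | τ-view i r
      ... | _ | fst-view       = same-≢0 ne′ ne
      ... | _ | snd-view       = same-≢0 ne ne′
      ... | _ | other-view _ _ = same-refl (g r)
      same′ : ∀ r → Same (g (τ i r)) (g r)
      same′ r = subst (λ j → Same (g (τ i r)) (g j)) (τ-invol i r) (same (τ i r))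
      s₁ : ∀ U → ind (Supp? (g ∘ τ i) U) ≡ ind (Supp? g U)
      s₁ U = ind-⇔ (Supp? (g ∘ τ i) U) (Supp? g U) (supp-cong U same′) (supp-cong U same)
      s≡′ : ∀ U → U ≡ T ⊎ U ≡ ρ T → ind (Supp? (g ∘ τ i) U) ≡ ind (Supp? g T)
      s≡′ U (inj₁ refl) = s₁ T
      s≡′ U (inj₂ refl) = ind-⇔ (Supp? (g ∘ τ i) (ρ T)) (Supp? g T) (supp-row-swap⁻ i g T i<n) (supp-row-swap i g T i<n)
      s≡ : ∀ U → U ≡ T ⊎ U ≡ ρ T → ind (Supp? g U) ≡ ind (Supp? g T)
      s≡ U p = trans (sym (s₁ U)) (s≡′ U p)
      L′ = L ⊕ cnt T
      factor : ∀ h → (∀ U → U ≡ T ⊎ U ≡ ρ T → ind (Supp? h U) ≡ ind (Supp? g T)) →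
               G′ (suc m) h T L + G′ (suc m) h (ρ T) L ≡
               ind (Supp? g T) * (S′ m (pred ∘ h) T L′ + S′ m (pred ∘ h) (ρ T) L′)
      factor h e = trans
        (cong₂ _+_ (cong (_* S′ m (pred ∘ h) T L′) (e T (inj₁ refl)))
          (cong₂ _*_ (e (ρ T) (inj₂ refl))
            (S-cong B m (pred ∘ h) (ρ T) (λ w → el (λ k → cong (_+ w k) (cnt-row-swap i T k))))))
        (sym (*-distribˡ-+ (ind (Supp? g T)) _ _))
      c : Vec ℕ n → ℕ
      c N = ind (Adj? N T) + ind (Adj? N (ρ T))
      core : Supp g T → S′ m pg T L′ + S′ m pg (ρ T) L′ ≡ S′ m (pg ∘ τ i) T L′ + S′ m (pg ∘ τ i) (ρ T) L′
      core s = trans (merge pg)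
        (trans (∑-G-row-swap m pg (pg ∘ τ i) c inv L′ (λ N → G-row-swap i<n m pg N (⊕-ext el (cnt T)) (pred-mono-≤ le)))
          (sym (merge (pg ∘ τ i))))
        where
        x≢0 = supp-nonempty g T s i (<-trans (n<1+n i) i<n) ne′
        y≢0 = supp-nonempty g T s (suc i) i<n ne
        c≡ : ∀ N → ind (Adj? N T ⊎-dec Adj? N (ρ T)) ≡ c N
        c≡ N = ind-⊎ (Adj? N T) (Adj? N (ρ T)) (adj-row-swap-excl i N T i<n x≢0 y≢0)
        inv : ∀ N → c (ρ N) ≡ c N
        inv N = trans (sym (c≡ (ρ N))) (trans (ind-⇔ (Adj? (ρ N) T ⊎-dec Adj? (ρ N) (ρ T)) (Adj? N T ⊎-dec Adj? N (ρ T))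
          (λ h → subst (λ M → Adj M T ⊎ Adj M (ρ T)) (row-swap-invol i N) (adj-row-swap-both i (ρ N) T i<n x≢0 y≢0 h))
          (adj-row-swap-both i N T i<n x≢0 y≢0)) (c≡ N))
        merge : ∀ h → S′ m h T L′ + S′ m h (ρ T) L′ ≡ ∑ (cols n B) (λ N → c N * G′ m h N L′)
        merge h = trans (sym (∑-+ (cols n B) _ _))
          (∑-cong (cols n B) (λ N → sym (*-distribʳ-+ (G′ m h N L′) (ind (Adj? N T)) (ind (Adj? N (ρ T))))))

    -- Equal bounds make the flag condition on the first column invariant under `ρ`, so it can serve
    -- as the weight in `∑-G-row-swap`.
    Φ-row-swap : ∀ n m g b → suc i < n → b i ≡ b (suc i) → g (suc i) ≤ g i → ∀ {L} → Ext L →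
                 Φ n m g b L ≡ Φ n m (g ∘ τ i) b L
    Φ-row-swap n m g b i<n e le {L} el =
      ∑-G-row-swap m g (g ∘ τ i) (λ T → ind (LE? b T))
        (λ N → ind-⇔ (LE? b (ρ N)) (LE? b N)
          (λ l → subst (LE b) (row-swap-invol i N) (swap (ρ N) l)) (swap N))
        L (λ N → G-row-swap i<n m g N el le)
      where
      b-swap : ∀ r → b (τ i r) ≡ b r
      b-swap r with τ i r | τ-view i r
      ... | _ | fst-view       = sym e
      ... | _ | snd-view       = e
      ... | _ | other-view _ _ = refl
      swap : ∀ N → LE b N → LE b (ρ N)
      swap N l = le-intro b (ρ N) (λ r → subst₂ _≤_ (sym (ix-row-swap i N i<n r)) (b-swap r) (le-ix b N l (τ i r)))

    -- A descent from row `i` to row `i + 1` persists: by (c) row `i` must continue with an entry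
    -- above `T (i + 1)`, and row `i + 1` continues with an entry at most that. As row `i` is not
    -- the longer one, it ends with nothing left to satisfy (c). The bound `g i ≤ m` keeps the
    -- recursion running until then.
    G-ascending : suc i < n → ∀ m g (T : Vec ℕ n) L → g i ≤ m → g i ≤ g (suc i) → g i ≢ 0 →
                  ¬ (ix T i < ix T (suc i)) → G′ m g T L ≡ 0
    G-ascending i<n zero    g T L gm le ne ¬l = ⊥-elim (ne (n≤0⇒n≡0 gm))
    G-ascending i<n (suc m) g T L gm le ne ¬l = ind*-zero (Supp? g T) (λ s →
      S-zero B m (pred ∘ g) T (L ⊕ cnt T) (λ N adj → term s N adj (adj-cmp N T adj (n<1+n i))))
      where
      gsi≢0 : g (suc i) ≢ 0
      gsi≢0 e = ne (n≤0⇒n≡0 (subst (g i ≤_) e le))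
      term : Supp g T → ∀ N → Adj N T → Cmp (ix T i) (ix N i) (ix T (suc i)) → G′ m (pred ∘ g) N (L ⊕ cnt T) ≡ 0
      term s N adj (inj₁ e)        = ⊥-elim (supp-nonempty g T s (suc i) i<n gsi≢0 e)
      term s N adj (inj₂ (inj₁ l)) = ⊥-elim (¬l l)
      term s N adj (inj₂ (inj₂ l)) with pred (g i) ≟ 0
      ... | yes e = G-empty m (pred ∘ g) N (L ⊕ cnt T) i e (m<n⇒n≢0 l)
      ... | no pne = G-ascending i<n m (pred ∘ g) N (L ⊕ cnt T) (pred-mono-≤ gm) (pred-mono-≤ le) pne
                       (λ l′ → <-asym l (<-≤-trans l′ (adj-≤ N T adj (suc i))))

    -- If row `i` is nonempty, only first columns with `T i < T (i + 1)` contribute, by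
    -- `G-ascending`, and there `T (i + 1)` is at most the common bound; so `T i` stays below it.
    Φ-lower-flag : ∀ n m g b b′ → suc i < n → g i ≤ m → g i ≤ g (suc i) → b i ≡ b (suc i) →
                   b i ≡ suc (b′ i) → (∀ r → r ≢ i → b′ r ≡ b r) → ∀ L →
                   Φ n m g b L ≡ Φ n m g b′ L
    Φ-lower-flag n m g b b′ i<n gm le e e′ other L = ∑-cong (cols n B) term
      where
      b′≤b : ∀ r → b′ r ≤ b r
      b′≤b r with r ≟ i
      ... | yes refl = ≤-trans (n≤1+n (b′ r)) (≤-reflexive (sym e′))
      ... | no r≢i   = ≤-reflexive (other r r≢i)
      same : ∀ T → (LE b T → ix T i ≤ b′ i) → ind (LE? b T) * G′ m g T L ≡ ind (LE? b′ T) * G′ m g T L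
      same T f = cong (_* G′ m g T L) (ind-⇔ (LE? b T) (LE? b′ T)
        (λ l → le-intro b′ T (λ r → lower l r)) (λ l → le-intro b T (λ r → ≤-trans (le-ix b′ T l r) (b′≤b r))))
        where
        lower : LE b T → ∀ r → ix T r ≤ b′ r
        lower l r with r ≟ i
        ... | yes refl = f l
        ... | no r≢i   = subst (ix T r ≤_) (sym (other r r≢i)) (le-ix b T l r)
      vanish : ∀ T → G′ m g T L ≡ 0 → ind (LE? b T) * G′ m g T L ≡ ind (LE? b′ T) * G′ m g T L
      vanish T z rewrite z = trans (*-zeroʳ (ind (LE? b T))) (sym (*-zeroʳ (ind (LE? b′ T))))
      term : ∀ T → ind (LE? b T) * G′ m g T L ≡ ind (LE? b′ T) * G′ m g T L
      term T with ix T i ≟ 0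
      ... | yes z = same T (λ _ → subst (_≤ b′ i) (sym z) z≤n)
      ... | no nz with g i ≟ 0
      ...   | yes gz = vanish T (G-empty m g T L i gz nz)
      ...   | no gnz with ix T i <? ix T (suc i)
      ...     | no ¬l = vanish T (G-ascending i<n m g T L gm le gnz ¬l)
      ...     | yes l = same T (λ le′ → ≤-pred (subst (ix T i <_) (trans (sym e) e′) (<-≤-trans l (le-ix b T le′ (suc i)))))

-- The Demazure operator on flagged generating functions

-- With rows counted from 0 the identity flag is `suc`; here row `i` receives the bound of row
-- `i + 1` instead.
raise : ℕ → ℕ → ℕ
raise i r = suc (r + ind (r ≟ i))

raise-self : ∀ i → raise i i ≡ suc (suc i)
raise-self i = cong suc (trans (cong (i +_) (ind-yes (i ≟ i) refl)) (+-comm i 1))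

raise-other : ∀ i r → r ≢ i → raise i r ≡ suc r
raise-other i r r≢i = cong suc (trans (cong (r +_) (ind-no (r ≟ i) r≢i)) (+-identityʳ r))

module _ (B : ℕ) where

  module _ (i : ℕ) (i<B : suc i < B) (n m : ℕ) (g : ℕ → ℕ) where

    private
      a = suc i
      δ : ℕ → ℕ
      δ k = ind (k ≟ i)

    -- The exchange pushes an entry over its bound only if the entry and the bound both equal `a`,
    -- and `raise i` skips the value `a`.
    Φ-raise-sym : ∀ {L} → Ext L → Φ B n m g (raise i) L ≡ Φ B n m g (raise i) (swapᵂ i L)
    Φ-raise-sym = ∑-G-sym B i i<B n m (pairSym B i i<B n m) g (λ T → ind (LE? (raise i) T)) (λ N _ →
      ind-⇔ (LE? (raise i) (val-swap i N)) (LE? (raise i) N)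
        (λ l → subst (LE (raise i)) (val-swap-invol i N) (swap (val-swap i N) l)) (swap N))
      where
      raise≢a : ∀ r → raise i r ≢ a
      raise≢a r e with r ≟ i
      ... | yes refl = 1+n≢n (trans (sym (raise-self r)) e)
      ... | no r≢i   = r≢i (suc-injective (trans (sym (raise-other i r r≢i)) e))
      swap : ∀ (N : Vec ℕ n) → LE (raise i) N → LE (raise i) (val-swap i N)
      swap N l = le-intro (raise i) (val-swap i N) f
        where
        f : ∀ r → ix (val-swap i N) r ≤ raise i r
        f r rewrite ix-val-swap i N r with τ-monoˡ-≤ a (le-ix (raise i) N l r)
        ... | inj₁ (_ , e) = ⊥-elim (raise≢a r e)
        ... | inj₂ q       = q

    -- The difference of the generating functions for the two flags, written as a sum to avoid
    -- subtraction.
    raised : Test → ℕ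
    raised L = ∑ (cols n B) (λ T → ind (LE? (raise i) T ×-dec ¬? (LE? suc T)) * G B m g T L)

    Φ-raise-split : ∀ L → Φ B n m g (raise i) L ≡ Φ B n m g suc L + raised L
    Φ-raise-split L = trans (∑-cong (cols n B) (λ T →
        trans (cong (_* G B m g T L) (split T)) (*-distribʳ-+ (G B m g T L) (ind (LE? suc T)) _)))
      (∑-+ (cols n B) _ _)
      where
      split : ∀ T → ind (LE? (raise i) T) ≡ ind (LE? suc T) + ind (LE? (raise i) T ×-dec ¬? (LE? suc T))
      split T with LE? suc T
      ... | yes l = trans (ind-yes (LE? (raise i) T) (le-intro (raise i) T (λ r → ≤-trans (le-ix suc T l r) (s≤s (m≤m+n r _)))))
                      (cong suc (sym (ind-no (LE? (raise i) T ×-dec ¬? (yes l)) (λ (_ , ¬l) → ¬l l))))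
      ... | no ¬l = ind-⇔ (LE? (raise i) T) (LE? (raise i) T ×-dec yes ¬l) (λ l → l , ¬l) proj₁

    -- Such a column must use the extra value `a + 1` in row `i`, and the bounds of all lower rows
    -- are less than `a`.
    raised-Upper : (T : Vec ℕ n) → LE (raise i) T → ¬ LE suc T → Upper a T
    raised-Upper T l ¬l = i , Ti , (λ {k} k<i e → <⇒≱ k<i (≤-pred (subst (_≤ suc k) e (other k (<⇒≢ k<i)))))
      where
      other : ∀ r → r ≢ i → ix T r ≤ suc r
      other r r≢i = subst (ix T r ≤_) (raise-other i r r≢i) (le-ix (raise i) T l r)
      bound : ix T i ≤ suc a
      bound = subst (ix T i ≤_) (raise-self i) (le-ix (raise i) T l i)
      Ti : ix T i ≡ suc a
      Ti with ix T i ≟ suc a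
      ... | yes e = e
      ... | no ne = ⊥-elim (¬l (le-intro suc T f))
        where
        f : ∀ r → ix T r ≤ suc r
        f r with r ≟ i
        ... | yes refl = ≤-pred (≤∧≢⇒< bound ne)
        ... | no r≢i   = other r r≢i

    raised-sym : ∀ {L} → Ext L → raised (L ⊕ δ) ≡ raised (swapᵂ i L ⊕ δ)
    raised-sym el = ∑-cong (cols n B) (λ T → ind*-cong (LE? (raise i) T ×-dec ¬? (LE? suc T))
      (λ (l , ¬l) → upperSym B i i<B n m g T (raised-Upper T l ¬l) el))

-- Partitions

tab : ∀ n → (ℕ → ℕ) → Vec ℕ n
tab zero    f = []
tab (suc n) f = f 0 ∷ tab n (f ∘ suc)

ix-tab : ∀ n f r → r < n → ix (tab n f) r ≡ f r
ix-tab (suc n) f zero    _   = refl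
ix-tab (suc n) f (suc r) r<n = ix-tab n (f ∘ suc) r (s<s⁻¹ r<n)

entry : (ℕ → ℕ) → ℕ → ℕ
entry g r = if does (g r ≟ 0) then 0 else suc r

entry-0 : ∀ g r → g r ≡ 0 → entry g r ≡ 0
entry-0 g r e rewrite e = refl

entry-≢0 : ∀ g r → g r ≢ 0 → entry g r ≡ suc r
entry-≢0 g r ne with g r
... | zero  = ⊥-elim (ne refl)
... | suc _ = refl

supp-intro : ∀ g (T : Vec ℕ n) → (∀ r → r < n → Same (ix T r) (g r)) → Supp g T
supp-intro g []      f = tt
supp-intro g (x ∷ T) f = f 0 z<s , supp-intro (g ∘ suc) T (λ r r<n → f (suc r) (s<s r<n))

module _ (n : ℕ) where

  -- First column of the only tableau of partition shape g flagged by the identity,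
  -- in which all entries of a row equal its index.
  yam : (ℕ → ℕ) → Vec ℕ n
  yam g = tab n (entry g)

  ix-yam-0 : ∀ g r → g r ≡ 0 → ix (yam g) r ≡ 0
  ix-yam-0 g r e with r <? n
  ... | yes r<n = trans (ix-tab n (entry g) r r<n) (entry-0 g r e)
  ... | no r≮n  = ix-≥ (yam g) (≮⇒≥ r≮n)

  ix-yam : ∀ g r → r < n → g r ≢ 0 → ix (yam g) r ≡ suc r
  ix-yam g r r<n ne = trans (ix-tab n (entry g) r r<n) (entry-≢0 g r ne)

  ix-yam-≢0 : ∀ g r → ix (yam g) r ≢ 0 → g r ≢ 0 × ix (yam g) r ≡ suc r
  ix-yam-≢0 g r ne = gne , ix-yam g r (ix≢0⇒< (yam g) ne) gne
    where
    gne : g r ≢ 0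
    gne e = ne (ix-yam-0 g r e)

  yam-le : ∀ g → LE suc (yam g)
  yam-le g = le-intro suc (yam g) f
    where
    f : ∀ r → ix (yam g) r ≤ suc r
    f r with ix (yam g) r ≟ 0
    ... | yes e = subst (_≤ suc r) (sym e) z≤n
    ... | no ne = ≤-reflexive (proj₂ (ix-yam-≢0 g r ne))

  yam-supp : ∀ g → Supp g (yam g)
  yam-supp g = supp-intro g (yam g) f
    where
    f : ∀ r → r < n → Same (ix (yam g) r) (g r)
    f r r<n with g r ≟ 0
    ... | yes e rewrite ix-yam-0 g r e | e = tt
    ... | no ne = same-≢0 (λ e → 0≢1+n (trans (sym e) (ix-yam g r r<n ne))) ne

  yam-distinct : ∀ g → Distinct (yam g)
  yam-distinct g = distinct-intro (yam g) (λ {i} {k} e ne →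
    suc-injective (trans (sym (proj₂ (ix-yam-≢0 g i ne)))
      (trans e (proj₂ (ix-yam-≢0 g k (ne ∘ trans e))))))

  module _ (g : ℕ → ℕ) (dec : ∀ {j k} → j ≤ k → g k ≤ g j) where

    private
      ≢0-below : ∀ {j k} → j ≤ k → g k ≢ 0 → g j ≢ 0
      ≢0-below j≤k ne e = ne (n≤0⇒n≡0 (subst (g _ ≤_) e (dec j≤k)))

    yam-adj : Adj (yam (pred ∘ g)) (yam g)
    yam-adj = adj-intro (yam (pred ∘ g)) (yam g) le cm
      where
      le : ∀ r → ix (yam (pred ∘ g)) r ≤ ix (yam g) r
      le r with ix (yam (pred ∘ g)) r ≟ 0
      ... | yes e = subst (_≤ ix (yam g) r) (sym e) z≤n
      ... | no ne with ix-yam-≢0 (pred ∘ g) r ne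
      ...   | pne , e = ≤-reflexive (trans e (sym (ix-yam g r (ix≢0⇒< (yam (pred ∘ g)) ne) (pne ∘ cong pred))))
      cm : ∀ {i k} → i < k → Cmp (ix (yam g) i) (ix (yam (pred ∘ g)) i) (ix (yam g) k)
      cm {i} {k} i<k with ix (yam g) k ≟ 0
      ... | yes e = inj₁ e
      ... | no ne with ix-yam-≢0 g k ne
      ...   | gne , e = inj₂ (inj₁ (subst₂ _<_
                (sym (ix-yam g i (<-trans i<k (ix≢0⇒< (yam g) ne)) (≢0-below (<⇒≤ i<k) gne))) (sym e) (s<s i<k)))

    -- Strong induction on the row: the flag leaves the values up to the row index, and in a
    -- partition shape all lower rows are nonempty and have already taken the smaller ones.
    yam-unique : (T : Vec ℕ n) → Supp g T → Distinct T → LE suc T → T ≡ yam g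
    yam-unique T s d l = ix-ext T (yam g) eq
      where
      eq : ∀ r → r < n → ix T r ≡ ix (yam g) r
      eq r r<n with g r ≟ 0
      ... | yes e = trans (supp-empty g T s r e) (sym (ix-yam-0 g r e))
      ... | no ne = trans (<-rec (λ r → r < n → g r ≢ 0 → ix T r ≡ suc r) step r r<n ne) (sym (ix-yam g r r<n ne))
        where
        step : ∀ r → (∀ {k} → k < r → k < n → g k ≢ 0 → ix T k ≡ suc k) → r < n → g r ≢ 0 → ix T r ≡ suc r
        step r rec r<n ne with ix T r in e
        ... | zero  = ⊥-elim (supp-nonempty g T s r r<n ne e)
        ... | suc k with k <? r
        ...   | no k≮r  = cong suc (≤-antisym (≤-pred (subst (_≤ suc r) e (le-ix suc T l r))) (≮⇒≥ k≮r))
        ...   | yes k<r = ⊥-elim (<⇒≢ k<r (sym (distinct-ix T d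
                            (trans e (sym (rec k<r (<-trans k<r r<n) (≢0-below (<⇒≤ k<r) ne))))
                            (λ e₀ → 0≢1+n (trans (sym e₀) e)))))

    -- Each nonempty row contributes its own index once, so the exponent drops exactly as the row
    -- length does; hence the weight of the whole tableau is its shape.
    cnt-yam : (∀ k → n ≤ k → g k ≡ 0) → ∀ k → cnt (yam g) k + pred (g k) ≡ g k
    cnt-yam fin k with g k ≟ 0
    ... | yes e = trans (cong₂ _+_ (cnt-¬Has k (yam g) none) (cong pred e)) (sym e)
      where
      none : ¬ Has (suc k) (yam g)
      none (r , er) with ix-yam-≢0 g r (λ e₀ → 0≢1+n (trans (sym e₀) er))
      ... | gne , e′ with trans (sym er) e′
      ...   | refl = gne e
    ... | no ne = trans (cong (_+ pred (g k)) (cnt-Has k (yam g) (yam-distinct g) (k , ix-yam g k k<n ne)))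
                    (suc-pred (g k) {{≢-nonZero ne}})
      where
      k<n : k < n
      k<n with k <? n
      ... | yes p = p
      ... | no ¬p = ⊥-elim (ne (fin k (≮⇒≥ ¬p)))

  -- For `m = 0` the definition of `G` tests against the empty shape, with which `g` then agrees by
  -- its bound.
  G-supp : ∀ B m g (T : Vec ℕ n) L → (∀ r → g r ≤ m) → ¬ Supp g T → G B m g T L ≡ 0
  G-supp B zero    g T L gm ¬s = ind*-zero (Supp? (λ _ → 0) T) (λ s →
    ⊥-elim (¬s (supp-cong T (λ r → subst (Same 0) (sym (n≤0⇒n≡0 (gm r))) tt) s)))
  G-supp B (suc m) g T L gm ¬s = ind*-zero (Supp? g T) (λ s → ⊥-elim (¬s s))

  G-yam : ∀ B m g → (∀ {j k} → j ≤ k → g k ≤ g j) → (∀ r → g r ≤ m) →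
          (T : Vec ℕ n) → LE suc T → T ≢ yam g → ∀ L → G B m g T L ≡ 0
  G-yam B m g dec gm T l ne L with Supp? g T | Distinct? T
  ... | no ¬s | _     = G-supp B m g T L gm ¬s
  ... | yes _ | no ¬d = G-distinct B m g T L ¬d
  ... | yes s | yes d = ⊥-elim (ne (yam-unique g dec T s d l))

  Φ-partition : ∀ B → n ≤ B → ∀ m g → (∀ {j k} → j ≤ k → g k ≤ g j) → (∀ k → n ≤ k → g k ≡ 0) →
                (∀ r → g r ≤ m) → ∀ {L} → Ext L → Φ B n m g suc L ≡ L g
  Φ-partition B n≤B m g dec fin gm {L} el =
    trans (∑-cols-single B (λ T → ind (LE? suc T) * G B m g T L) (yam g) bounded
            (λ T ne → ind*-zero (LE? suc T) (λ l → G-yam B m g dec gm T l ne L)))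
      (trans (cong (_* G B m g (yam g) L) (ind-yes (LE? suc (yam g)) (yam-le g)))
        (trans (+-identityʳ _) (value m g dec fin gm el)))
    where
    bounded : All (_≤ B) (yam g)
    bounded = ix⇒All (yam g) f
      where
      f : ∀ k → ix (yam g) k ≤ B
      f k with ix (yam g) k ≟ 0
      ... | yes e = subst (_≤ B) (sym e) z≤n
      ... | no ne = subst (_≤ B) (sym (proj₂ (ix-yam-≢0 g k ne))) (<-≤-trans (ix≢0⇒< (yam g) ne) n≤B)
    value : ∀ m g → (∀ {j k} → j ≤ k → g k ≤ g j) → (∀ k → n ≤ k → g k ≡ 0) →
            (∀ r → g r ≤ m) → ∀ {L} → Ext L → G B m g (yam g) L ≡ L g
    value zero g dec fin gm {L} el =
      trans (cong (_* L (λ _ → 0)) (ind-yes (Supp? (λ _ → 0) (yam g))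
              (supp-cong (yam g) (λ r → subst (λ x → Same x 0) (sym (n≤0⇒n≡0 (gm r))) tt) (yam-supp g))))
        (trans (+-identityʳ _) (el (λ k → sym (n≤0⇒n≡0 (gm k)))))
    value (suc m) g dec fin gm {L} el =
      trans (cong (_* S B m (pred ∘ g) (yam g) (L ⊕ cnt (yam g))) (ind-yes (Supp? g (yam g)) (yam-supp g)))
        (trans (+-identityʳ _)
          (trans (∑-cong (cols n B) term)
            (trans (Φ-partition B n≤B m (pred ∘ g) (λ l → pred-mono-≤ (dec l)) (λ k l → cong pred (fin k l))
                     (λ r → pred-mono-≤ (gm r)) (⊕-ext el (cnt (yam g))))
              (el (cnt-yam g dec fin)))))
      where
      L′ = L ⊕ cnt (yam g)
      -- Adjacency to `yam g` and the identity flag select different columns, but among the flagged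
      -- ones only `yam (pred ∘ g)` contributes, and it satisfies both. This turns the sum over
      -- continuations into `Φ` of a smaller partition.
      term : ∀ N → ind (Adj? N (yam g)) * G B m (pred ∘ g) N L′ ≡ ind (LE? suc N) * G B m (pred ∘ g) N L′
      term N with LE? suc N
      ... | no ¬l = cong (_* G B m (pred ∘ g) N L′) (ind-no (Adj? N (yam g)) (λ adj →
                      ¬l (le-intro suc N (λ r → ≤-trans (adj-≤ N (yam g) adj r) (le-ix suc (yam g) (yam-le g) r)))))
      ... | yes l with ≡-dec _≟_ N (yam (pred ∘ g))
      ...   | yes refl = cong (_* G B m (pred ∘ g) N L′) (ind-yes (Adj? N (yam g)) (yam-adj g dec))
      ...   | no ne rewrite G-yam B m (pred ∘ g) (λ l → pred-mono-≤ (dec l)) (λ r → pred-mono-≤ (gm r)) N l ne L′ =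
                *-zeroʳ (ind (Adj? N (yam g)))

-- Key tableaux as lists of rows

hd : List ℕ → ℕ
hd row = idx0 row 0

RowOK : List ℕ → Set
RowOK []        = ⊤
RowOK (x ∷ row) = hd row ≤ x × RowOK row

RowOK? : ∀ row → Dec (RowOK row)
RowOK? []        = yes tt
RowOK? (x ∷ row) = hd row ≤? x ×-dec RowOK? row

-- With missing boxes read as 0, `Cmp` is automatic once either row has ended, so the recursion may
-- stop there.
Rows : List ℕ → List ℕ → Set
Rows []        _          = ⊤
Rows (x ∷ row) []         = ⊤
Rows (x ∷ row) (y ∷ row′) = Cmp x (hd row) y × Rows row row′

Rows? : ∀ row row′ → Dec (Rows row row′)
Rows? []        _          = yes tt
Rows? (x ∷ row) []         = yes tt
Rows? (x ∷ row) (y ∷ row′) = Cmp? x (hd row) y ×-dec Rows? row row′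

Key : Tableau → Set
Key []        = ⊤
Key (row ∷ T) = RowOK row × (AllL.All (Rows row) T × Key T)

Key? : ∀ T → Dec (Key T)
Key? []        = yes tt
Key? (row ∷ T) = RowOK? row ×-dec (AllL.all? (Rows? row) T ×-dec Key? T)

weight : Tableau → ℕ → ℕ
weight T k = count (suc k) T

-- Tableaux with row lengths and entry bounds prescribed by a list of pairs

fill : List (ℕ × ℕ) → List Tableau
fill []             = [] ∷ []
fill ((a , b) ∷ ps) = concatMap (λ row → List.map (row ∷_) (fill ps)) (rowsOf a b)

Ψ : List (ℕ × ℕ) → Test → ℕ
Ψ ps L = ∑ (fill ps) (λ T → ind (Key? T) * L (weight T))

pairs : ℕ → (ℕ → ℕ) → (ℕ → ℕ) → List (ℕ × ℕ)
pairs zero    g b = []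
pairs (suc n) g b = (g 0 , b 0) ∷ pairs n (g ∘ suc) (b ∘ suc)

∑-product : {A C D : Set} (xs : List A) (ys : List C) (h : A → C → D) (F : D → ℕ) →
            ∑ (concatMap (λ x → List.map (h x) ys) xs) F ≡ ∑ xs (λ x → ∑ ys (λ y → F (h x y)))
∑-product xs ys h F =
  trans (∑-concatMap (λ x → List.map (h x) ys) xs F) (∑-cong xs (λ x → ∑-map (h x) ys F))

∑-rowsOf-suc : ∀ a b (F : List ℕ → ℕ) →
               ∑ (rowsOf (suc a) b) F ≡ ∑ (upTo b) (λ x → ∑ (rowsOf a b) (λ row → F (suc x ∷ row)))
∑-rowsOf-suc a b F = trans (∑-product (range1 b) (rowsOf a b) _∷_ F) (∑-map suc (upTo b) _)

All-product : {A C D : Set} {P : A → Set} {Q : C → Set} {R : D → Set} (h : A → C → D) →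
              (∀ x y → P x → Q y → R (h x y)) → ∀ {xs ys} → AllL.All P xs → AllL.All Q ys →
              AllL.All R (concatMap (λ x → List.map (h x) ys) xs)
All-product h f []       qs = []
All-product h f (p ∷ ps) qs =
  AllLP.++⁺ (AllLP.map⁺ (AllL.map (f _ _ p) qs)) (All-product h f ps qs)

private
  -- The same fillings as vectors: fixing the number of rows allows them to be zipped with a column.
  fillV : ∀ n → (ℕ → ℕ) → (ℕ → ℕ) → List (Vec (List ℕ) n)
  fillV zero    g b = [] ∷ []
  fillV (suc n) g b = concatMap (λ row → List.map (row ∷_) (fillV n (g ∘ suc) (b ∘ suc))) (rowsOf (g 0) (b 0))

  ∑-fill-pairs : ∀ n g b (F : Tableau → ℕ) → ∑ (fill (pairs n g b)) F ≡ ∑ (fillV n g b) (F ∘ toList)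
  ∑-fill-pairs zero    g b F = refl
  ∑-fill-pairs (suc n) g b F =
    trans (∑-product (rowsOf (g 0) (b 0)) (fill (pairs n (g ∘ suc) (b ∘ suc))) _∷_ F)
      (trans (∑-cong (rowsOf (g 0) (b 0)) (λ row → ∑-fill-pairs n (g ∘ suc) (b ∘ suc) (F ∘ (row ∷_))))
        (sym (∑-product (rowsOf (g 0) (b 0)) (fillV n (g ∘ suc) (b ∘ suc)) _∷_ (F ∘ toList))))

  Fit : (ℕ → ℕ) → Vec (List ℕ) n → Set
  Fit g []        = ⊤
  Fit g (row ∷ T) = length row ≡ g 0 × Fit (g ∘ suc) T

  rowsOf-length : ∀ a b → AllL.All (λ row → length row ≡ a) (rowsOf a b)
  rowsOf-length zero    b = refl ∷ []
  rowsOf-length (suc a) b = All-product {P = λ _ → ⊤} _∷_ (λ x row _ e → cong suc e)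
    (AllL.universal (λ _ → tt) (range1 b)) (rowsOf-length a b)

  fillV-Fit : ∀ n g b → AllL.All (Fit g) (fillV n g b)
  fillV-Fit zero    g b = tt ∷ []
  fillV-Fit (suc n) g b = All-product _∷_ (λ _ _ e f → e , f) (rowsOf-length (g 0) (b 0)) (fillV-Fit n (g ∘ suc) (b ∘ suc))

  col₁ : ℕ → ℕ → List ℕ
  col₁ zero    b = 0 ∷ []
  col₁ (suc a) b = range1 b

  col : ∀ n → (ℕ → ℕ) → (ℕ → ℕ) → List (Vec ℕ n)
  col zero    g b = [] ∷ []
  col (suc n) g b = concatMap (λ x → List.map (x ∷_) (col n (g ∘ suc) (b ∘ suc))) (col₁ (g 0) (b 0))

  push : ℕ → List ℕ → List ℕ
  push zero    row = row
  push (suc x) row = suc x ∷ row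

  pushes : Vec ℕ n → Vec (List ℕ) n → Vec (List ℕ) n
  pushes = Vec.zipWith push

  ∑-peel₁ : ∀ a b (F : List ℕ → ℕ) →
            ∑ (rowsOf a b) F ≡ ∑ (col₁ a b) (λ x → ∑ (rowsOf (pred a) b) (λ row → F (push x row)))
  ∑-peel₁ zero    b F = sym (+-identityʳ _)
  ∑-peel₁ (suc a) b F = trans (∑-rowsOf-suc a b F) (sym (∑-map suc (upTo b) _))

  -- Splits the first box off every row. The sums over first boxes and over remainders alternate row
  -- by row, and exchanging them collects the first boxes into one column.
  ∑-peel : ∀ n g b (F : Vec (List ℕ) n → ℕ) →
           ∑ (fillV n g b) F ≡ ∑ (col n g b) (λ c → ∑ (fillV n (pred ∘ g) b) (λ T → F (pushes c T)))
  ∑-peel zero    g b F = sym (+-identityʳ _)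
  ∑-peel (suc n) g b F =
    trans (∑-product (rowsOf (g 0) (b 0)) (fillV n g′ b′) _∷_ F)
    (trans (∑-peel₁ (g 0) (b 0) _)
    (trans (∑-cong (col₁ (g 0) (b 0)) (λ x →
      trans (∑-cong rows (λ row → ∑-peel n g′ b′ (λ T → F (push x row ∷ T))))
      (trans (∑-comm rows (col n g′ b′) _)
      (∑-cong (col n g′ b′) (λ c → sym (∑-product rows (fillV n (pred ∘ g′) b′) _∷_ (λ T → F (pushes (x ∷ c) T))))))))
    (sym (∑-product (col₁ (g 0) (b 0)) (col n g′ b′) _∷_ _))))
    where
    g′ = g ∘ suc
    b′ = b ∘ suc
    rows = rowsOf (pred (g 0)) (b 0)

  ∑-upTo-≤ : ∀ b B → b ≤ B → (Y : ℕ → ℕ) → ∑ (upTo b) Y ≡ ∑ (upTo B) (λ x → ind (suc x ≤? b) * Y x)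
  ∑-upTo-≤ zero    B       _       Y = sym (∑-zero (upTo B) (λ x → cong (_* Y x) (ind-no (suc x ≤? 0) λ ())))
  ∑-upTo-≤ (suc b) (suc B) (s≤s l) Y =
    trans (∑-upTo-suc b Y)
      (trans (cong₂ _+_ (sym (trans (cong (_* Y 0) (ind-yes (1 ≤? suc b) (s≤s z≤n))) (+-identityʳ (Y 0))))
               (trans (∑-upTo-≤ b B l (Y ∘ suc))
                 (∑-cong (upTo B) (λ x → cong (_* Y (suc x)) (ind-⇔ (suc x ≤? b) (suc (suc x) ≤? suc b) s≤s ≤-pred)))))
        (sym (∑-upTo-suc B (λ x → ind (suc x ≤? suc b) * Y x))))

  ∑-col₁ : ∀ B a b → b ≤ B → (X : ℕ → ℕ) →
           ∑ (col₁ a b) X ≡ ∑ (upTo (suc B)) (λ x → ind (Same? x a) * (ind (x ≤? b) * X x))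
  ∑-col₁ B zero b l X =
    trans (+-identityʳ (X 0))
      (trans (sym (trans (+-identityʳ _) (trans (cong (_* X 0) (ind-yes (0 ≤? b) z≤n)) (+-identityʳ (X 0)))))
        (sym (∑-upTo-single (suc B) 0 (λ x → ind (Same? x 0) * (ind (x ≤? b) * X x)) z<s rest)))
    where
    rest : ∀ k → k ≢ 0 → ind (Same? k 0) * (ind (k ≤? b) * X k) ≡ 0
    rest zero    ne = ⊥-elim (ne refl)
    rest (suc k) ne = refl
  ∑-col₁ B (suc a) b l X =
    trans (∑-map suc (upTo b) X)
      (trans (∑-upTo-≤ b B l (X ∘ suc))
        (trans (∑-cong (upTo B) (λ x → sym (+-identityʳ _)))
          (sym (∑-upTo-suc B (λ x → ind (Same? x (suc a)) * (ind (x ≤? b) * X x))))))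

  ∑-col : ∀ B n g b → (∀ r → r < n → b r ≤ B) → (X : Vec ℕ n → ℕ) →
          ∑ (col n g b) X ≡ ∑ (cols n B) (λ T → ind (Supp? g T) * (ind (LE? b T) * X T))
  ∑-col B zero    g b l X = cong (_+ 0) (sym (trans (+-identityʳ _) (+-identityʳ _)))
  ∑-col B (suc n) g b l X =
    trans (∑-product (col₁ (g 0) (b 0)) (col n (g ∘ suc) (b ∘ suc)) _∷_ X)
      (trans (∑-col₁ B (g 0) (b 0) (l 0 z<s) _)
        (trans (∑-cong (upTo (suc B)) term) (sym (∑-cols-suc n B _))))
    where
    rearrange : ∀ p q r s x → p * (q * (r * (s * x))) ≡ (p * r) * ((q * s) * x)
    rearrange = ℕ-Solver.solve-∀
    term : ∀ x → ind (Same? x (g 0)) * (ind (x ≤? b 0) * ∑ (col n (g ∘ suc) (b ∘ suc)) (λ T → X (x ∷ T))) ≡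
                 ∑ (cols n B) (λ T → ind (Supp? g (x ∷ T)) * (ind (LE? b (x ∷ T)) * X (x ∷ T)))
    term x =
      trans (cong (λ z → ind (Same? x (g 0)) * (ind (x ≤? b 0) * z))
              (∑-col B n (g ∘ suc) (b ∘ suc) (λ r r<n → l (suc r) (s<s r<n)) (λ T → X (x ∷ T))))
        (trans (cong (ind (Same? x (g 0)) *_) (sym (∑-* (ind (x ≤? b 0)) (cols n B) _)))
          (trans (sym (∑-* (ind (Same? x (g 0))) (cols n B) _))
            (∑-cong (cols n B) (λ T →
              trans (rearrange (ind (Same? x (g 0))) (ind (x ≤? b 0)) (ind (Supp? (g ∘ suc) T)) (ind (LE? (b ∘ suc) T)) (X (x ∷ T)))
                (cong₂ (λ u v → u * (v * X (x ∷ T)))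
                  (sym (ind-× (Same? x (g 0)) (Supp? (g ∘ suc) T)))
                  (sym (ind-× (x ≤? b 0) (LE? (b ∘ suc) T))))))))

  col-Supp : ∀ n g b → AllL.All (λ c → Supp g c × LE b c) (col n g b)
  col-Supp zero    g b = (tt , tt) ∷ []
  col-Supp (suc n) g b = All-product {P = λ x → Same x (g 0) × x ≤ b 0} _∷_
    (λ _ _ (s , l) (s′ , l′) → (s , s′) , (l , l′)) (one (g 0)) (col-Supp n (g ∘ suc) (b ∘ suc))
    where
    one : ∀ a → AllL.All (λ x → Same x a × x ≤ b 0) (col₁ a (b 0))
    one zero    = (tt , z≤n) ∷ []
    one (suc a) = AllLP.map⁺ (AllL.map (tt ,_) (AllLP.all-upTo (b 0)))

  -- A missing box is followed by nothing. Under this condition the column can be recovered after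
  -- `pushes`, since a 0 is not stored in the row.
  Ok : Vec ℕ n → Vec (List ℕ) n → Set
  Ok []      []        = ⊤
  Ok (x ∷ c) (row ∷ T) = (x ≡ 0 → row ≡ []) × Ok c T

  ok : ∀ g (c : Vec ℕ n) (T : Vec (List ℕ) n) → Supp g c → Fit (pred ∘ g) T → Ok c T
  ok g []      []        s       f       = tt
  ok g (x ∷ c) (row ∷ T) (s , t) (e , f) = empty row e , ok (g ∘ suc) c T t f
    where
    empty : ∀ row → length row ≡ pred (g 0) → x ≡ 0 → row ≡ []
    empty []        _ _   = refl
    empty (y ∷ row) e x≡0 = ⊥-elim (0≢1+n (trans (sym (cong pred (same-0ˡ s x≡0))) (sym e)))

  heads : Vec (List ℕ) n → Vec ℕ n
  heads = Vec.map hd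

  heads-pushes : (c : Vec ℕ n) (T : Vec (List ℕ) n) → Ok c T → heads (pushes c T) ≡ c
  heads-pushes []          []        o       = refl
  heads-pushes (zero ∷ c)  (row ∷ T) (o , p) = cong₂ _∷_ (cong hd (o refl)) (heads-pushes c T p)
  heads-pushes (suc x ∷ c) (row ∷ T) (o , p) = cong (suc x ∷_) (heads-pushes c T p)

  rowCount : ℕ → ℕ → List ℕ → ℕ
  rowCount i = List.foldr (λ x m → ind (x ≟ i) + m)

  rowCount-+ : ∀ i a m row → rowCount i (a + m) row ≡ a + rowCount i m row
  rowCount-+ i a m []        = refl
  rowCount-+ i a m (x ∷ row) =
    trans (cong (ind (x ≟ i) +_) (rowCount-+ i a m row)) (x∙yz≈y∙xz (ind (x ≟ i)) a (rowCount i m row))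

  weight-pushes : (c : Vec ℕ n) (T : Vec (List ℕ) n) → ∀ k →
                  weight (toList (pushes c T)) k ≡ cnt c k + weight (toList T) k
  weight-pushes []          []        k = refl
  weight-pushes (zero ∷ c)  (row ∷ T) k =
    trans (cong (λ m → rowCount (suc k) m row) (weight-pushes c T k)) (rowCount-+ (suc k) (cnt c k) _ row)
  weight-pushes (suc x ∷ c) (row ∷ T) k =
    trans (cong (ind (suc x ≟ suc k) +_)
            (trans (cong (λ m → rowCount (suc k) m row) (weight-pushes c T k)) (rowCount-+ (suc k) (cnt c k) _ row)))
      (sym (+-assoc (ind (suc x ≟ suc k)) (cnt c k) _))

  RowOK-push : ∀ x row → (x ≡ 0 → row ≡ []) → RowOK (push x row) → hd row ≤ x × RowOK row
  RowOK-push zero    row o h rewrite o refl = z≤n , tt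
  RowOK-push (suc x) row o h = h

  RowOK-push⁻ : ∀ x row → (x ≡ 0 → row ≡ []) → hd row ≤ x × RowOK row → RowOK (push x row)
  RowOK-push⁻ zero    row o h rewrite o refl = tt
  RowOK-push⁻ (suc x) row o h = h

  Rows-[] : ∀ row → Rows row []
  Rows-[] []        = tt
  Rows-[] (x ∷ row) = tt

  Rows-push : ∀ x row y row′ → (x ≡ 0 → row ≡ []) → (y ≡ 0 → row′ ≡ []) →
              Rows (push x row) (push y row′) → Cmp x (hd row) y × Rows row row′
  Rows-push x       row zero    row′ o o′ h rewrite o′ refl = inj₁ refl , Rows-[] row
  Rows-push zero    row (suc y) row′ o o′ h rewrite o refl = inj₂ (inj₁ z<s) , tt
  Rows-push (suc x) row (suc y) row′ o o′ h = h

  Rows-push⁻ : ∀ x row y row′ → (x ≡ 0 → row ≡ []) → (y ≡ 0 → row′ ≡ []) →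
               Cmp x (hd row) y × Rows row row′ → Rows (push x row) (push y row′)
  Rows-push⁻ x       row zero    row′ o o′ h rewrite o′ refl = Rows-[] (push x row)
  Rows-push⁻ zero    row (suc y) row′ o o′ h rewrite o refl = tt
  Rows-push⁻ (suc x) row (suc y) row′ o o′ h = h

  AllRows-push : ∀ x row (c : Vec ℕ n) T → (x ≡ 0 → row ≡ []) → Ok c T →
                 AllL.All (Rows (push x row)) (toList (pushes c T)) →
                 All (Cmp x (hd row)) c × AllL.All (Rows row) (toList T)
  AllRows-push x row []      []         o p       []       = [] , []
  AllRows-push x row (y ∷ c) (row′ ∷ T) o (q , p) (h ∷ hs)
    with Rows-push x row y row′ o q h | AllRows-push x row c T o p hs
  ... | u , v | us , vs = u ∷ us , v ∷ vs

  AllRows-push⁻ : ∀ x row (c : Vec ℕ n) T → (x ≡ 0 → row ≡ []) → Ok c T →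
                  All (Cmp x (hd row)) c → AllL.All (Rows row) (toList T) →
                  AllL.All (Rows (push x row)) (toList (pushes c T))
  AllRows-push⁻ x row []      []         o p       []       []       = []
  AllRows-push⁻ x row (y ∷ c) (row′ ∷ T) o (q , p) (u ∷ us) (v ∷ vs) =
    Rows-push⁻ x row y row′ o q (u , v) ∷ AllRows-push⁻ x row c T o p us vs

  Key-pushes : (c : Vec ℕ n) (T : Vec (List ℕ) n) → Ok c T →
               Key (toList (pushes c T)) → Adj (heads T) c × Key (toList T)
  Key-pushes []      []        o       h           = tt , tt
  Key-pushes (x ∷ c) (row ∷ T) (o , p) (h , a , k)
    with RowOK-push x row o h | AllRows-push x row c T o p a | Key-pushes c T p k
  ... | l , h′ | u , v | s , t = (l , u , s) , (h′ , v , t)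

  Key-pushes⁻ : (c : Vec ℕ n) (T : Vec (List ℕ) n) → Ok c T →
                Adj (heads T) c × Key (toList T) → Key (toList (pushes c T))
  Key-pushes⁻ []      []        o       h                             = tt
  Key-pushes⁻ (x ∷ c) (row ∷ T) (o , p) ((l , u , s) , (h′ , v , t)) =
    RowOK-push⁻ x row o (l , h′) , AllRows-push⁻ x row c T o p u v , Key-pushes⁻ c T p (s , t)

  ∑-fillV-0 : ∀ n g b (F : Vec (List ℕ) n → ℕ) → (∀ r → g r ≡ 0) → ∑ (fillV n g b) F ≡ F (Vec.replicate n [])
  ∑-fillV-0 zero    g b F e = +-identityʳ _
  ∑-fillV-0 (suc n) g b F e rewrite e 0 =
    trans (∑-product ([] ∷ []) (fillV n (g ∘ suc) (b ∘ suc)) _∷_ F)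
      (trans (+-identityʳ _) (∑-fillV-0 n (g ∘ suc) (b ∘ suc) (F ∘ ([] ∷_)) (e ∘ suc)))

  module _ (B : ℕ) where

    -- The arbitrary factor `K` of the first column is what carries the induction: after a column
    -- `c` is peeled off, it becomes the indicator of adjacency to `c`.
    ∑-fillV : ∀ n m g b (K : Vec ℕ n → ℕ) {L} → Ext L → (∀ r → g r ≤ m) → (∀ r → r < n → b r ≤ B) →
              ∑ (fillV n g b) (λ T → K (heads T) * (ind (Key? (toList T)) * L (weight (toList T)))) ≡
              ∑ (cols n B) (λ N → K N * (ind (LE? b N) * G B m g N L))
    ∑-fillV n zero g b K {L} el gm bB =
      trans (∑-fillV-0 n g b _ (λ r → n≤0⇒n≡0 (gm r)))
        (trans (cong₂ _*_ (cong K (heads-∅ n))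
                 (trans (cong (_* L (weight (∅ n))) (ind-yes (Key? (∅ n)) (Key-∅ n)))
                   (trans (trans (+-identityʳ _) (el (weight-∅ n)))
                     (sym (trans (cong (_* G B 0 g z L) (ind-yes (LE? b z) (le-intro b z (λ r → subst (_≤ b r) (sym (ix-0 n r)) z≤n))))
                       (trans (+-identityʳ _) (trans (cong (_* L (λ _ → 0)) (ind-yes (Supp? (λ _ → 0) z) (Supp-0 n))) (+-identityʳ _))))))))
          (sym (∑-cols-single B (λ N → K N * (ind (LE? b N) * G B 0 g N L)) z (bounded n) rest)))
      where
      z = Vec.replicate n 0
      ∅ : ∀ n → Tableau
      ∅ n = toList (Vec.replicate n [])
      heads-∅ : ∀ n → heads (Vec.replicate n []) ≡ Vec.replicate n 0
      heads-∅ zero    = refl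
      heads-∅ (suc n) = cong (0 ∷_) (heads-∅ n)
      allRows-∅ : ∀ n → AllL.All (Rows []) (∅ n)
      allRows-∅ zero    = []
      allRows-∅ (suc n) = tt ∷ allRows-∅ n
      Key-∅ : ∀ n → Key (∅ n)
      Key-∅ zero    = tt
      Key-∅ (suc n) = tt , allRows-∅ n , Key-∅ n
      weight-∅ : ∀ n k → weight (∅ n) k ≡ 0
      weight-∅ zero    k = refl
      weight-∅ (suc n) k = weight-∅ n k
      ix-0 : ∀ n r → ix (Vec.replicate n 0) r ≡ 0
      ix-0 zero    r       = refl
      ix-0 (suc n) zero    = refl
      ix-0 (suc n) (suc r) = ix-0 n r
      Supp-0 : ∀ n → Supp (λ _ → 0) (Vec.replicate n 0)
      Supp-0 zero    = tt
      Supp-0 (suc n) = tt , Supp-0 n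
      bounded : ∀ n → All (_≤ B) (Vec.replicate n 0)
      bounded zero    = []
      bounded (suc n) = z≤n ∷ bounded n
      rest : ∀ N → N ≢ z → K N * (ind (LE? b N) * G B 0 g N L) ≡ 0
      rest N ne rewrite ind-no (Supp? (λ _ → 0) N)
          (λ s → ne (ix-ext N z (λ r _ → trans (supp-empty _ N s r refl) (sym (ix-0 n r))))) =
        trans (cong (K N *_) (*-zeroʳ (ind (LE? b N)))) (*-zeroʳ (K N))
    ∑-fillV n (suc m) g b K {L} el gm bB =
      trans (∑-peel n g b _)
        (trans (∑-cong-All (col-Supp n g b) column)
          (trans (∑-col B n g b bB _)
            (∑-cong (cols n B) (λ N → shuffle (ind (Supp? g N)) (ind (LE? b N)) (K N) (S B m (pred ∘ g) N (L ⊕ cnt N))))))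
      where
      shuffle : ∀ s l k x → s * (l * (k * x)) ≡ k * (l * (s * x))
      shuffle = ℕ-Solver.solve-∀
      assoc₄ : ∀ k p q x → k * ((p * q) * x) ≡ k * (p * (q * x))
      assoc₄ k p q x = cong (k *_) (*-assoc p q x)
      column : ∀ c → Supp g c × LE b c →
        ∑ (fillV n (pred ∘ g) b) (λ T → K (heads (pushes c T)) * (ind (Key? (toList (pushes c T))) * L (weight (toList (pushes c T)))))
        ≡ K c * S B m (pred ∘ g) c (L ⊕ cnt c)
      column c (s , l) =
        trans (∑-cong-All (fillV-Fit n (pred ∘ g) b) term)
          (trans (∑-* (K c) (fillV n (pred ∘ g) b) _)
            (cong (K c *_)
              (trans (∑-fillV n m (pred ∘ g) b (λ N → ind (Adj? N c)) (⊕-ext el (cnt c)) (λ r → pred-mono-≤ (gm r)) bB)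
                (∑-cong (cols n B) (λ N → ind*-cong (Adj? N c) (λ adj →
                  trans (cong (_* G B m (pred ∘ g) N (L ⊕ cnt c)) (ind-yes (LE? b N)
                          (le-intro b N (λ r → ≤-trans (adj-≤ N c adj r) (le-ix b c l r)))))
                    (+-identityʳ _)))))))
        where
        term : ∀ T → Fit (pred ∘ g) T →
          K (heads (pushes c T)) * (ind (Key? (toList (pushes c T))) * L (weight (toList (pushes c T)))) ≡
          K c * (ind (Adj? (heads T) c) * (ind (Key? (toList T)) * (L ⊕ cnt c) (weight (toList T))))
        term T f = trans
          (cong₂ _*_ (cong K (heads-pushes c T o))
            (cong₂ _*_ (trans (ind-⇔ (Key? (toList (pushes c T))) (Adj? (heads T) c ×-dec Key? (toList T)) (Key-pushes c T o) (Key-pushes⁻ c T o))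
                               (ind-× (Adj? (heads T) c) (Key? (toList T))))
                       (el (weight-pushes c T))))
          (assoc₄ (K c) (ind (Adj? (heads T) c)) (ind (Key? (toList T))) _)
          where o = ok g c T s f

Ψ-Φ : ∀ B n m g b {L} → Ext L → (∀ r → g r ≤ m) → (∀ r → r < n → b r ≤ B) →
      Ψ (pairs n g b) L ≡ Φ B n m g b L
Ψ-Φ B n m g b {L} el gm bB =
  trans (∑-fill-pairs n g b _)
    (trans (∑-cong (fillV n g b) (λ T → sym (+-identityʳ _)))
      (trans (∑-fillV B n m g b (λ _ → 1) el gm bB)
        (∑-cong (cols n B) (λ N → +-identityʳ _))))

-- Coefficient extraction

-- The functional that reads off the coefficient of x^c. Agreement is tested below `B` only, to be
-- decidable; `B` is always chosen to bound both the entries of the tableaux and the support of `c`.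
test : ℕ → (ℕ → ℕ) → Test
test B c w = ind (allUpTo? (λ k → w k ≟ c k) B)

test-ext : ∀ B c → Ext (test B c)
test-ext B c e = ind-⇔ (allUpTo? _ B) (allUpTo? _ B)
  (λ f l → trans (sym (e _)) (f l)) (λ f l → trans (e _) (f l))

∧⁻ : ∀ {p q} → True (p ∧ q) → True p × True q
∧⁻ = Equivalence.to BP.T-∧

∧⁺ : ∀ {p q} → True p → True q → True (p ∧ q)
∧⁺ h h′ = Equivalence.from BP.T-∧ (h , h′)

monEq-sound : ∀ μ ν → True (monEq μ ν) → ∀ k → idx0 μ k ≡ idx0 ν k
monEq-sound []      []      h k       = refl
monEq-sound []      (y ∷ ν) h zero    = sym (≡ᵇ⇒≡ y 0 (proj₁ (∧⁻ h)))
monEq-sound []      (y ∷ ν) h (suc k) = monEq-sound [] ν (proj₂ (∧⁻ {y ≡ᵇ 0} h)) k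
monEq-sound (x ∷ μ) []      h zero    = ≡ᵇ⇒≡ x 0 (proj₁ (∧⁻ h))
monEq-sound (x ∷ μ) []      h (suc k) = monEq-sound μ [] (proj₂ (∧⁻ {x ≡ᵇ 0} h)) k
monEq-sound (x ∷ μ) (y ∷ ν) h zero    = ≡ᵇ⇒≡ x y (proj₁ (∧⁻ h))
monEq-sound (x ∷ μ) (y ∷ ν) h (suc k) = monEq-sound μ ν (proj₂ (∧⁻ {x ≡ᵇ y} h)) k

monEq-complete : ∀ μ ν → (∀ k → idx0 μ k ≡ idx0 ν k) → True (monEq μ ν)
monEq-complete []      []      e = tt
monEq-complete []      (y ∷ ν) e = ∧⁺ (≡⇒≡ᵇ y 0 (sym (e 0))) (monEq-complete [] ν (e ∘ suc))
monEq-complete (x ∷ μ) []      e = ∧⁺ (≡⇒≡ᵇ x 0 (e 0)) (monEq-complete μ [] (e ∘ suc))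
monEq-complete (x ∷ μ) (y ∷ ν) e = ∧⁺ (≡⇒≡ᵇ x y (e 0)) (monEq-complete μ ν (e ∘ suc))

private
  entries-row : ∀ i m row → (∀ c → idx0 row c < i) → List.foldr (λ x m → (if x ≡ᵇ i then 1 else 0) + m) m row ≡ m
  entries-row i m []        f = refl
  entries-row i m (x ∷ row) f = cong₂ _+_ (ind-no (x ≟ i) (<⇒≢ (f 0))) (entries-row i m row (f ∘ suc))

  count-bound : ∀ i T → 0 < i → (∀ r c → idx0 (rowOf T r) c < i) → count i T ≡ 0
  count-bound i []        i>0 f = refl
  count-bound i (row ∷ T) i>0 f = trans (entries-row i (count i T) row (f 0)) (count-bound i T i>0 (f ∘ suc))

  max-acc : ∀ m row → m ≤ List.foldr _⊔_ m row
  max-acc m []        = ≤-refl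
  max-acc m (x ∷ row) = ≤-trans (max-acc m row) (m≤n⊔m x _)

  max-row : ∀ m row c → idx0 row c ≤ List.foldr _⊔_ m row
  max-row m []        c       = z≤n
  max-row m (x ∷ row) zero    = m≤m⊔n x _
  max-row m (x ∷ row) (suc c) = ≤-trans (max-row m row c) (m≤n⊔m x _)

  maxEnt-bound : ∀ T r c → idx0 (rowOf T r) c ≤ maxEnt T
  maxEnt-bound []        r       c = z≤n
  maxEnt-bound (row ∷ T) zero    c = max-row (maxEnt T) row c
  maxEnt-bound (row ∷ T) (suc r) c = ≤-trans (maxEnt-bound T r c) (max-acc (maxEnt T) row)

  idx0-range : ∀ (f h : ℕ → ℕ) M k → idx0 (List.map f (List.map suc (List.applyUpTo h M))) k ≡
               (if k <ᵇ M then f (suc (h k)) else 0)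
  idx0-range f h zero    zero    = refl
  idx0-range f h zero    (suc k) = refl
  idx0-range f h (suc M) zero    = refl
  idx0-range f h (suc M) (suc k) = idx0-range f (h ∘ suc) M k

idx0-wt : ∀ T k → idx0 (wt T) k ≡ weight T k
idx0-wt T k = trans (idx0-range (λ i → count i T) id (maxEnt T) k) (cases (k <? maxEnt T))
  where
  cases : Dec (k < maxEnt T) → (if k <ᵇ maxEnt T then count (suc k) T else 0) ≡ count (suc k) T
  cases (yes l) rewrite Equivalence.to BP.T-≡ (<⇒<ᵇ l) = refl
  cases (no ¬l) = trans (lemma (k <ᵇ maxEnt T) (¬l ∘ <ᵇ⇒< k (maxEnt T)))
    (sym (count-bound (suc k) T z<s (λ r c → s≤s (≤-trans (maxEnt-bound T r c) (≮⇒≥ ¬l)))))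
    where
    lemma : ∀ p {x} → ¬ True p → (if p then x else 0) ≡ 0
    lemma true  h = ⊥-elim (h tt)
    lemma false h = refl

monEq-test : ∀ B T γ → (∀ r c → idx0 (rowOf T r) c ≤ B) → (∀ k → B ≤ k → idx0 γ k ≡ 0) →
             ind (BP.T? (monEq (wt T) γ)) ≡ test B (idx0 γ) (weight T)
monEq-test B T γ bT bγ = ind-⇔ (BP.T? (monEq (wt T) γ)) (allUpTo? _ B)
  (λ h {k} _ → trans (sym (idx0-wt T k)) (monEq-sound (wt T) γ h k))
  (λ f → monEq-complete (wt T) γ (λ k → trans (idx0-wt T k) (agree f k)))
  where
  agree : (∀ {k} → k < B → weight T k ≡ idx0 γ k) → ∀ k → weight T k ≡ idx0 γ k
  agree f k with k <? B
  ... | yes l = f l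
  ... | no ¬l = trans (count-bound (suc k) T z<s (λ r c → s≤s (≤-trans (bT r c) (≮⇒≥ ¬l)))) (sym (bγ k (≮⇒≥ ¬l)))

-- Membership in SSKT

-- What enumeration by `fillingsFrom` guarantees. Under it the flag and the row lengths come for
-- free, and the Boolean conditions reduce to `Key`.
Fits : (ℕ → ℕ) → ℕ → List ℕ → Tableau → Set
Fits φ r []      []        = ⊤
Fits φ r (a ∷ α) (row ∷ T) = (length row ≡ a × AllL.All (λ x → 1 ≤ x × x ≤ φ r) row) × Fits φ (suc r) α T
Fits φ r _       _         = ⊥

private
  rowsOf-Fits : ∀ a b → AllL.All (λ row → length row ≡ a × AllL.All (λ x → 1 ≤ x × x ≤ b) row) (rowsOf a b)
  rowsOf-Fits zero    b = (refl , []) ∷ []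
  rowsOf-Fits (suc a) b = All-product _∷_ (λ _ _ p (e , q) → cong suc e , p ∷ q)
    (AllLP.map⁺ (AllL.map (λ l → s≤s z≤n , l) (AllLP.all-upTo b))) (rowsOf-Fits a b)

  fillings-Fits : ∀ φ r α → AllL.All (Fits φ r α) (fillingsFrom φ r α)
  fillings-Fits φ r []      = tt ∷ []
  fillings-Fits φ r (a ∷ α) = All-product _∷_ (λ _ _ p q → p , q) (rowsOf-Fits a (φ r)) (fillings-Fits φ (suc r) α)

  fits-row : ∀ φ r α T → Fits φ r α T → ∀ k → length (rowOf T k) ≡ idx0 α k
  fits-row φ r []      []        f             k       = refl
  fits-row φ r (a ∷ α) (row ∷ T) ((e , _) , _) zero    = e
  fits-row φ r (a ∷ α) (row ∷ T) (_ , f)       (suc k) = fits-row φ (suc r) α T f k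

  fits-bound : ∀ φ r α T → Fits φ r α T → ∀ k → AllL.All (λ x → 1 ≤ x × x ≤ φ (k + r)) (rowOf T k)
  fits-bound φ r []      []        f             k       = []
  fits-bound φ r (a ∷ α) (row ∷ T) ((_ , h) , _) zero    = h
  fits-bound φ r (a ∷ α) (row ∷ T) (_ , f)       (suc k) =
    subst (λ j → AllL.All (λ x → 1 ≤ x × x ≤ φ j) (rowOf T k)) (+-suc k r) (fits-bound φ (suc r) α T f k)

  idx0-All : ∀ {P : ℕ → Set} {row} → AllL.All P row → ∀ c → c < length row → P (idx0 row c)
  idx0-All (p ∷ ps) zero    l = p
  idx0-All (p ∷ ps) (suc c) l = idx0-All ps c (s<s⁻¹ l)

idx0-≥ : ∀ row c → length row ≤ c → idx0 row c ≡ 0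
idx0-≥ []        c       l       = refl
idx0-≥ (x ∷ row) (suc c) (s≤s l) = idx0-≥ row c l

private
  all-sound : {A : Set} (p : A → Bool) (xs : List A) → True (all p xs) → AllL.All (True ∘ p) xs
  all-sound p []       h = []
  all-sound p (x ∷ xs) h = proj₁ (∧⁻ h) ∷ all-sound p xs (proj₂ (∧⁻ {p x} h))

  all-complete : {A : Set} (p : A → Bool) {xs : List A} → AllL.All (True ∘ p) xs → True (all p xs)
  all-complete p []       = tt
  all-complete p (h ∷ hs) = ∧⁺ h (all-complete p hs)

  all-range⁻ : (p : ℕ → Bool) (n : ℕ) → True (all p (range1 n)) → ∀ k → k < n → True (p (suc k))
  all-range⁻ p n h k l = AllLP.applyUpTo⁻ id n (AllLP.map⁻ (all-sound p (range1 n) h)) l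

  all-range⁺ : (p : ℕ → Bool) (n : ℕ) → (∀ k → k < n → True (p (suc k))) → True (all p (range1 n))
  all-range⁺ p n f = all-complete p (AllLP.map⁺ (AllLP.applyUpTo⁺₁ id n (λ {k} l → f k l)))

  if-true⁻ : ∀ {p q} → True (if p then q else true) → True p → True q
  if-true⁻ {true} h _ = h

  if-true⁺ : ∀ {p q} → (True p → True q) → True (if p then q else true)
  if-true⁺ {true}  f = f tt
  if-true⁺ {false} f = tt

  not⁻ : ∀ {p} → True (not p) → ¬ True p
  not⁻ {false} _ ()

  not⁺ : ∀ {p} → ¬ True p → True (not p)
  not⁺ {true}  f = f tt
  not⁺ {false} f = tt

Entries : Tableau → ℕ → ℕ → ℕ
Entries T r c = idx0 (rowOf T r) c

private
  RowOK⇒ : ∀ row → RowOK row → ∀ c → idx0 row (suc c) ≤ idx0 row c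
  RowOK⇒ []        h       c       = z≤n
  RowOK⇒ (x ∷ row) (l , h) zero    = l
  RowOK⇒ (x ∷ row) (l , h) (suc c) = RowOK⇒ row h c

  RowOK⇐ : ∀ row → (∀ c → idx0 row (suc c) ≤ idx0 row c) → RowOK row
  RowOK⇐ []        f = tt
  RowOK⇐ (x ∷ row) f = f 0 , RowOK⇐ row (f ∘ suc)

  Rows⇒ : ∀ row row′ → Rows row row′ → ∀ c → Cmp (idx0 row c) (idx0 row (suc c)) (idx0 row′ c)
  Rows⇒ []        row′       h       c with idx0 row′ c
  ... | zero  = inj₁ refl
  ... | suc _ = inj₂ (inj₁ z<s)
  Rows⇒ (x ∷ row) []         h       c       = inj₁ refl
  Rows⇒ (x ∷ row) (y ∷ row′) (l , h) zero    = l
  Rows⇒ (x ∷ row) (y ∷ row′) (l , h) (suc c) = Rows⇒ row row′ h c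

  Rows⇐ : ∀ row row′ → (∀ c → Cmp (idx0 row c) (idx0 row (suc c)) (idx0 row′ c)) → Rows row row′
  Rows⇐ []        row′       f = tt
  Rows⇐ (x ∷ row) []         f = tt
  Rows⇐ (x ∷ row) (y ∷ row′) f = f 0 , Rows⇐ row row′ (f ∘ suc)

  AllRows⇒ : ∀ row T → AllL.All (Rows row) T → ∀ k c → Cmp (idx0 row c) (idx0 row (suc c)) (Entries T k c)
  AllRows⇒ row []        []       k       c = inj₁ refl
  AllRows⇒ row (row′ ∷ T) (h ∷ hs) zero    c = Rows⇒ row row′ h c
  AllRows⇒ row (row′ ∷ T) (h ∷ hs) (suc k) c = AllRows⇒ row T hs k c

  AllRows⇐ : ∀ row T → (∀ k c → Cmp (idx0 row c) (idx0 row (suc c)) (Entries T k c)) → AllL.All (Rows row) T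
  AllRows⇐ row []         f = []
  AllRows⇐ row (row′ ∷ T) f = Rows⇐ row row′ (f 0) ∷ AllRows⇐ row T (f ∘ suc)

  Decreasing Compared : Tableau → Set
  Decreasing T = ∀ r c → Entries T r (suc c) ≤ Entries T r c
  Compared T = ∀ {i k} → i < k → ∀ c → Cmp (Entries T i c) (Entries T i (suc c)) (Entries T k c)

  Key⇒ : ∀ T → Key T → Decreasing T × Compared T
  Key⇒ []        h = (λ _ _ → z≤n) , (λ _ _ → inj₁ refl)
  Key⇒ (row ∷ T) (o , a , h) = dec , cmp
    where
    dec : Decreasing (row ∷ T)
    dec zero    = RowOK⇒ row o
    dec (suc r) = proj₁ (Key⇒ T h) r
    cmp : Compared (row ∷ T)
    cmp {zero}  {suc k} _         = AllRows⇒ row T a k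
    cmp {suc i} {suc k} (s<s i<k) = proj₂ (Key⇒ T h) i<k

  Key⇐ : ∀ T → Decreasing T → Compared T → Key T
  Key⇐ []        d c = tt
  Key⇐ (row ∷ T) d c =
    RowOK⇐ row (d 0) , AllRows⇐ row T (λ k → c {0} {suc k} z<s) , Key⇐ T (d ∘ suc) (λ i<k → c (s<s i<k))

module _ (φ : ℕ → ℕ) (α : List ℕ) (T : Tableau) (fits : Fits φ 1 α T) where

  private
    e : ℕ → ℕ → ℕ
    e = Entries T

    empty : ∀ r c → idx0 α r ≤ c → e r c ≡ 0
    empty r c l = idx0-≥ (rowOf T r) c (subst (_≤ c) (sym (fits-row φ 1 α T fits r)) l)

    entry-bounds : ∀ r c → c < idx0 α r → 1 ≤ e r c × e r c ≤ φ (suc r)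
    entry-bounds r c l = subst (λ j → 1 ≤ e r c × e r c ≤ φ j) (+-comm r 1)
      (idx0-All (fits-bound φ 1 α T fits r) c (subst (c <_) (sym (fits-row φ 1 α T fits r)) l))

    α-length : ∀ {r c} → c < idx0 α r → r < length α
    α-length {r} {c} l with r <? length α
    ... | yes p = p
    ... | no ¬p = ⊥-elim (n≮0 (subst (c <_) (idx0-≥ α r (≮⇒≥ ¬p)) l))

  Fits-bound : ∀ B → (∀ r → r < length α → φ (suc r) ≤ B) → ∀ r c → e r c ≤ B
  Fits-bound B φB r c with c <? idx0 α r
  ... | yes l = ≤-trans (proj₂ (entry-bounds r c l)) (φB r (α-length l))
  ... | no ¬l = subst (_≤ B) (sym (empty r c (≮⇒≥ ¬l))) z≤n

  isSSKT⇒Key : True (isSSKT α φ T) → Key T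
  isSSKT⇒Key h = Key⇐ T dec cmp
    where
    hA = proj₁ (∧⁻ {condA α T} h)
    hBC = proj₁ (∧⁻ {condBC α T} (proj₂ (∧⁻ {condA α T} h)))
    dec : Decreasing T
    dec r c with suc c <? idx0 α r
    ... | no ¬l = subst (_≤ e r c) (sym (empty r (suc c) (≮⇒≥ ¬l))) z≤n
    ... | yes l = ≤ᵇ⇒≤ _ _ (all-range⁻ _ (idx0 α r ∸ 1) (all-range⁻ _ (length α) hA r (α-length l)) c (lower l))
      where
      lower : ∀ {x} → suc c < x → c < x ∸ 1
      lower (s<s p) = p
    pair : ∀ {i k c} → i < k → c < idx0 α i → c < idx0 α k → True (pairCond α T (suc i) (suc k) (suc c))
    pair {i} {k} {c} i<k li lk = all-range⁻ _ (idx0 α i ⊓ idx0 α k)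
      (if-true⁻ {suc i <ᵇ suc k} (all-range⁻ _ (length α) (all-range⁻ _ (length α) hBC i (α-length li)) k (α-length lk)) (<⇒<ᵇ (s<s i<k)))
      c (⊓-glb li lk)
    cmp : Compared T
    cmp {i} {k} i<k c with c <? idx0 α k
    ... | no ¬l = inj₁ (empty k c (≮⇒≥ ¬l))
    ... | yes lk with c <? idx0 α i
    ...   | no ¬l = inj₂ (inj₁ (subst (_< e k c) (sym (empty i c (≮⇒≥ ¬l))) (proj₁ (entry-bounds k c lk))))
    ...   | yes li with <-cmp (e i c) (e k c)
    ...     | tri< l _ _ = inj₂ (inj₁ l)
    ...     | tri≈ _ q _ = ⊥-elim (not⁻ (proj₁ (∧⁻ {not (e i c ≡ᵇ e k c)} (pair i<k li lk))) (≡⇒≡ᵇ _ _ q))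
    ...     | tri> _ _ l = inj₂ (inj₂ (<ᵇ⇒< _ _ (proj₂ (∧⁻ {box α (suc i) (suc (suc c))}
                             (if-true⁻ {e k c <ᵇ e i c} (proj₂ (∧⁻ {not (e i c ≡ᵇ e k c)} (pair i<k li lk))) (<⇒<ᵇ l))))))

  Key⇒isSSKT : Key T → True (isSSKT α φ T)
  Key⇒isSSKT h = ∧⁺ {condA α T} hA (∧⁺ {condBC α T} hBC hF)
    where
    dec = proj₁ (Key⇒ T h)
    hA : True (condA α T)
    hA = all-range⁺ _ (length α) (λ r _ → all-range⁺ _ (idx0 α r ∸ 1) (λ c _ → ≤⇒≤ᵇ (dec r c)))
    hF : True (flagged α φ T)
    hF = all-range⁺ _ (length α) (λ r _ → all-range⁺ _ (idx0 α r) (λ c l →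
      ∧⁺ {1 ≤ᵇ e r c} (≤⇒≤ᵇ (proj₁ (entry-bounds r c l))) (≤⇒≤ᵇ (proj₂ (entry-bounds r c l)))))
    pc : ∀ {i k c} → i < k → c < idx0 α k → True (pairCond α T (suc i) (suc k) (suc c))
    pc {i} {k} {c} i<k lk with proj₂ (Key⇒ T h) i<k c
    ... | inj₁ q        = ⊥-elim (<⇒≢ (proj₁ (entry-bounds k c lk)) (sym q))
    ... | inj₂ (inj₁ l) = ∧⁺ {not (e i c ≡ᵇ e k c)} (not⁺ {e i c ≡ᵇ e k c} (<⇒≢ l ∘ ≡ᵇ⇒≡ _ _))
                            (if-true⁺ {e k c <ᵇ e i c} (λ l′ → ⊥-elim (<-asym l (<ᵇ⇒< _ _ l′))))
    ... | inj₂ (inj₂ l) = ∧⁺ {not (e i c ≡ᵇ e k c)} (not⁺ {e i c ≡ᵇ e k c} (λ q → <⇒≢ (<-≤-trans l (dec i c)) (sym (≡ᵇ⇒≡ _ _ q))))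
                            (if-true⁺ {e k c <ᵇ e i c} (λ _ → ∧⁺ {box α (suc i) (suc (suc c))} bx (<⇒<ᵇ l)))
      where
      -- The right neighbour exceeds an entry, hence is nonzero, and a nonzero entry sits in an
      -- actual box.
      bx : True (suc (suc c) ≤ᵇ idx0 α i)
      bx with suc c <? idx0 α i
      ... | yes p = ≤⇒≤ᵇ p
      ... | no ¬p = ⊥-elim (n≮0 (subst (e k c <_) (empty i (suc c) (≮⇒≥ ¬p)) l))
    hBC : True (condBC α T)
    hBC = all-range⁺ _ (length α) (λ i _ → all-range⁺ _ (length α) (λ k _ →
      if-true⁺ {suc i <ᵇ suc k} (λ i<k → all-range⁺ _ (idx0 α i ⊓ idx0 α k) (λ c l →
        pc (s<s⁻¹ (<ᵇ⇒< (suc i) (suc k) i<k)) (≤-trans l (m⊓n≤n (idx0 α i) (idx0 α k)))))))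

private
  coeff-∑ : (xs : List Tableau) (γ : Mon) →
            coeff (List.map (λ T → (⁺ 1 , wt T)) xs) γ ≡ ⁺ ∑ xs (λ T → ind (BP.T? (monEq (wt T) γ)))
  coeff-∑ []       γ = refl
  coeff-∑ (T ∷ xs) γ with monEq (wt T) γ
  ... | true  = cong (ℤ._+_ (⁺ 1)) (coeff-∑ xs γ)
  ... | false = cong (ℤ._+_ (⁺ 0)) (coeff-∑ xs γ)

  ∑-fillingsFrom : ∀ φ r α b (F : Tableau → ℕ) → (∀ k → b k ≡ φ (k + r)) →
                   ∑ (fillingsFrom φ r α) F ≡ ∑ (fill (pairs (length α) (idx0 α) b)) F
  ∑-fillingsFrom φ r []      b F e = refl
  ∑-fillingsFrom φ r (a ∷ α) b F e rewrite sym (e 0) =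
    trans (∑-product (rowsOf a (b 0)) (fillingsFrom φ (suc r) α) _∷_ F)
      (trans (∑-cong (rowsOf a (b 0)) (λ row →
               ∑-fillingsFrom φ (suc r) α (b ∘ suc) (F ∘ (row ∷_)) (λ k → trans (e (suc k)) (cong φ (sym (+-suc k r))))))
        (sym (∑-product (rowsOf a (b 0)) (fill (pairs (length α) (idx0 α) (b ∘ suc))) _∷_ F)))

κφ-Ψ : ∀ B α φ γ → (∀ r → r < length α → φ (suc r) ≤ B) → (∀ k → B ≤ k → idx0 γ k ≡ 0) →
       coeff (κφ α φ) γ ≡ ⁺ Ψ (pairs (length α) (idx0 α) (φ ∘ suc)) (test B (idx0 γ))
κφ-Ψ B α φ γ φB bγ = trans (coeff-∑ (SSKT α φ) γ) (cong ⁺_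
  (trans (∑-filter (λ T → BP.T? (isSSKT α φ T)) (fillingsFrom φ 1 α) _)
    (trans (∑-cong-All (fillings-Fits φ 1 α) (λ T f → cong₂ _*_
             (ind-⇔ (BP.T? (isSSKT α φ T)) (Key? T) (isSSKT⇒Key φ α T f) (Key⇒isSSKT φ α T f))
             (monEq-test B T γ (Fits-bound φ α T f B φB) bγ)))
      (∑-fillingsFrom φ 1 α (φ ∘ suc) _ (λ k → cong φ (+-comm 1 k))))))

-- Removing empty rows

strip : List (ℕ × ℕ) → List (ℕ × ℕ)
strip []                 = []
strip ((zero  , b) ∷ ps) = strip ps
strip ((suc a , b) ∷ ps) = (suc a , b) ∷ strip ps

private
  stripT : Tableau → Tableau
  stripT []              = []
  stripT ([] ∷ T)        = stripT T
  stripT ((x ∷ row) ∷ T) = (x ∷ row) ∷ stripT T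

  ∑-strip : ∀ ps (F : Tableau → ℕ) → ∑ (fill ps) (F ∘ stripT) ≡ ∑ (fill (strip ps)) F
  ∑-strip []                 F = refl
  ∑-strip ((zero  , b) ∷ ps) F =
    trans (∑-product ([] ∷ []) (fill ps) _∷_ (F ∘ stripT)) (trans (+-identityʳ _) (∑-strip ps F))
  ∑-strip ((suc a , b) ∷ ps) F =
    trans (∑-product (rowsOf (suc a) b) (fill ps) _∷_ (F ∘ stripT))
      (trans (∑-rowsOf-suc a b _)
        (trans (∑-cong (upTo b) (λ x → ∑-cong (rowsOf a b) (λ row → ∑-strip ps (F ∘ ((suc x ∷ row) ∷_)))))
          (trans (sym (∑-rowsOf-suc a b _))
            (sym (∑-product (rowsOf (suc a) b) (fill (strip ps)) _∷_ F)))))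

  AllRows-strip : ∀ row T → AllL.All (Rows row) T → AllL.All (Rows row) (stripT T)
  AllRows-strip row []              []       = []
  AllRows-strip row ([] ∷ T)        (h ∷ hs) = AllRows-strip row T hs
  AllRows-strip row ((x ∷ row′) ∷ T) (h ∷ hs) = h ∷ AllRows-strip row T hs

  AllRows-strip⁻ : ∀ row T → AllL.All (Rows row) (stripT T) → AllL.All (Rows row) T
  AllRows-strip⁻ row []               hs       = []
  AllRows-strip⁻ row ([] ∷ T)         hs       = Rows⇐ row [] (λ _ → inj₁ refl) ∷ AllRows-strip⁻ row T hs
  AllRows-strip⁻ row ((x ∷ row′) ∷ T) (h ∷ hs) = h ∷ AllRows-strip⁻ row T hs

  Key-strip : ∀ T → Key T → Key (stripT T)
  Key-strip []              h           = tt
  Key-strip ([] ∷ T)        (_ , _ , h) = Key-strip T h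
  Key-strip ((x ∷ row) ∷ T) (o , a , h) = o , AllRows-strip (x ∷ row) T a , Key-strip T h

  Key-strip⁻ : ∀ T → Key (stripT T) → Key T
  Key-strip⁻ []              h           = tt
  Key-strip⁻ ([] ∷ T)        h           = tt , AllL.universal (λ _ → tt) T , Key-strip⁻ T h
  Key-strip⁻ ((x ∷ row) ∷ T) (o , a , h) = o , AllRows-strip⁻ (x ∷ row) T a , Key-strip⁻ T h

  weight-strip : ∀ T k → weight T k ≡ weight (stripT T) k
  weight-strip []              k = refl
  weight-strip ([] ∷ T)        k = weight-strip T k
  weight-strip ((x ∷ row) ∷ T) k =
    cong (λ m → List.foldr (λ x m → (if x ≡ᵇ suc k then 1 else 0) + m) m (x ∷ row)) (weight-strip T k)

-- Empty rows satisfy every comparison and carry no weight. This serves two purposes: shapes can be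
-- padded to a common number of rows, and a strictly increasing flag can be matched with the
-- identity flag.
Ψ-strip : ∀ ps {L} → Ext L → Ψ ps L ≡ Ψ (strip ps) L
Ψ-strip ps el = trans
  (∑-cong (fill ps) (λ T → cong₂ _*_ (ind-⇔ (Key? T) (Key? (stripT T)) (Key-strip T) (Key-strip⁻ T)) (el (weight-strip T))))
  (∑-strip ps _)

strip-pairs-0 : ∀ n g b → (∀ k → g k ≡ 0) → strip (pairs n g b) ≡ []
strip-pairs-0 zero    g b e = refl
strip-pairs-0 (suc n) g b e rewrite e 0 = strip-pairs-0 n (g ∘ suc) (b ∘ suc) (e ∘ suc)

strip-cons : ∀ a b {ps qs} → strip ps ≡ strip qs → strip ((a , b) ∷ ps) ≡ strip ((a , b) ∷ qs)
strip-cons zero    b e = e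
strip-cons (suc a) b e = cong ((suc a , b) ∷_) e

strip-pad : ∀ n α b → length α ≤ n → strip (pairs n (idx0 α) b) ≡ strip (pairs (length α) (idx0 α) b)
strip-pad n       []      b l       = strip-pairs-0 n (idx0 []) b (λ _ → refl)
strip-pad (suc n) (a ∷ α) b (s≤s l) = strip-cons a (b 0) (strip-pad n α (b ∘ suc) l)

κφ-Φ : ∀ B n m α φ γ → length α ≤ n → (∀ r → idx0 α r ≤ m) → (∀ r → r < n → φ (suc r) ≤ B) →
       (∀ k → B ≤ k → idx0 γ k ≡ 0) →
       coeff (κφ α φ) γ ≡ ⁺ Φ B n m (idx0 α) (φ ∘ suc) (test B (idx0 γ))
κφ-Φ B n m α φ γ ln αm φB bγ =
  trans (κφ-Ψ B α φ γ (λ r l → φB r (<-≤-trans l ln)) bγ)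
    (cong ⁺_ (trans (Ψ-strip (pairs (length α) (idx0 α) (φ ∘ suc)) el)
      (trans (cong (λ ps → Ψ ps (test B (idx0 γ))) (sym (strip-pad n α (φ ∘ suc) ln)))
        (trans (sym (Ψ-strip (pairs n (idx0 α) (φ ∘ suc)) el))
          (Ψ-Φ B n m (idx0 α) (φ ∘ suc) el αm φB)))))
  where
  el = test-ext B (idx0 γ)

-- Coefficients of π_i

idx0-upd0 : ∀ l k v → idx0 (upd0 l k v) k ≡ v
idx0-upd0 []      zero    v = refl
idx0-upd0 []      (suc k) v = idx0-upd0 [] k v
idx0-upd0 (x ∷ l) zero    v = refl
idx0-upd0 (x ∷ l) (suc k) v = idx0-upd0 l k v

idx0-upd0-≢ : ∀ l k v j → j ≢ k → idx0 (upd0 l k v) j ≡ idx0 l j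
idx0-upd0-≢ []      zero    v zero    ne = ⊥-elim (ne refl)
idx0-upd0-≢ []      zero    v (suc j) ne = refl
idx0-upd0-≢ []      (suc k) v zero    ne = refl
idx0-upd0-≢ []      (suc k) v (suc j) ne = idx0-upd0-≢ [] k v j (ne ∘ cong suc)
idx0-upd0-≢ (x ∷ l) zero    v zero    ne = ⊥-elim (ne refl)
idx0-upd0-≢ (x ∷ l) zero    v (suc j) ne = refl
idx0-upd0-≢ (x ∷ l) (suc k) v zero    ne = refl
idx0-upd0-≢ (x ∷ l) (suc k) v (suc j) ne = idx0-upd0-≢ l k v j (ne ∘ cong suc)

set₂ : ℕ → Mon → ℕ → ℕ → Mon
set₂ i μ u v = upd0 (upd0 μ i u) (suc i) v

set₂-fst : ∀ i μ u v → idx0 (set₂ i μ u v) i ≡ u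
set₂-fst i μ u v = trans (idx0-upd0-≢ (upd0 μ i u) (suc i) v i (≢-sym 1+n≢n)) (idx0-upd0 μ i u)

set₂-snd : ∀ i μ u v → idx0 (set₂ i μ u v) (suc i) ≡ v
set₂-snd i μ u v = idx0-upd0 (upd0 μ i u) (suc i) v

set₂-other : ∀ i μ u v j → j ≢ i → j ≢ suc i → idx0 (set₂ i μ u v) j ≡ idx0 μ j
set₂-other i μ u v j p q = trans (idx0-upd0-≢ (upd0 μ i u) (suc i) v j q) (idx0-upd0-≢ μ i u j p)

at-pair : ∀ {A : Set} i (f h : ℕ → A) → f i ≡ h i → f (suc i) ≡ h (suc i) →
          (∀ j → j ≢ i → j ≢ suc i → f j ≡ h j) → ∀ j → f j ≡ h j
at-pair i f h e₁ e₂ e₃ j with j ≟ i | j ≟ suc i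
... | yes refl | _        = e₁
... | no _     | yes refl = e₂
... | no p     | no q     = e₃ j p q

coeff-cong : ∀ p {γ γ′} → (∀ k → idx0 γ k ≡ idx0 γ′ k) → coeff p γ ≡ coeff p γ′
coeff-cong []            e = refl
coeff-cong ((c , μ) ∷ p) {γ} {γ′} e =
  cong₂ ℤ._+_ (cong (λ b → if b then c else ⁺ 0) (bool-ext
    (λ h → monEq-complete μ γ′ (λ k → trans (monEq-sound μ γ h k) (e k)))
    (λ h → monEq-complete μ γ (λ k → trans (monEq-sound μ γ′ h k) (sym (e k))))))
    (coeff-cong p e)
  where
  bool-ext : ∀ {b b′} → (True b → True b′) → (True b′ → True b) → b ≡ b′
  bool-ext {true}  {true}  f g = refl
  bool-ext {true}  {false} f g = ⊥-elim (f _)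
  bool-ext {false} {true}  f g = ⊥-elim (g _)
  bool-ext {false} {false} f g = refl

private
  hit : Mon → Mon → ℕ
  hit μ γ = ind (BP.T? (monEq μ γ))

  coeff-++ : ∀ p q γ → coeff (p ++ q) γ ≡ coeff p γ ℤ.+ coeff q γ
  coeff-++ []            q γ = sym (ℤP.+-identityˡ (coeff q γ))
  coeff-++ ((c , μ) ∷ p) q γ =
    trans (cong (ℤ._+_ (if monEq μ γ then c else ⁺ 0)) (coeff-++ p q γ)) (sym (ℤP.+-assoc (if monEq μ γ then c else ⁺ 0) (coeff p γ) (coeff q γ)))

  scaled : ∀ c μ γ → (if monEq μ γ then c else ⁺ 0) ≡ c ℤ.* ⁺ hit μ γ
  scaled c μ γ with monEq μ γ
  ... | true  = sym (ℤP.*-identityʳ c)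
  ... | false = sym (ℤP.*-zeroʳ c)

  coeff-scale : ∀ c q γ → coeff (List.map (λ { (d , μ) → (c ℤ.* d , μ) }) q) γ ≡ c ℤ.* coeff q γ
  coeff-scale c []            γ = sym (ℤP.*-zeroʳ c)
  coeff-scale c ((d , μ) ∷ q) γ =
    trans (cong₂ ℤ._+_ (head (monEq μ γ)) (coeff-scale c q γ)) (sym (ℤP.*-distribˡ-+ c _ (coeff q γ)))
    where
    head : ∀ b → (if b then c ℤ.* d else ⁺ 0) ≡ c ℤ.* (if b then d else ⁺ 0)
    head true  = refl
    head false = sym (ℤP.*-zeroʳ c)

  coeff-map : ∀ s (M : ℕ → Mon) xs γ →
              coeff (List.map (λ k → (s , M k)) xs) γ ≡ s ℤ.* ⁺ ∑ xs (λ k → hit (M k) γ)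
  coeff-map s M []       γ = sym (ℤP.*-zeroʳ s)
  coeff-map s M (k ∷ xs) γ =
    trans (cong₂ ℤ._+_ (scaled s (M k) γ) (coeff-map s M xs γ))
      (trans (sym (ℤP.*-distribˡ-+ s (⁺ hit (M k) γ) (⁺ ∑ xs (λ k → hit (M k) γ))))
        (cong (s ℤ.*_) (sym (ℤP.pos-+ (hit (M k) γ) _))))

  ∑-ind-unique : {P : ℕ → Set} {D : Set} (P? : ∀ k → Dec (P k)) (D? : Dec D) (N : ℕ) →
                 (∀ {k k′} → P k → P k′ → k ≡ k′) → (D → ∃ λ k → k < N × P k) → (∀ {k} → k < N → P k → D) →
                 ∑ (upTo N) (λ k → ind (P? k)) ≡ ind D?
  ∑-ind-unique P? (yes d) N uniq ex _ with ex d
  ... | k , k<N , p = trans (∑-upTo-single N k _ k<N (λ j j≢k → ind-no (P? j) (λ q → j≢k (uniq q p)))) (ind-yes (P? k) p)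
  ∑-ind-unique P? (no ¬d) N uniq _ f =
    trans (∑-cong-All (AllLP.all-upTo N) (λ k k<N → ind-no (P? k) (λ p → ¬d (f k<N p)))) (∑-zero (upTo N) (λ _ → refl))

  ind-exchange : {A A′ C C′ : Set} (a : Dec A) (a′ : Dec A′) (c : Dec C) (c′ : Dec C′) →
                 ¬ (A × A′) → ¬ (C × C′) → (A ⊎ A′ → C ⊎ C′) → (C ⊎ C′ → A ⊎ A′) →
                 ind a + ind a′ ≡ ind c + ind c′
  ind-exchange a a′ c c′ ¬a ¬c f g =
    trans (sym (ind-⊎ a a′ ¬a)) (trans (ind-⇔ (a ⊎-dec a′) (c ⊎-dec c′) f g) (ind-⊎ c c′ ¬c))

  +-pos-cong : ∀ {x y z w} → x + y ≡ z + w → ⁺ x ℤ.+ ⁺ y ≡ ⁺ z ℤ.+ ⁺ w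
  +-pos-cong {x} {y} {z} {w} e = trans (sym (ℤP.pos-+ x y)) (trans (cong ⁺_ e) (ℤP.pos-+ z w))

  neg-exchange : ∀ {x y z w} → z + y ≡ x + w → - ⁺ x ℤ.+ ⁺ y ≡ - ⁺ z ℤ.+ ⁺ w
  neg-exchange {x} {y} {z} {w} e = begin
    - ⁺ x ℤ.+ ⁺ y                         ≡⟨ cong (ℤ._+ ⁺ y) (sym (ℤP.+-identityʳ (- ⁺ x))) ⟩
    (- ⁺ x ℤ.+ ⁺ 0) ℤ.+ ⁺ y               ≡⟨ cong (λ t → (- ⁺ x ℤ.+ t) ℤ.+ ⁺ y) (sym (ℤP.+-inverseˡ (⁺ z))) ⟩
    (- ⁺ x ℤ.+ (- ⁺ z ℤ.+ ⁺ z)) ℤ.+ ⁺ y   ≡⟨ shuffle (- ⁺ x) (- ⁺ z) (⁺ z) (⁺ y) ⟩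
    - ⁺ z ℤ.+ (- ⁺ x ℤ.+ (⁺ z ℤ.+ ⁺ y))   ≡⟨ cong (λ t → - ⁺ z ℤ.+ (- ⁺ x ℤ.+ t)) (+-pos-cong {z} {y} {x} {w} e) ⟩
    - ⁺ z ℤ.+ (- ⁺ x ℤ.+ (⁺ x ℤ.+ ⁺ w))   ≡⟨ cong (ℤ._+_ (- ⁺ z)) (sym (ℤP.+-assoc (- ⁺ x) (⁺ x) (⁺ w))) ⟩
    - ⁺ z ℤ.+ ((- ⁺ x ℤ.+ ⁺ x) ℤ.+ ⁺ w)   ≡⟨ cong (λ t → - ⁺ z ℤ.+ (t ℤ.+ ⁺ w)) (ℤP.+-inverseˡ (⁺ x)) ⟩
    - ⁺ z ℤ.+ (⁺ 0 ℤ.+ ⁺ w)               ≡⟨ cong (ℤ._+_ (- ⁺ z)) (ℤP.+-identityˡ (⁺ w)) ⟩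
    - ⁺ z ℤ.+ ⁺ w                         ∎
    where
    open ≡-Reasoning
    shuffle : ∀ p q r s → (p ℤ.+ (q ℤ.+ r)) ℤ.+ s ≡ q ℤ.+ (p ℤ.+ (r ℤ.+ s))
    shuffle = ℤ-Solver.solve-∀

module _ (i : ℕ) (μ γ : Mon) where

  private
    a b : ℕ
    a = idx0 μ i
    b = idx0 μ (suc i)
    μ⁺ : Mon
    μ⁺ = upd0 μ i (suc a)
    γ[_,_] : ℕ → ℕ → Mon
    γ[ u , v ] = set₂ i γ u v

    -- Agreement of `μ` and `γ` in all exponents other than the two on which `π_i` acts.
    Off : Set
    Off = True (monEq (set₂ i μ 0 0) γ[ 0 , 0 ])
    Off? : Dec Off
    Off? = BP.T? (monEq (set₂ i μ 0 0) γ[ 0 , 0 ])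

    Like : Mon → Set
    Like ν = ∀ j → j ≢ i → j ≢ suc i → idx0 ν j ≡ idx0 μ j

    hit⇒ : ∀ ν u v → Like ν → True (monEq ν γ[ u , v ]) → Off × idx0 ν i ≡ u × idx0 ν (suc i) ≡ v
    hit⇒ ν u v like h =
      monEq-complete (set₂ i μ 0 0) γ[ 0 , 0 ] (at-pair i _ _
        (trans (set₂-fst i μ 0 0) (sym (set₂-fst i γ 0 0)))
        (trans (set₂-snd i μ 0 0) (sym (set₂-snd i γ 0 0)))
        (λ j p q → trans (set₂-other i μ 0 0 j p q) (trans (sym (like j p q))
          (trans (s j) (trans (set₂-other i γ u v j p q) (sym (set₂-other i γ 0 0 j p q))))))) ,
      trans (s i) (set₂-fst i γ u v) , trans (s (suc i)) (set₂-snd i γ u v)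
      where s = monEq-sound ν γ[ u , v ] h

    hit⇐ : ∀ ν u v → Like ν → Off × idx0 ν i ≡ u × idx0 ν (suc i) ≡ v → True (monEq ν γ[ u , v ])
    hit⇐ ν u v like (o , e₁ , e₂) = monEq-complete ν γ[ u , v ] (at-pair i _ _
      (trans e₁ (sym (set₂-fst i γ u v))) (trans e₂ (sym (set₂-snd i γ u v)))
      (λ j p q → trans (like j p q) (trans (sym (set₂-other i μ 0 0 j p q))
        (trans (s j) (trans (set₂-other i γ 0 0 j p q) (sym (set₂-other i γ u v j p q)))))))
      where s = monEq-sound (set₂ i μ 0 0) γ[ 0 , 0 ] o

    like⁺ : ∀ x y → Like (set₂ i μ⁺ x y)
    like⁺ x y j p q = trans (set₂-other i μ⁺ x y j p q) (idx0-upd0-≢ μ i (suc a) j p)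

    hit⁺⇒ : ∀ {x y u v} → True (monEq (set₂ i μ⁺ x y) γ[ u , v ]) → Off × x ≡ u × y ≡ v
    hit⁺⇒ {x} {y} {u} {v} h with hit⇒ (set₂ i μ⁺ x y) u v (like⁺ x y) h
    ... | o , e₁ , e₂ = o , trans (sym (set₂-fst i μ⁺ x y)) e₁ , trans (sym (set₂-snd i μ⁺ x y)) e₂

    hit⁺⇐ : ∀ {x y u v} → Off → x ≡ u → y ≡ v → True (monEq (set₂ i μ⁺ x y) γ[ u , v ])
    hit⁺⇐ {x} {y} {u} {v} o e₁ e₂ = hit⇐ (set₂ i μ⁺ x y) u v (like⁺ x y)
      (o , trans (set₂-fst i μ⁺ x y) e₁ , trans (set₂-snd i μ⁺ x y) e₂)

    Hit? : ∀ u v → Dec (True (monEq μ γ[ u , v ]))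
    Hit? u v = BP.T? (monEq μ γ[ u , v ])

    hit⇒′ : ∀ {u v} → True (monEq μ γ[ u , v ]) → Off × a ≡ u × b ≡ v
    hit⇒′ {u} {v} = hit⇒ μ u v (λ _ _ _ → refl)

    hit⇐′ : ∀ {u v} → Off → a ≡ u → b ≡ v → True (monEq μ γ[ u , v ])
    hit⇐′ {u} {v} o e e′ = hit⇐ μ u v (λ _ _ _ → refl) (o , e , e′)

    -- The monomials of π_i(x_i^a x_{i+1}^b): for b ≤ a it is the sum over `D₁`, for b > a+1 minus
    -- the sum over `D₂`, and for b = a+1 it vanishes. The shift comes from the factor x_i inside
    -- π_i.
    D₁ D₂ : ℕ → ℕ → Set
    D₁ u v = Off × (b ≤ v × v ≤ a) × u + v ≡ a + b
    D₂ u v = Off × (suc a ≤ u × u < b) × u + v ≡ a + b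

    D₁? : ∀ u v → Dec (D₁ u v)
    D₁? u v = Off? ×-dec ((b ≤? v ×-dec v ≤? a) ×-dec u + v ≟ a + b)

    D₂? : ∀ u v → Dec (D₂ u v)
    D₂? u v = Off? ×-dec ((suc a ≤? u ×-dec u <? b) ×-dec u + v ≟ a + b)

    down : b < suc a → ∀ u v → ∑ (upTo (suc a ∸ b)) (λ k → hit (set₂ i μ⁺ (a ∸ k) (b + k)) γ[ u , v ]) ≡ ind (D₁? u v)
    down (s≤s b≤a) u v = ∑-ind-unique (λ k → BP.T? (monEq (set₂ i μ⁺ (a ∸ k) (b + k)) γ[ u , v ])) (D₁? u v) (suc a ∸ b)
      (λ p q → +-cancelˡ-≡ b _ _ (trans (proj₂ (proj₂ (hit⁺⇒ p))) (sym (proj₂ (proj₂ (hit⁺⇒ q))))))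
      (λ (o , (b≤v , v≤a) , e) → v ∸ b , ∸-monoˡ-< (s≤s v≤a) b≤v ,
        hit⁺⇐ o (fst-eq b≤v v≤a e) (m+[n∸m]≡n b≤v))
      (λ {k} k<N p → let (o , e₁ , e₂) = hit⁺⇒ p ; k≤a = ≤-trans (≤-pred (≤-trans k<N (m∸n≤m (suc a) b))) ≤-refl in
        o , (subst (b ≤_) e₂ (m≤m+n b k) , subst (_≤ a) e₂ (bound k k<N)) ,
        trans (sym (cong₂ _+_ e₁ e₂)) (sum-eq k k≤a))
      where
      fst-eq : b ≤ v → v ≤ a → u + v ≡ a + b → a ∸ (v ∸ b) ≡ u
      fst-eq b≤v v≤a e = +-cancelʳ-≡ (v ∸ b) _ _ (trans (m∸n+n≡m (≤-trans (m∸n≤m v b) v≤a))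
        (+-cancelʳ-≡ b _ _ (trans (sym e) (trans (cong (u +_) (sym (m∸n+n≡m b≤v))) (sym (+-assoc u (v ∸ b) b))))))
      bound : ∀ k → k < suc a ∸ b → b + k ≤ a
      bound k l = subst (b + k ≤_) (m+[n∸m]≡n b≤a) (+-monoʳ-≤ b (≤-pred (subst (k <_) (+-∸-assoc 1 b≤a) l)))
      sum-eq : ∀ k → k ≤ a → (a ∸ k) + (b + k) ≡ a + b
      sum-eq k k≤a = trans (cong (a ∸ k +_) (+-comm b k)) (trans (sym (+-assoc (a ∸ k) k b)) (cong (_+ b) (m∸n+n≡m k≤a)))

    up : suc a < b → ∀ u v → ∑ (upTo (b ∸ suc a)) (λ k → hit (set₂ i μ⁺ (suc a + k) (b ∸ 1 ∸ k)) γ[ u , v ]) ≡ ind (D₂? u v)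
    up a<b u v = ∑-ind-unique (λ k → BP.T? (monEq (set₂ i μ⁺ (suc a + k) (b ∸ 1 ∸ k)) γ[ u , v ])) (D₂? u v) (b ∸ suc a)
      (λ p q → +-cancelˡ-≡ (suc a) _ _ (trans (proj₁ (proj₂ (hit⁺⇒ p))) (sym (proj₁ (proj₂ (hit⁺⇒ q))))))
      (λ (o , (l , u<b) , e) → u ∸ suc a , ∸-monoˡ-< u<b l ,
        hit⁺⇐ o (m+[n∸m]≡n l) (snd-eq l u<b e))
      (λ {k} k<N p → let (o , e₁ , e₂) = hit⁺⇒ p in
        o , (subst (suc a ≤_) e₁ (m≤m+n (suc a) k) , subst (_< b) e₁ (bound k k<N)) ,
        trans (sym (cong₂ _+_ e₁ e₂)) (sum-eq k (bound k k<N)))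
      where
      bound : ∀ k → k < b ∸ suc a → suc a + k < b
      bound k l = subst₂ _≤_ (+-suc (suc a) k) (m+[n∸m]≡n (<⇒≤ a<b)) (+-monoʳ-≤ (suc a) l)
      sum-eq : ∀ k → suc a + k < b → (suc a + k) + (b ∸ 1 ∸ k) ≡ a + b
      sum-eq k l = trans (cong (suc a + k +_) (∸-+-assoc b 1 k))
        (trans (cong (_+ (b ∸ suc k)) (sym (+-suc a k))) (trans (+-assoc a (suc k) _)
          (cong (_+_ a) (m+[n∸m]≡n (≤-trans (s≤s (m≤n+m k (suc a))) l)))))
      snd-eq : suc a ≤ u → u < b → u + v ≡ a + b → b ∸ 1 ∸ (u ∸ suc a) ≡ v
      snd-eq l u<b e = +-cancelˡ-≡ u _ _ (trans
        (cong (_+ (b ∸ 1 ∸ (u ∸ suc a))) (sym (m+[n∸m]≡n l)))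
        (trans (sum-eq (u ∸ suc a) (subst (_< b) (sym (m+[n∸m]≡n l)) u<b)) (sym e)))

  private
    h : ℕ → ℕ → ℤ
    h u v = coeff (∂mon (suc i) μ⁺) γ[ u , v ]

    ∂-cases : ℕ → ℕ → Poly
    ∂-cases p q =
      if q <ᵇ p then List.map (λ k → (⁺ 1 , set₂ i μ⁺ (p ∸ 1 ∸ k) (q + k))) (upTo (p ∸ q))
      else (if p <ᵇ q then List.map (λ k → (- (⁺ 1) , set₂ i μ⁺ (p + k) (q ∸ 1 ∸ k))) (upTo (q ∸ p))
      else [])

    h≡ : ∀ u v → h u v ≡ coeff (∂-cases (suc a) b) γ[ u , v ]
    h≡ u v = cong₂ (λ p q → coeff (∂-cases p q) γ[ u , v ]) (idx0-upd0 μ i (suc a)) (idx0-upd0-≢ μ i (suc a) (suc i) 1+n≢n)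

    data Shape : Set where
      shape₁ : b ≤ a → (∀ u v → h u v ≡ ⁺ ind (D₁? u v)) → Shape
      shape₂ : suc a < b → (∀ u v → h u v ≡ - ⁺ ind (D₂? u v)) → Shape
      shape₃ : b ≡ suc a → (∀ u v → h u v ≡ ⁺ 0) → Shape

    if-yes : ∀ {A : Set} {p} {x y : A} → True p → (if p then x else y) ≡ x
    if-yes {p = true} _ = refl

    if-no : ∀ {A : Set} {p} {x y : A} → ¬ True p → (if p then x else y) ≡ y
    if-no {p = true}  f = ⊥-elim (f _)
    if-no {p = false} f = refl

    shape : Shape
    shape with <-cmp b (suc a)
    ... | tri< l _ _ = shape₁ (≤-pred l) (λ u v → trans (h≡ u v)
      (trans (cong (λ p → coeff p γ[ u , v ]) (if-yes (<⇒<ᵇ l)))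
        (trans (coeff-map (⁺ 1) _ (upTo (suc a ∸ b)) γ[ u , v ])
          (trans (ℤP.*-identityˡ _) (cong ⁺_ (down l u v))))))
    ... | tri≈ _ e _ = shape₃ e (λ u v → trans (h≡ u v) (cong (λ p → coeff p γ[ u , v ])
      (trans (if-no {p = b <ᵇ suc a} (λ l → <⇒≢ (<ᵇ⇒< b (suc a) l) e))
             (if-no {p = suc a <ᵇ b} (λ l → <⇒≢ (<ᵇ⇒< (suc a) b l) (sym e))))))
    ... | tri> _ _ l = shape₂ l (λ u v → trans (h≡ u v)
      (trans (cong (λ p → coeff p γ[ u , v ])
               (trans (if-no {p = b <ᵇ suc a} (λ l′ → <-asym l (<ᵇ⇒< b (suc a) l′))) (if-yes {p = suc a <ᵇ b} (<⇒<ᵇ l))))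
        (trans (coeff-map (- ⁺ 1) _ (upTo (b ∸ suc a)) γ[ u , v ])
          (trans (ℤP.-1*i≡-i _) (cong (λ t → - ⁺ t) (up l u v))))))

    f : ℕ → ℕ → ℕ
    f u v = hit μ γ[ u , v ]

  -- This and the next lemma compare coefficients in (x_i - x_{i+1}) π_i f = x_i f - x_{i+1} s_i f,
  -- here at x_i^0 x_{i+1}^{v+1}, where only the terms with x_{i+1} survive.
  ∂mon-zero : ∀ v → coeff (∂mon (suc i) μ⁺) γ[ 0 , v ] ≡ ⁺ f v 0
  ∂mon-zero v with shape
  ... | shape₁ b≤a e = trans (e 0 v) (cong ⁺_ (ind-⇔ (D₁? 0 v) (Hit? v 0)
          (λ (o , (b≤v , v≤a) , s) → let b≡0 = n≤0⇒n≡0 (+-cancelˡ-≤ a b 0 (subst₂ _≤_ s (sym (+-identityʳ a)) v≤a)) in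
            hit⇐′ o (sym (trans s (trans (cong (_+_ a) b≡0) (+-identityʳ a)))) b≡0)
          (λ p → let (o , e₁ , e₂) = hit⇒′ p in
            o , (subst (_≤ v) (sym e₂) z≤n , ≤-reflexive (sym e₁)) , trans (sym e₁) (sym (trans (cong (_+_ a) e₂) (+-identityʳ a))))))
  ... | shape₂ l e = trans (e 0 v) (trans (cong (λ t → - ⁺ t) (ind-no (D₂? 0 v) (λ { (_ , (() , _) , _) })))
          (cong ⁺_ (sym (ind-no (Hit? v 0) (λ p → n≮0 (subst (suc a <_) (proj₂ (proj₂ (hit⇒′ p))) l))))))
  ... | shape₃ q e = trans (e 0 v)
          (cong ⁺_ (sym (ind-no (Hit? v 0) (λ p → 0≢1+n (trans (sym (proj₂ (proj₂ (hit⇒′ p)))) q)))))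

  -- The coefficients at x_i^{u+1} x_{i+1}^{v+1}, with the negative terms moved across. In the
  -- proof, the intervals `D₁` or `D₂` at the two neighbouring exponents differ only at their ends,
  -- and there the monomial or its exchange is hit.
  ∂mon-suc : ∀ u v → coeff (∂mon (suc i) μ⁺) γ[ suc u , v ] ℤ.+ ⁺ f u (suc v) ≡
                     coeff (∂mon (suc i) μ⁺) γ[ u , suc v ] ℤ.+ ⁺ f v (suc u)
  ∂mon-suc u v with shape
  ... | shape₁ b≤a e rewrite e (suc u) v | e u (suc v) =
          +-pos-cong {ind (D₁? (suc u) v)} {f u (suc v)} {ind (D₁? u (suc v))} {f v (suc u)}
            (ind-exchange (D₁? (suc u) v) (Hit? u (suc v)) (D₁? u (suc v)) (Hit? v (suc u)) ex₁ ex₂ to from)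
    where
    ex₁ : ¬ (D₁ (suc u) v × True (monEq μ γ[ u , suc v ]))
    ex₁ ((_ , (b≤v , _) , _) , p) = 1+n≰n (subst (_≤ v) (proj₂ (proj₂ (hit⇒′ p))) b≤v)
    ex₂ : ¬ (D₁ u (suc v) × True (monEq μ γ[ v , suc u ]))
    ex₂ ((_ , (_ , v<a) , _) , p) = <-irrefl (sym (proj₁ (proj₂ (hit⇒′ p)))) v<a
    to : D₁ (suc u) v ⊎ True (monEq μ γ[ u , suc v ]) → D₁ u (suc v) ⊎ True (monEq μ γ[ v , suc u ])
    to (inj₁ (o , (b≤v , v≤a) , s)) with v ≟ a
    ... | yes v≡a = inj₂ (hit⇐′ o (sym v≡a) (+-cancelˡ-≡ a _ _ (sym (trans (cong (_+ suc u) (sym v≡a)) (trans (+-comm v (suc u)) s)))))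
    ... | no v≢a = inj₁ (o , (m≤n⇒m≤1+n b≤v , ≤∧≢⇒< v≤a v≢a) , trans (+-suc u v) s)
    to (inj₂ p) with hit⇒′ p
    ... | o , e₁ , e₂ = inj₁ (o , (≤-reflexive e₂ , subst (_≤ a) e₂ b≤a) , cong₂ _+_ (sym e₁) (sym e₂))
    from : D₁ u (suc v) ⊎ True (monEq μ γ[ v , suc u ]) → D₁ (suc u) v ⊎ True (monEq μ γ[ u , suc v ])
    from (inj₁ (o , (b≤sv , v<a) , s)) with b ≟ suc v
    ... | yes q = inj₂ (hit⇐′ o (+-cancelʳ-≡ (suc v) _ _ (trans (cong (a +_) (sym q)) (sym s))) q)
    ... | no ne = inj₁ (o , (≤-pred (≤∧≢⇒< b≤sv ne) , <⇒≤ v<a) , trans (sym (+-suc u v)) s)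
    from (inj₂ p) with hit⇒′ p
    ... | o , e₁ , e₂ = inj₁ (o , (subst (b ≤_) e₁ b≤a , ≤-reflexive (sym e₁)) ,
            trans (+-comm (suc u) v) (cong₂ _+_ (sym e₁) (sym e₂)))
  ... | shape₂ a<b e rewrite e (suc u) v | e u (suc v) =
          neg-exchange {ind (D₂? (suc u) v)} {f u (suc v)} {ind (D₂? u (suc v))} {f v (suc u)}
            (ind-exchange (D₂? u (suc v)) (Hit? u (suc v)) (D₂? (suc u) v) (Hit? v (suc u)) ex₁ ex₂ to from)
    where
    ex₁ : ¬ (D₂ u (suc v) × True (monEq μ γ[ u , suc v ]))
    ex₁ ((_ , (l , _) , _) , p) = <-irrefl (proj₁ (proj₂ (hit⇒′ p))) l
    ex₂ : ¬ (D₂ (suc u) v × True (monEq μ γ[ v , suc u ]))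
    ex₂ ((_ , (_ , l) , _) , p) = <-irrefl (sym (proj₂ (proj₂ (hit⇒′ p)))) l
    to : D₂ u (suc v) ⊎ True (monEq μ γ[ u , suc v ]) → D₂ (suc u) v ⊎ True (monEq μ γ[ v , suc u ])
    to (inj₁ (o , (l , u<b) , s)) with suc u ≟ b
    ... | yes q = inj₂ (hit⇐′ o (+-cancelʳ-≡ b _ _ (trans (sym s) (trans (+-suc u v) (trans (+-comm (suc u) v) (cong (v +_) q))))) (sym q))
    ... | no ne = inj₁ (o , (m≤n⇒m≤1+n l , ≤∧≢⇒< u<b ne) , trans (sym (+-suc u v)) s)
    to (inj₂ p) with hit⇒′ p
    ... | o , e₁ , e₂ = inj₁ (o , (s≤s (≤-reflexive e₁) , subst (λ t → suc t < b) e₁ a<b) ,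
            trans (sym (+-suc u v)) (cong₂ _+_ (sym e₁) (sym e₂)))
    from : D₂ (suc u) v ⊎ True (monEq μ γ[ v , suc u ]) → D₂ u (suc v) ⊎ True (monEq μ γ[ u , suc v ])
    from (inj₁ (o , (l , u<b) , s)) with a ≟ u
    ... | yes q = inj₂ (hit⇐′ o q (+-cancelˡ-≡ a _ _ (trans (sym s) (trans (sym (+-suc u v)) (cong (_+ suc v) (sym q))))))
    ... | no ne = inj₁ (o , (≤∧≢⇒< (≤-pred l) ne , <⇒≤ u<b) , trans (+-suc u v) s)
    from (inj₂ p) with hit⇒′ p
    ... | o , e₁ , e₂ = inj₁ (o , (≤-pred (subst (suc a <_) e₂ a<b) , ≤-reflexive (sym e₂)) ,
            trans (+-suc u v) (trans (+-comm (suc u) v) (cong₂ _+_ (sym e₁) (sym e₂))))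
  ... | shape₃ q e rewrite e (suc u) v | e u (suc v) =
          cong (λ t → ⁺ 0 ℤ.+ ⁺ t) (ind-⇔ (Hit? u (suc v)) (Hit? v (suc u)) flip flip)
    where
    flip : ∀ {u v} → True (monEq μ γ[ u , suc v ]) → True (monEq μ γ[ v , suc u ])
    flip p with hit⇒′ p
    ... | o , e₁ , e₂ = hit⇐′ o (suc-injective (trans (sym q) e₂)) (trans q (cong suc e₁))

private
  inc : ℕ → Mon → Mon
  inc i μ = upd0 μ i (suc (idx0 μ i))

  π-cons : ∀ i c μ p ν → coeff (π (suc i) ((c , μ) ∷ p)) ν ≡
                         c ℤ.* coeff (∂mon (suc i) (inc i μ)) ν ℤ.+ coeff (π (suc i) p) ν
  π-cons i c μ p ν = trans
    (coeff-++ (List.map (λ { (d , ν′) → (c ℤ.* d , ν′) }) (∂mon (suc i) (inc i μ))) (π (suc i) p) ν)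
    (cong (ℤ._+ coeff (π (suc i) p) ν) (coeff-scale c (∂mon (suc i) (inc i μ)) ν))

module _ (i : ℕ) (γ : Mon) where

  private
    γ[_,_] : ℕ → ℕ → Mon
    γ[ u , v ] = set₂ i γ u v

  π-coeff-zero : ∀ p v → coeff (π (suc i) p) γ[ 0 , v ] ≡ coeff p γ[ v , 0 ]
  π-coeff-zero []            v = refl
  π-coeff-zero ((c , μ) ∷ p) v =
    trans (π-cons i c μ p γ[ 0 , v ])
      (cong₂ ℤ._+_ (trans (cong (c ℤ.*_) (∂mon-zero i μ γ v)) (sym (scaled c μ γ[ v , 0 ]))) (π-coeff-zero p v))

  π-coeff-suc : ∀ p u v →
    coeff (π (suc i) p) γ[ suc u , v ] ℤ.+ coeff p γ[ u , suc v ] ≡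
    coeff (π (suc i) p) γ[ u , suc v ] ℤ.+ coeff p γ[ v , suc u ]
  π-coeff-suc []            u v = refl
  π-coeff-suc ((c , μ) ∷ p) u v =
    trans (split γ[ suc u , v ] γ[ u , suc v ])
      (trans (cong₂ (λ s t → c ℤ.* s ℤ.+ t) (∂mon-suc i μ γ u v) (π-coeff-suc p u v))
        (sym (split γ[ u , suc v ] γ[ v , suc u ])))
    where
    regroup : ∀ c h P f F → (c ℤ.* h ℤ.+ P) ℤ.+ (c ℤ.* f ℤ.+ F) ≡ c ℤ.* (h ℤ.+ f) ℤ.+ (P ℤ.+ F)
    regroup = ℤ-Solver.solve-∀
    split : ∀ ν ν′ → coeff (π (suc i) ((c , μ) ∷ p)) ν ℤ.+ coeff ((c , μ) ∷ p) ν′ ≡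
      c ℤ.* (coeff (∂mon (suc i) (inc i μ)) ν ℤ.+ ⁺ hit μ ν′) ℤ.+ (coeff (π (suc i) p) ν ℤ.+ coeff p ν′)
    split ν ν′ = trans (cong₂ ℤ._+_ (π-cons i c μ p ν) (cong (ℤ._+ coeff p ν′) (scaled c μ ν′)))
      (regroup c (coeff (∂mon (suc i) (inc i μ)) ν) (coeff (π (suc i) p) ν) (⁺ hit μ ν′) (coeff p ν′))

  -- The two relations determine all coefficients by induction on the exponent of x_i, so any `H`
  -- that satisfies them gives the coefficients of π_i p.
  π-coeff : ∀ p (F H : ℕ → ℕ → ℕ) → (∀ u v → coeff p γ[ u , v ] ≡ ⁺ F u v) →
            (∀ v → H 0 v ≡ F v 0) → (∀ u v → H (suc u) v + F u (suc v) ≡ H u (suc v) + F v (suc u)) →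
            ∀ u v → coeff (π (suc i) p) γ[ u , v ] ≡ ⁺ H u v
  π-coeff p F H eF h₀ hₛ zero    v = trans (π-coeff-zero p v) (trans (eF v 0) (cong ⁺_ (sym (h₀ v))))
  π-coeff p F H eF h₀ hₛ (suc u) v = ℤ-cancelʳ (⁺ F u (suc v)) (coeff (π (suc i) p) γ[ suc u , v ]) (⁺ H (suc u) v)
    (trans (cong (ℤ._+_ (coeff (π (suc i) p) γ[ suc u , v ])) (sym (eF u (suc v))))
      (trans (π-coeff-suc p u v)
        (trans (cong₂ ℤ._+_ (π-coeff p F H eF h₀ hₛ u (suc v)) (eF v (suc u)))
          (+-pos-cong {H u (suc v)} {F v (suc u)} {H (suc u) v} {F u (suc v)} (sym (hₛ u v))))))

-- Key polynomials

G-zero : ∀ B {n} m g (T : _) {L} → (∀ w → L w ≡ 0) → G B {n} m g T L ≡ 0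
G-zero B zero    g T {L} e = trans (cong (ind (Supp? (λ _ → 0) T) *_) (e _)) (*-zeroʳ (ind (Supp? (λ _ → 0) T)))
G-zero B (suc m) g T {L} e = ind*-zero (Supp? g T) (λ _ →
  S-zero B m (pred ∘ g) T (L ⊕ cnt T) (λ N _ → G-zero B m (pred ∘ g) N (λ w → e _)))

G-shape-cong : ∀ B {n} m {g h : ℕ → ℕ} → (∀ r → g r ≡ h r) → ∀ T L → G B {n} m g T L ≡ G B m h T L
G-shape-cong B     zero    e T L = refl
G-shape-cong B {n} (suc m) {g} {h} e T L = cong₂ _*_
  (ind-⇔ (Supp? g T) (Supp? h T)
    (supp-cong T (λ r → subst (Same (g r)) (e r) (same-refl (g r))))
    (supp-cong T (λ r → subst (λ x → Same x (g r)) (e r) (same-refl (g r)))))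
  (∑-cong (cols n B) (λ N → cong (ind (Adj? N T) *_) (G-shape-cong B m (cong pred ∘ e) N (L ⊕ cnt T))))

Φ-cong : ∀ B n m g b {L L′} → (∀ w → L w ≡ L′ w) → Φ B n m g b L ≡ Φ B n m g b L′
Φ-cong B n m g b e = ∑-cong (cols n B) (λ T → cong (ind (LE? b T) *_) (G-cong B m g T e))

Φ-shape-cong : ∀ B n m {g h} b L → (∀ r → g r ≡ h r) → Φ B n m g b L ≡ Φ B n m h b L
Φ-shape-cong B n m b L e = ∑-cong (cols n B) (λ T → cong (ind (LE? b T) *_) (G-shape-cong B m e T L))

test-cong : ∀ B {c c′ : ℕ → ℕ} → (∀ k → c k ≡ c′ k) → ∀ w → test B c w ≡ test B c′ w
test-cong B e w = ind-⇔ (allUpTo? _ B) (allUpTo? _ B) (λ f l → trans (f l) (e _)) (λ f l → trans (f l) (sym (e _)))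

τ-< : ∀ i B → suc i < B → ∀ {k} → k < B → τ i k < B
τ-< i B i<B {k} k<B with τ i k | τ-view i k
... | _ | fst-view       = i<B
... | _ | snd-view       = <-trans (n<1+n i) i<B
... | _ | other-view _ _ = k<B

module _ (B n m : ℕ) (g : ℕ → ℕ) (i : ℕ) (i<B : suc i < B) (γ : Mon) where

  private
    δ : ℕ → ℕ
    δ k = ind (k ≟ i)

    t : ℕ → ℕ → Test
    t u v = test B (idx0 (set₂ i γ u v))

    t-ext : ∀ u v → Ext (t u v)
    t-ext u v = test-ext B (idx0 (set₂ i γ u v))

    set₂-swap : ∀ u v k → idx0 (set₂ i γ u v) (τ i k) ≡ idx0 (set₂ i γ v u) k
    set₂-swap u v k with τ i k | τ-view i k
    ... | _ | fst-view       = trans (set₂-snd i γ u v) (sym (set₂-fst i γ v u))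
    ... | _ | snd-view       = trans (set₂-fst i γ u v) (sym (set₂-snd i γ v u))
    ... | _ | other-view p q = trans (set₂-other i γ u v k p q) (sym (set₂-other i γ v u k p q))

    t-swap : ∀ u v w → swapᵂ i (t u v) w ≡ t v u w
    t-swap u v w = ind-⇔ (allUpTo? _ B) (allUpTo? _ B)
      (λ f {k} l → trans (cong w (sym (τ-invol i k))) (trans (f (τ-< i B i<B l)) (set₂-swap u v k)))
      (λ f {k} l → trans (f (τ-< i B i<B l)) (trans (sym (set₂-swap u v (τ i k))) (cong (idx0 (set₂ i γ u v)) (τ-invol i k))))

    set₂-δ : ∀ u v k → δ k + idx0 (set₂ i γ u v) k ≡ idx0 (set₂ i γ (suc u) v) k
    set₂-δ u v = at-pair i _ _
      (trans (cong₂ _+_ (ind-yes (i ≟ i) refl) (set₂-fst i γ u v)) (sym (set₂-fst i γ (suc u) v)))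
      (trans (cong₂ _+_ (ind-no (suc i ≟ i) 1+n≢n) (set₂-snd i γ u v)) (sym (set₂-snd i γ (suc u) v)))
      (λ j p q → trans (cong₂ _+_ (ind-no (j ≟ i) p) (set₂-other i γ u v j p q)) (sym (set₂-other i γ (suc u) v j p q)))

    -- Multiplying a series by x_a and reading at exponent u+1 is reading the series itself at u.
    t-δ : ∀ u v w → (t (suc u) v ⊕ δ) w ≡ t u v w
    t-δ u v w = ind-⇔ (allUpTo? _ B) (allUpTo? _ B)
      (λ f {k} l → +-cancelˡ-≡ (δ k) _ _ (trans (f l) (sym (set₂-δ u v k))))
      (λ f {k} l → trans (cong (δ k +_) (f l)) (set₂-δ u v k))

    t-δ-zero : ∀ v w → (t 0 v ⊕ δ) w ≡ 0
    t-δ-zero v w = ind-no (allUpTo? _ B) (λ f →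
      0≢1+n (trans (sym (trans (f (<-trans (n<1+n i) i<B)) (set₂-fst i γ 0 v))) (cong (_+ w i) (ind-yes (i ≟ i) refl))))

    raised-cong : ∀ {L L′} → (∀ w → L w ≡ L′ w) → raised B i i<B n m g L ≡ raised B i i<B n m g L′
    raised-cong e = ∑-cong (cols n B) (λ T → cong (ind (LE? (raise i) T ×-dec ¬? (LE? suc T)) *_) (G-cong B m g T e))

    R F H : ℕ → ℕ → ℕ
    R u v = raised B i i<B n m g (t u v)
    F u v = Φ B n m g suc (t u v)
    H u v = Φ B n m g (raise i) (t u v)

    R-swap : ∀ u v → raised B i i<B n m g (t u (suc v) ⊕ δ) ≡ R v u
    R-swap u v = trans (raised-sym B i i<B n m g (t-ext u (suc v)))
      (raised-cong (λ w → trans (t-swap u (suc v) (λ k → δ k + w k)) (t-δ v u w)))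

    R-sym : ∀ u v → R u (suc v) ≡ R v (suc u)
    R-sym u v = trans (sym (raised-cong (t-δ u (suc v)))) (R-swap (suc u) v)

    -- Every term of x_a R contains x_a, hence by symmetry also x_{a+1}; so R has no term free of
    -- x_{a+1}.
    R-zero : ∀ v → R v 0 ≡ 0
    R-zero v = trans (sym (R-swap 0 v))
      (∑-zero (cols n B) (λ T → trans (cong (ind (LE? (raise i) T ×-dec ¬? (LE? suc T)) *_) (G-zero B m g T (t-δ-zero (suc v))))
        (*-zeroʳ (ind (LE? (raise i) T ×-dec ¬? (LE? suc T))))))

    H-sym : ∀ u v → H u v ≡ H v u
    H-sym u v = trans (Φ-raise-sym B i i<B n m g (t-ext u v)) (Φ-cong B n m g (raise i) (t-swap u v))

    H-split : ∀ u v → H u v ≡ F u v + R u v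
    H-split u v = Φ-raise-split B i i<B n m g (t u v)

  π-Φ : ∀ p → (∀ u v → coeff p (set₂ i γ u v) ≡ ⁺ Φ B n m g suc (test B (idx0 (set₂ i γ u v)))) →
        coeff (π (suc i) p) γ ≡ ⁺ Φ B n m g (raise i) (test B (idx0 γ))
  π-Φ p e = trans (coeff-cong (π (suc i) p) (sym ∘ self))
    (trans (π-coeff i γ p F H e h₀ hₛ (idx0 γ i) (idx0 γ (suc i)))
      (cong ⁺_ (Φ-cong B n m g (raise i) (test-cong B self))))
    where
    self : ∀ k → idx0 (set₂ i γ (idx0 γ i) (idx0 γ (suc i))) k ≡ idx0 γ k
    self = at-pair i _ _ (set₂-fst i γ _ _) (set₂-snd i γ _ _) (set₂-other i γ _ _)
    h₀ : ∀ v → H 0 v ≡ F v 0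
    h₀ v = trans (H-sym 0 v) (trans (H-split v 0) (trans (cong (F v 0 +_) (R-zero v)) (+-identityʳ (F v 0))))
    -- Symmetry of `H` gives H(u+1,v) = F(v,u+1) + R(v,u+1), which is compared with H(u,v+1) =
    -- F(u,v+1) + R(u,v+1); the two values of `R` agree by `R-sym`.
    hₛ : ∀ u v → H (suc u) v + F u (suc v) ≡ H u (suc v) + F v (suc u)
    hₛ u v = trans (cong (_+ F u (suc v)) (trans (H-sym (suc u) v) (H-split v (suc u))))
      (trans (rotate (F v (suc u)) (R v (suc u)) (F u (suc v)))
        (cong (_+ F v (suc u)) (trans (cong (F u (suc v) +_) (R-sym v u)) (sym (H-split u (suc v))))))
      where
      rotate : ∀ x y z → x + y + z ≡ z + y + x
      rotate x y z = trans (+-comm (x + y) z) (trans (cong (z +_) (+-comm x y)) (sym (+-assoc z y x)))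

-- Ascents of a composition as the measure of the key recursion

·s-idx0 : ∀ β j k → idx0 (β ·s suc j) k ≡ idx0 β (τ j k)
·s-idx0 β j k with τ j k | τ-view j k
... | _ | fst-view       = set₂-fst j β _ _
... | _ | snd-view       = set₂-snd j β _ _
... | _ | other-view p q = set₂-other j β _ _ k p q

idx0-<-length : ∀ β {x} k → x < idx0 β k → k < length β
idx0-<-length (y ∷ β) zero    l = z<s
idx0-<-length (y ∷ β) (suc k) l = s<s (idx0-<-length β k l)

·s-length : ∀ β j → suc j < length β → length (β ·s suc j) ≡ length β
·s-length (x ∷ [])    zero    (s≤s ())
·s-length (x ∷ y ∷ β) zero    l = refl
·s-length (x ∷ β)     (suc j) l = cong suc (·s-length β j (s<s⁻¹ l))

larger : ℕ → List ℕ → ℕ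
larger x []       = 0
larger x (y ∷ ys) = ind (x <? y) + larger x ys

-- Counts all pairs in increasing order, adjacent or not. This is the length of the minimal
-- permutation that sorts the list into a partition, hence the amount of fuel that the recursion
-- consumes.
ascents : List ℕ → ℕ
ascents []       = 0
ascents (x ∷ xs) = larger x xs + ascents xs

larger-·s : ∀ x β j → suc j < length β → larger x (β ·s suc j) ≡ larger x β
larger-·s x (y ∷ [])    zero    (s≤s ())
larger-·s x (y ∷ z ∷ β) zero    l =
  x∙yz≈y∙xz (ind (x <? z)) (ind (x <? y)) (larger x β)
larger-·s x (y ∷ β)     (suc j) l = cong (ind (x <? y) +_) (larger-·s x β j (s<s⁻¹ l))

ascents-·s : ∀ β j → idx0 β j < idx0 β (suc j) → suc (ascents (β ·s suc j)) ≡ ascents β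
ascents-·s (x ∷ y ∷ β) zero l = begin
  suc (ind (y <? x) + larger y β + (larger x β + ascents β))
    ≡⟨ cong (λ e → suc (e + larger y β + (larger x β + ascents β))) (ind-no (y <? x) (<-asym l)) ⟩
  suc (larger y β + (larger x β + ascents β))
    ≡⟨ cong suc (x∙yz≈y∙xz (larger y β) (larger x β) (ascents β)) ⟩
  suc (larger x β) + (larger y β + ascents β)
    ≡⟨ cong (λ e → e + larger x β + (larger y β + ascents β)) (sym (ind-yes (x <? y) l)) ⟩
  ind (x <? y) + larger x β + (larger y β + ascents β) ∎
  where open ≡-Reasoning
ascents-·s (x ∷ β) (suc j) l =
  trans (sym (+-suc (larger x (β ·s suc j)) _))
    (cong₂ _+_ (larger-·s x β j (idx0-<-length β (suc j) l)) (ascents-·s β j l))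

larger-≤ : ∀ x ys → larger x ys ≤ length ys
larger-≤ x []       = z≤n
larger-≤ x (y ∷ ys) = +-mono-≤ (ind-≤ (x <? y)) (larger-≤ x ys)
  where
  ind-≤ : ∀ {P : Set} (d : Dec P) → ind d ≤ 1
  ind-≤ (yes _) = ≤-refl
  ind-≤ (no _)  = z≤n

ascents-≤ : ∀ β → ascents β ≤ length β * length β
ascents-≤ []      = z≤n
ascents-≤ (x ∷ β) = ≤-trans (+-mono-≤ (larger-≤ x β) (ascents-≤ β))
  (≤-trans (+-monoʳ-≤ (length β) (*-monoʳ-≤ (length β) (n≤1+n (length β)))) (n≤1+n _))

firstAscent-just : ∀ β {i} → firstAscent β ≡ just i → ∃ λ j → i ≡ suc j × idx0 β j < idx0 β (suc j)
firstAscent-just (x ∷ y ∷ β) {i} = step (firstAscent-just (y ∷ β))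
  where
  step : (∀ {i} → firstAscent (y ∷ β) ≡ just i → ∃ λ j → i ≡ suc j × idx0 (y ∷ β) j < idx0 β j) →
         firstAscent (x ∷ y ∷ β) ≡ just i → ∃ λ j → i ≡ suc j × idx0 (x ∷ y ∷ β) j < idx0 (y ∷ β) j
  step rec e with x <ᵇ y in l
  ... | true  = 0 , sym (just-injective e) , <ᵇ⇒< x y (Equivalence.from BP.T-≡ l)
  ... | false with firstAscent (y ∷ β)
  ...   | just k with rec refl
  ...     | j , refl , l′ = suc j , sym (just-injective e) , l′

firstAscent-nothing : ∀ β → firstAscent β ≡ nothing → ∀ k → idx0 β (suc k) ≤ idx0 β k
firstAscent-nothing []          e k       = z≤n
firstAscent-nothing (x ∷ [])    e k       = z≤n
firstAscent-nothing (x ∷ y ∷ β) e k with x <ᵇ y in l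
firstAscent-nothing (x ∷ y ∷ β) e k | false with firstAscent (y ∷ β) in e′
firstAscent-nothing (x ∷ y ∷ β) e zero    | false | nothing =
  ≮⇒≥ (λ l′ → subst True l (<⇒<ᵇ l′))
firstAscent-nothing (x ∷ y ∷ β) e (suc k) | false | nothing = firstAscent-nothing (y ∷ β) e′ k

ascents-0 : ∀ β → ascents β ≡ 0 → firstAscent β ≡ nothing
ascents-0 β e with firstAscent β in eq
... | nothing = refl
... | just i with firstAscent-just β eq
...   | j , refl , l = ⊥-elim (0≢1+n (trans (sym e) (sym (ascents-·s β j l))))

module _ (B n m : ℕ) (n≤B : n ≤ B) where

  private
    Key-Φ : List ℕ → Poly → Set
    Key-Φ β p = ∀ γ → (∀ k → B ≤ k → idx0 γ k ≡ 0) → coeff p γ ≡ ⁺ Φ B n m (idx0 β) suc (test B (idx0 γ))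

    monomial-Φ : ∀ β → length β ≡ n → (∀ r → idx0 β r ≤ m) → firstAscent β ≡ nothing → Key-Φ β (monomial β)
    monomial-Φ β refl βm e γ bγ = trans (value (monEq β γ)) (cong ⁺_ (trans
      (ind-⇔ (BP.T? (monEq β γ)) (allUpTo? (λ k → idx0 β k ≟ idx0 γ k) B)
        (λ h {k} _ → monEq-sound β γ h k) (λ f → monEq-complete β γ (agree f)))
      (sym (Φ-partition n B n≤B m (idx0 β) dec (idx0-≥ β) βm (test-ext B (idx0 γ))))))
      where
      value : ∀ b → (if b then ⁺ 1 else ⁺ 0) ℤ.+ ⁺ 0 ≡ ⁺ ind (BP.T? b)
      value true  = refl
      value false = refl
      agree : (∀ {k} → k < B → idx0 β k ≡ idx0 γ k) → ∀ k → idx0 β k ≡ idx0 γ k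
      agree f k with k <? B
      ... | yes l = f l
      ... | no ¬l = trans (idx0-≥ β k (≤-trans n≤B (≮⇒≥ ¬l))) (sym (bγ k (≮⇒≥ ¬l)))
      dec : ∀ {j k} → j ≤ k → idx0 β k ≤ idx0 β j
      dec {j} j≤k with m≤n⇒∃[o]m+o≡n j≤k
      ... | o , refl = down o
        where
        down : ∀ o → idx0 β (j + o) ≤ idx0 β j
        down zero    = ≤-reflexive (cong (idx0 β) (+-identityʳ j))
        down (suc o) = ≤-trans (≤-reflexive (cong (idx0 β) (+-suc j o)))
          (≤-trans (firstAscent-nothing β e (j + o)) (down o))

  -- At the ascent `j` the operator raises the bound of row `j` to that of row `j + 1`. Equal bounds
  -- allow the rows to be exchanged, which turns `β′` into `β`; there row `j` is the shorter one, so
  -- its bound can be lowered back to the identity flag.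
  keyAux-Φ : ∀ f β → ascents β ≤ f → length β ≡ n → (∀ r → idx0 β r ≤ m) → Key-Φ β (keyAux f β)
  keyAux-Φ zero    β a len βm = monomial-Φ β len βm (ascents-0 β (n≤0⇒n≡0 a))
  keyAux-Φ (suc f) β a len βm with firstAscent β in eq
  ... | nothing = monomial-Φ β len βm eq
  ... | just i with firstAscent-just β eq
  ...   | j , refl , l = λ γ bγ → trans (π-Φ B n m g j j<B γ (keyAux f β′) (λ u v → ih (set₂ j γ u v) (bγ′ γ bγ u v)))
      (cong ⁺_ (trans (Φ-row-swap B j n m g (raise j) j<n flag gle (test-ext B (idx0 γ)))
        (trans (Φ-lower-flag B j n m (g ∘ τ j) (raise j) suc j<n (≤-trans (≤-reflexive (gτ j)) (βm j))
                 (subst₂ _≤_ (sym (gτ j)) (sym (gτ (suc j))) (<⇒≤ l)) flag (raise-self j) (λ r r≢j → sym (raise-other j r r≢j)) _)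
          (Φ-shape-cong B n m suc _ gτ))))
    where
    β′ = β ·s suc j
    g = idx0 β′
    j<len = idx0-<-length β (suc j) l
    j<n : suc j < n
    j<n = subst (suc j <_) len j<len
    j<B : suc j < B
    j<B = <-≤-trans j<n n≤B
    gτ : ∀ r → g (τ j r) ≡ idx0 β r
    gτ r = trans (·s-idx0 β j (τ j r)) (cong (idx0 β) (τ-invol j r))
    gle : g (suc j) ≤ g j
    gle = subst₂ _≤_ (sym (trans (·s-idx0 β j (suc j)) (cong (idx0 β) (τ-snd j))))
                     (sym (trans (·s-idx0 β j j) (cong (idx0 β) (τ-fst j)))) (<⇒≤ l)
    flag : raise j j ≡ raise j (suc j)
    flag = trans (raise-self j) (sym (raise-other j (suc j) 1+n≢n))
    ih : Key-Φ β′ (keyAux f β′)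
    ih = keyAux-Φ f β′ (≤-pred (≤-trans (≤-reflexive (ascents-·s β j l)) a)) (trans (·s-length β j j<len) len)
           (λ r → ≤-trans (≤-reflexive (·s-idx0 β j r)) (βm (τ j r)))
    -- The induction hypothesis is used at every exponent vector that differs from `γ` in the two
    -- exchanged positions, and both positions are below `B`.
    bγ′ : ∀ γ → (∀ k → B ≤ k → idx0 γ k ≡ 0) → ∀ u v k → B ≤ k → idx0 (set₂ j γ u v) k ≡ 0
    bγ′ γ bγ u v k B≤k = trans (set₂-other j γ u v k (λ { refl → <⇒≱ (<-trans (n<1+n j) j<B) B≤k }) (λ { refl → <⇒≱ j<B B≤k })) (bγ k B≤k)

idx0-sum : ∀ α r → idx0 α r ≤ sum α
idx0-sum []      r       = z≤n
idx0-sum (a ∷ α) zero    = m≤m+n a (sum α)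
idx0-sum (a ∷ α) (suc r) = ≤-trans (idx0-sum α r) (m≤n+m (sum α) a)

κ-Φ : ∀ B m β γ → length β ≤ B → (∀ r → idx0 β r ≤ m) → (∀ k → B ≤ k → idx0 γ k ≡ 0) →
      coeff (κ β) γ ≡ ⁺ Φ B (length β) m (idx0 β) suc (test B (idx0 γ))
κ-Φ B m β γ len βm bγ = keyAux-Φ B (length β) m len (length β * length β) β (ascents-≤ β) refl βm γ bγ

-- Strictly increasing flags

private
  _≺_ : ℕ × ℕ → ℕ × ℕ → Set
  p ≺ q = proj₂ p < proj₂ q

  sorted-unique : ∀ ps qs → AllPairs _≺_ ps → AllPairs _≺_ qs → (∀ x → x ∈ ps → x ∈ qs) → (∀ x → x ∈ qs → x ∈ ps) → ps ≡ qs
  sorted-unique []       []       _ _ f g = refl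
  sorted-unique []       (q ∷ qs) _ _ f g with g q (here refl)
  ... | ()
  sorted-unique (p ∷ ps) []       _ _ f g with f p (here refl)
  ... | ()
  sorted-unique (p ∷ ps) (q ∷ qs) (p< ∷ sp) (q< ∷ sq) f g with f p (here refl) | g q (here refl)
  ... | there p∈ | there q∈ = ⊥-elim (<-asym (AllL.lookup q< p∈) (AllL.lookup p< q∈))
  ... | here refl | _ = cong (p ∷_) (sorted-unique ps qs sp sq (λ x x∈ → tail p< x∈ (f x (there x∈))) (λ x x∈ → tail q< x∈ (g x (there x∈))))
    where
    tail : ∀ {p xs ys x} → AllL.All (p ≺_) xs → x ∈ xs → x ∈ p ∷ ys → x ∈ ys
    tail a x∈ (here refl) = ⊥-elim (<-irrefl refl (AllL.lookup a x∈))
    tail a x∈ (there y∈)  = y∈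
  ... | there p∈ | here refl = ⊥-elim (<-irrefl refl (AllL.lookup q< p∈))

  ∈-strip⁻ : ∀ n g b {x} → x ∈ strip (pairs n g b) → ∃ λ r → r < n × x ≡ (g r , b r) × g r ≢ 0
  ∈-strip⁻ (suc n) g b x∈ with g 0 in e
  ... | zero with ∈-strip⁻ n (g ∘ suc) (b ∘ suc) x∈
  ...   | r , l , q , ne = suc r , s<s l , q , ne
  ∈-strip⁻ (suc n) g b (here refl) | suc a = 0 , z<s , cong (_, b 0) (sym e) , (λ e′ → 0≢1+n (trans (sym e′) e))
  ∈-strip⁻ (suc n) g b (there x∈)  | suc a with ∈-strip⁻ n (g ∘ suc) (b ∘ suc) x∈
  ...   | r , l , q , ne = suc r , s<s l , q , ne

  ∈-strip⁺ : ∀ n g b r → r < n → g r ≢ 0 → (g r , b r) ∈ strip (pairs n g b)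
  ∈-strip⁺ (suc n) g b zero l ne with g 0
  ... | zero  = ⊥-elim (ne refl)
  ... | suc a = here refl
  ∈-strip⁺ (suc n) g b (suc r) l ne with g 0
  ... | zero  = ∈-strip⁺ n (g ∘ suc) (b ∘ suc) r (s<s⁻¹ l) ne
  ... | suc a = there (∈-strip⁺ n (g ∘ suc) (b ∘ suc) r (s<s⁻¹ l) ne)

  strip-sorted : ∀ n g b → (∀ r → b r < b (suc r)) → AllPairs _≺_ (strip (pairs n g b))
  strip-sorted zero    g b inc = []
  strip-sorted (suc n) g b inc with g 0
  ... | zero  = strip-sorted n (g ∘ suc) (b ∘ suc) (inc ∘ suc)
  ... | suc a = AllL.tabulate above ∷ strip-sorted n (g ∘ suc) (b ∘ suc) (inc ∘ suc)
    where
    climb : ∀ r → b 0 < b (suc r)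
    climb zero    = inc 0
    climb (suc r) = <-trans (climb r) (inc (suc r))
    above : ∀ {x} → x ∈ strip (pairs n (g ∘ suc) (b ∘ suc)) → b 0 < proj₂ x
    above x∈ with ∈-strip⁻ n (g ∘ suc) (b ∘ suc) x∈
    ... | r , _ , refl , _ = climb r

idx0≢0⇒< : ∀ β k → idx0 β k ≢ 0 → k < length β
idx0≢0⇒< β k ne = idx0-<-length β k (n≢0⇒n>0 ne)

-- Both lists are strictly increasing in the bound, so it suffices to compare their elements.
strip-strict : ∀ α β φ → IsFlag φ → (∀ m → 1 ≤ m → φ m < φ (suc m)) →
               (∀ i → 1 ≤ i → at β (φ i) ≡ at α i) →
               (∀ j → 1 ≤ j → (∀ i → 1 ≤ i → φ i ≢ j) → at β j ≡ 0) →
               strip (pairs (length α) (idx0 α) (φ ∘ suc)) ≡ strip (pairs (length β) (idx0 β) suc)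
strip-strict α β φ (_ , above) strict same rest =
  sorted-unique _ _ (strip-sorted (length α) (idx0 α) (φ ∘ suc) (λ r → strict (suc r) (s≤s z≤n)))
    (strip-sorted (length β) (idx0 β) suc (λ r → n<1+n (suc r))) to from
  where
  to : ∀ x → x ∈ strip (pairs (length α) (idx0 α) (φ ∘ suc)) → x ∈ strip (pairs (length β) (idx0 β) suc)
  to x x∈ with ∈-strip⁻ (length α) (idx0 α) (φ ∘ suc) x∈
  ... | r , _ , refl , ne with φ (suc r) | above (suc r) (s≤s z≤n) | same (suc r) (s≤s z≤n)
  ...   | suc j | _ | e = subst (λ a → (a , suc j) ∈ strip (pairs (length β) (idx0 β) suc)) e
            (∈-strip⁺ (length β) (idx0 β) suc j (idx0≢0⇒< β j ne′) ne′)
    where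
    ne′ : idx0 β j ≢ 0
    ne′ z = ne (trans (sym e) z)
  from : ∀ x → x ∈ strip (pairs (length β) (idx0 β) suc) → x ∈ strip (pairs (length α) (idx0 α) (φ ∘ suc))
  from x x∈ with ∈-strip⁻ (length β) (idx0 β) suc x∈
  -- Since φ(i) ≥ i, a preimage of j+1 is at most j+1, so the search for it is finite.
  ... | j , _ , refl , ne with anyUpTo? (λ r → φ (suc r) ≟ suc j) (suc j)
  ...   | no ¬h = ⊥-elim (ne (rest (suc j) (s≤s z≤n) none))
    where
    none : ∀ i → 1 ≤ i → φ i ≢ suc j
    none (suc r) _ e = ¬h (r , subst (suc r ≤_) e (above (suc r) (s≤s z≤n)) , e)
  ...   | yes (r , _ , e) = subst (_∈ strip (pairs (length α) (idx0 α) (φ ∘ suc))) (cong₂ _,_ (sym aα) e)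
            (∈-strip⁺ (length α) (idx0 α) (φ ∘ suc) r (idx0≢0⇒< α r ne′) ne′)
    where
    aα : idx0 β j ≡ idx0 α r
    aα = trans (cong (at β) (sym e)) (same (suc r) (s≤s z≤n))
    ne′ : idx0 α r ≢ 0
    ne′ z = ne (trans aα z)

flag-mono : ∀ φ → IsFlag φ → ∀ {r n} → r ≤ n → φ (suc r) ≤ φ (suc n)
flag-mono φ (inc , _) {r} {n} r≤n with m≤n⇒∃[o]m+o≡n r≤n
... | o , refl = climb o
  where
  climb : ∀ o → φ (suc r) ≤ φ (suc (r + o))
  climb zero    = ≤-reflexive (cong (φ ∘ suc) (sym (+-identityʳ r)))
  climb (suc o) = ≤-trans (climb o) (≤-trans (inc (suc (r + o)) (s≤s z≤n)) (≤-reflexive (cong (φ ∘ suc) (sym (+-suc r o)))))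

theorem4p14 : (α : List ℕ) (φ : ℕ → ℕ) → IsFlag φ →
    ((∀ m → 1 ≤ m → φ m < φ (suc m)) →
    (β : List ℕ) →
    (∀ i → 1 ≤ i → at β (φ i) ≡ at α i) →
    (∀ j → 1 ≤ j → (∀ i → 1 ≤ i → φ i ≢ j) → at β j ≡ 0) →
    κφ α φ ≈ₚ κ β)
    × ((i : ℕ) → 1 ≤ i → φ i ≡ φ (suc i) →
    (∀ j → 1 ≤ j → j < i → φ j ≢ φ (suc j)) →
    (at α i ≤ at α (suc i) → κφ α φ ≈ₚ κφ α (φ -e i))
    × (at α (suc i) < at α i → κφ α φ ≈ₚ κφ (α ·s i) (φ -e i)))
theorem4p14 α φ flag = strictCase , equalCase
  where
  strictCase : (∀ m → 1 ≤ m → φ m < φ (suc m)) → (β : List ℕ) →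
    (∀ i → 1 ≤ i → at β (φ i) ≡ at α i) →
    (∀ j → 1 ≤ j → (∀ i → 1 ≤ i → φ i ≢ j) → at β j ≡ 0) → κφ α φ ≈ₚ κ β
  strictCase strict β same rest γ =
    trans (κφ-Ψ B α φ γ (λ r l → ≤-trans (flag-mono φ flag (<⇒≤ l)) φ≤B) bγ)
      (trans (cong ⁺_ (trans (Ψ-strip (pairs (length α) (idx0 α) (φ ∘ suc)) el)
        (trans (cong (λ ps → Ψ ps L) (strip-strict α β φ flag strict same rest))
          (trans (sym (Ψ-strip (pairs (length β) (idx0 β) suc) el))
            (Ψ-Φ B (length β) (sum β) (idx0 β) suc el (idx0-sum β) (λ r l → ≤-trans l β≤B))))))
        (sym (κ-Φ B (sum β) β γ β≤B (idx0-sum β) bγ)))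
    where
    -- Large enough for the entries of tableaux of both shapes and for the support of `γ`.
    B = φ (suc (length α)) + (length β + length γ)
    φ≤B : φ (suc (length α)) ≤ B
    φ≤B = m≤m+n _ _
    β≤B : length β ≤ B
    β≤B = ≤-trans (m≤m+n (length β) (length γ)) (m≤n+m _ (φ (suc (length α))))
    bγ : ∀ k → B ≤ k → idx0 γ k ≡ 0
    bγ k l = idx0-≥ γ k (≤-trans (≤-trans (m≤n+m (length γ) (length β)) (m≤n+m _ (φ (suc (length α))))) l)
    L = test B (idx0 γ)
    el = test-ext B (idx0 γ)
  equalCase : (i : ℕ) → 1 ≤ i → φ i ≡ φ (suc i) → (∀ j → 1 ≤ j → j < i → φ j ≢ φ (suc j)) →
    (at α i ≤ at α (suc i) → κφ α φ ≈ₚ κφ α (φ -e i)) ×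
    (at α (suc i) < at α i → κφ α φ ≈ₚ κφ (α ·s i) (φ -e i))
  equalCase (suc j) _ e _ = ascending , descending
    where
    α′ = α ·s suc j
    φ′ = φ -e suc j
    -- Both shapes are padded to `N` rows, so that the two rows concerned exist even when `α` is
    -- shorter.
    N = suc (suc j) + (length α + length α′)
    j<N : suc j < N
    j<N = m≤m+n (suc (suc j)) _
    α≤N : length α ≤ N
    α≤N = ≤-trans (m≤m+n (length α) (length α′)) (m≤n+m _ (suc (suc j)))
    α′≤N : length α′ ≤ N
    α′≤N = ≤-trans (m≤n+m (length α′) (length α)) (m≤n+m _ (suc (suc j)))
    m = sum α
    φ′-other : ∀ r → r ≢ j → φ′ (suc r) ≡ φ (suc r)
    φ′-other r r≢j with r ≡ᵇ j in q
    ... | false = refl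
    ... | true  = ⊥-elim (r≢j (≡ᵇ⇒≡ r j (Equivalence.from BP.T-≡ q)))
    φ′-self : φ′ (suc j) ≡ φ (suc j) ∸ 1
    φ′-self rewrite Equivalence.to BP.T-≡ (≡⇒≡ᵇ j j refl) = refl
    φ-suc : φ (suc j) ≡ suc (φ′ (suc j))
    φ-suc rewrite φ′-self with φ (suc j) | proj₂ flag (suc j) (s≤s z≤n)
    ... | suc x | _ = refl
    φ′≤φ : ∀ r → φ′ (suc r) ≤ φ (suc r)
    φ′≤φ r with r ≡ᵇ j
    ... | true  = m∸n≤m (φ (suc r)) 1
    ... | false = ≤-refl
    α′-idx0 = ·s-idx0 α j
    α′m : ∀ r → idx0 α′ r ≤ m
    α′m r = ≤-trans (≤-reflexive (α′-idx0 r)) (idx0-sum α (τ j r))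
    module _ (γ : Mon) where
      B = φ (suc N) + length γ
      L = test B (idx0 γ)
      φB : ∀ r → r < N → φ (suc r) ≤ B
      φB r l = ≤-trans (flag-mono φ flag (<⇒≤ l)) (m≤m+n _ _)
      φ′B : ∀ r → r < N → φ′ (suc r) ≤ B
      φ′B r l = ≤-trans (φ′≤φ r) (φB r l)
      bγ : ∀ k → B ≤ k → idx0 γ k ≡ 0
      bγ k l = idx0-≥ γ k (≤-trans (m≤n+m (length γ) (φ (suc N))) l)
      lower : ∀ g → (∀ r → g r ≤ m) → g j ≤ g (suc j) → Φ B N m g (φ ∘ suc) L ≡ Φ B N m g (φ′ ∘ suc) L
      lower g gm le = Φ-lower-flag B j N m g (φ ∘ suc) (φ′ ∘ suc) j<N (gm j) le e φ-suc φ′-other L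
    ascending : idx0 α j ≤ idx0 α (suc j) → κφ α φ ≈ₚ κφ α φ′
    ascending le γ =
      trans (κφ-Φ (B γ) N m α φ γ α≤N (idx0-sum α) (φB γ) (bγ γ))
        (trans (cong ⁺_ (lower γ (idx0 α) (idx0-sum α) le))
          (sym (κφ-Φ (B γ) N m α φ′ γ α≤N (idx0-sum α) (φ′B γ) (bγ γ))))
    descending : idx0 α (suc j) < idx0 α j → κφ α φ ≈ₚ κφ α′ φ′
    descending l γ =
      trans (κφ-Φ (B γ) N m α φ γ α≤N (idx0-sum α) (φB γ) (bγ γ))
        (trans (cong ⁺_ (trans (Φ-row-swap (B γ) j N m (idx0 α) (φ ∘ suc) j<N e (<⇒≤ l) (test-ext (B γ) (idx0 γ)))
          (trans (Φ-shape-cong (B γ) N m (φ ∘ suc) (L γ) (sym ∘ α′-idx0))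
            (lower γ (idx0 α′) α′m (subst₂ _≤_
              (sym (trans (α′-idx0 j) (cong (idx0 α) (τ-fst j))))
              (sym (trans (α′-idx0 (suc j)) (cong (idx0 α) (τ-snd j)))) (<⇒≤ l))))))
          (sym (κφ-Φ (B γ) N m α′ φ′ γ α′≤N α′m (φ′B γ) (bγ γ))))
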